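{- Let $n$ be a non-zero integer. Let $D_{2,n}(N)$, $D_{3,n}(N)$ be the numbers of $D(n)$-pairs, respectively $D(n)$-triples, with all elements in $\{1,2,\dots,N\}$, and let $D_{3,n}^{\mathrm{reg}}(N)$ be the number of regular $D(n)$-triples $\{a,b,c\}$ with $a<b<c\le N$. Then, as $N\to\infty$, \[ D_{3,n}(N)\sim D_{3,n}^{\mathrm{reg}}(N)\sim\frac{D_{2,n}(N)}{2}. \]
   Context: For a non-zero integer $n$, a $D(n)$-pair (resp. $D(n)$-triple) is a set of two (resp. three) distinct positive integers such that the product of any two of them plus $n$ is a perfect square. A $D(n)$-triple $\{a,b,c\}$ with $a<b<c$ is regular if $c=a+b+2r$, where $r\ge0$ and $r^2=ab+n$; otherwise it is irregular. -}

module Defs where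

open import Data.Nat using (ℕ; zero; suc; _+_; _*_; _≤_; _<ᵇ_; _≡ᵇ_; ∣_-_∣)
open import Data.Integer as ℤ using (ℤ; +_; -[1+_])
open import Data.Bool using (Bool; true; false; if_then_else_; _∧_)
open import Data.List using (List; map; upTo)
open import Data.Bool.ListAction using (any)
open import Data.Nat.ListAction using (sum)
open import Data.Product using (∃; Σ)

isSquareᵇ : ℤ → Bool
isSquareᵇ (+ m)    = any (λ r → (r * r) ≡ᵇ m) (upTo (suc m))
isSquareᵇ -[1+ _ ] = false

range : ℕ → List ℕ
range N = map suc (upTo N)

sqCond : ℤ → ℕ → ℕ → Bool
sqCond n x y = isSquareᵇ ((+ (x * y)) ℤ.+ n)

isPairᵇ : ℤ → ℕ → ℕ → Bool
isPairᵇ n a b = (a <ᵇ b) ∧ sqCond n a b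

isTripleᵇ : ℤ → ℕ → ℕ → ℕ → Bool
isTripleᵇ n a b c = (a <ᵇ b) ∧ (b <ᵇ c) ∧ sqCond n a b ∧ sqCond n a c ∧ sqCond n b c

-- regularity: c = a + b + 2r for some r ≥ 0 with r² = ab + n
-- (such r satisfies r ≤ c, so searching r ∈ {0,…,c} is exhaustive)
isRegularᵇ : ℤ → ℕ → ℕ → ℕ → Bool
isRegularᵇ n a b c =
  any (λ r → isSquareEqᵇ r ∧ (c ≡ᵇ (a + b + 2 * r))) (upTo (suc c))
  where
  isSquareEqᵇ : ℕ → Bool
  isSquareEqᵇ r with (+ (a * b)) ℤ.+ n
  ... | + m      = (r * r) ≡ᵇ m
  ... | -[1+ _ ] = false

one : Bool → ℕ
one b = if b then 1 else 0

D2 : ℤ → ℕ → ℕ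
D2 n N = sum (map (λ a → sum (map (λ b → one (isPairᵇ n a b)) (range N))) (range N))

D3 : ℤ → ℕ → ℕ
D3 n N = sum (map (λ a → sum (map (λ b → sum (map (λ c →
  one (isTripleᵇ n a b c)) (range N))) (range N))) (range N))

D3reg : ℤ → ℕ → ℕ
D3reg n N = sum (map (λ a → sum (map (λ b → sum (map (λ c →
  one (isTripleᵇ n a b c ∧ isRegularᵇ n a b c)) (range N))) (range N))) (range N))

-- Asymptotic equivalence f ~ g (f N / g N → 1), in natural-number form:
-- for every k, eventually (k+1)·|f N − g N| ≤ g N, i.e. |f N/g N − 1| ≤ 1/(k+1).
_∼_ : (ℕ → ℕ) → (ℕ → ℕ) → Set
f ∼ g = ∀ (k : ℕ) → ∃ λ N₀ → ∀ N → N₀ ≤ N → suc k * ∣ f N - g N ∣ ≤ g N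

{-# OPTIONS --safe #-}

-- A pair {a, c} with a < c is a square root s of n modulo c. The roots s and c − s belong to two pairs which
-- together with c form a regular triple, so 2 · D3reg and D2 differ by O(1), and by N + O(1) if n is a square.
--
-- An irregular triple {a, b, c} descends to e ≥ 1 such that a e + n² and b e + n² are squares and a b e = O(c).
-- Sort a, b, e as p ≤ q ≤ z and write p q + m = w², p z + m′ = x² with m, m′ ∈ {n, n²}. The triple is determined
-- by (w, p, x) up to finitely many choices. The size constraints alone leave O(N) such codes, and p ∣ x² − m′
-- reduces this to o(N), since a long interval contains few roots of a quadratic congruence.
--
-- Conversely, coprime x, y give the root x / y of n modulo b = x² − n y². A positive proportion of all (x, y)
-- is coprime, so D2 grows at least linearly, and faster than linearly if n is a square.
module Submission where

open import Defs
open import Data.Bool using (Bool; true; false; T; _∧_; not; if_then_else_)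
open import Data.Bool.Properties using (T-∧)
open import Data.Empty using (⊥; ⊥-elim)
open import Data.Integer as ℤ using (ℤ; +_; -[1+_]; 0ℤ; ∣_∣)
  renaming (_+_ to _+ᶻ_; _*_ to _*ᶻ_; _-_ to _-ᶻ_; -_ to -ᶻ_)
open import Data.Integer.DivMod using (_%ℕ_; _/ℕ_; n%ℕd<d; a≡a%ℕn+[a/ℕn]*n)
import Data.Integer.Divisibility.Signed as ℤ
import Data.Integer.Properties as ℤ
import Data.Integer.Tactic.RingSolver as ℤSolver
import Algebra.Properties.AbelianGroup ℤ.+-0-abelianGroup as ℤ+
open import Data.List using (List; []; _∷_; map; upTo; _++_; length)
open import Data.List.Membership.Propositional using (_∈_; lose; find)
open import Data.List.Membership.Propositional.Properties
  using (∈-map⁺; ∈-map⁻; ∈-++⁺ˡ; ∈-++⁺ʳ; ∈-++⁻; ∈-∃++; ∈-upTo⁺; ∈-upTo⁻)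
open import Data.List.Properties
  using (map-++; map-cong; map-∘; upTo-∷ʳ; length-++; length-map; length-upTo)
open import Data.List.Relation.Unary.All as All using ([]; _∷_)
open import Data.List.Relation.Unary.AllPairs using ([]; _∷_)
open import Data.List.Relation.Unary.Any using (here; there; any?; satisfied)
open import Data.List.Relation.Unary.Any.Properties using (any⁺; any⁻)
open import Data.List.Relation.Unary.Unique.Propositional using (Unique)
import Data.List.Relation.Unary.Unique.Propositional.Properties as Unique
open import Data.Nat as ℕ hiding (∣_-_∣)
open import Data.Nat.Coprimality as Coprime using (Coprime; coprime?; coprime-divisor; coprime-Bézout)
open import Data.Nat.DivMod using (m/n*n≤m; m*n/n≡m; /-monoˡ-≤)
open import Data.Nat.Divisibility
open import Data.Nat.GCD using (gcd; gcd[m,n]∣m; gcd[m,n]∣n; gcd[m,n]≢0; module Bézout)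
open import Data.Nat.Induction using (<-wellFounded)
open import Data.Nat.ListAction using (sum)
open import Data.Nat.ListAction.Properties using (sum-++)
open import Data.Nat.Properties
open import Data.Nat.Tactic.RingSolver using (solve-∀)
open import Data.Product using (∃; _×_; _,_; proj₁; proj₂)
open import Data.Product.Properties using (,-injective)
open import Data.Sum using (_⊎_; inj₁; inj₂)
open import Function using (_∘_; const; Equivalence)
open import Induction.WellFounded using (Acc; acc)
open import Relation.Binary.Definitions using (tri<; tri≈; tri>)
open import Relation.Binary.PropositionalEquality
open import Relation.Nullary
  using (¬_; yes; no; contradiction; ⌊_⌋; toWitness; fromWitness; toWitnessFalse)

open Equivalence using (to; from)

-- Counting over lists

-- The lower bound for pairs is only linear in general, and so is the number of codes that the sizes
-- allow; a further factor has to be gained. It comes from a window H: beyond modulus 2 H³, the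
-- roots of x² ≡ m with no other root less than H after them, and the remaining roots as well, fill
-- only O(1 / H) of a long interval. As H is free, this yields o(N) without divisor estimates.
--
-- The number e is n (a + b + c) + 2 a b c - 2 r s t, where r, s, t are the roots of the three
-- pairs. Switching the sign of r s t gives the conjugate e + 4 r s t, and their product is n² ((c -
-- a - b)² - 4 r²). So e = 0 only if c = a + b ± 2 r, and e is small because its conjugate is large.
--
-- In the lower bound, two coprime points (x, y) and (x′, y′) must not give the same b with the same
-- root. If they do, b divides x y′ - x′ y, and the points agree once this number is 0. Non-zero
-- multiples of b are excluded by size for a form with positive coefficients, and by infinite
-- descent for the split form u (u + 2 t y), whose hyperbolic region contains more than O(N) points.

private variable
  X Y : Set

card : (X → Bool) → List X → ℕ
card P xs = sum (map (one ∘ P) xs)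

one-T : ∀ {b} → T b → one b ≡ 1
one-T {true} _ = refl

one≤1 : ∀ b → one b ≤ 1
one≤1 true  = ≤-refl
one≤1 false = z≤n

sum-map-+ : (f g : X → ℕ) (xs : List X) →
            sum (map (λ x → f x + g x) xs) ≡ sum (map f xs) + sum (map g xs)
sum-map-+ f g [] = refl
sum-map-+ f g (x ∷ xs) rewrite sum-map-+ f g xs =
  exchange (f x) (g x) (sum (map f xs)) (sum (map g xs))
  where
  exchange : ∀ a b c d → a + b + (c + d) ≡ a + c + (b + d)
  exchange = solve-∀

sum-map-* : ∀ c (f : X → ℕ) (xs : List X) → sum (map (λ x → c * f x) xs) ≡ c * sum (map f xs)
sum-map-* c f [] = sym (*-zeroʳ c)
sum-map-* c f (x ∷ xs) rewrite sum-map-* c f xs = sym (*-distribˡ-+ c (f x) _)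

sum-map-≤const : (f : X → ℕ) (c : ℕ) (xs : List X) → (∀ {x} → x ∈ xs → f x ≤ c) →
                 sum (map f xs) ≤ length xs * c
sum-map-≤const f c [] h = z≤n
sum-map-≤const f c (x ∷ xs) h = +-mono-≤ (h (here refl)) (sum-map-≤const f c xs (h ∘ there))

sum-map-const : (c : ℕ) (xs : List X) → sum (map (const c) xs) ≡ length xs * c
sum-map-const c [] = refl
sum-map-const c (x ∷ xs) = cong (λ z → c + z) (sum-map-const c xs)

sum-map-upTo-suc : (f : ℕ → ℕ) (n : ℕ) → sum (map f (upTo (suc n))) ≡ sum (map f (upTo n)) + f n
sum-map-upTo-suc f n = begin
  sum (map f (upTo (suc n)))          ≡⟨ cong (sum ∘ map f) (sym (upTo-∷ʳ n)) ⟩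
  sum (map f (upTo n ++ n ∷ []))      ≡⟨ cong sum (map-++ f (upTo n) (n ∷ [])) ⟩
  sum (map f (upTo n) ++ f n ∷ [])    ≡⟨ sum-++ (map f (upTo n)) (f n ∷ []) ⟩
  sum (map f (upTo n)) + (f n + 0)    ≡⟨ cong (λ z → sum (map f (upTo n)) + z) (+-identityʳ (f n)) ⟩
  sum (map f (upTo n)) + f n          ∎
  where open ≡-Reasoning

card-++ : (P : X → Bool) (xs ys : List X) → card P (xs ++ ys) ≡ card P xs + card P ys
card-++ P xs ys = trans (cong sum (map-++ (one ∘ P) xs ys)) (sum-++ (map (one ∘ P) xs) _)

card-map : (P : Y → Bool) (f : X → Y) (xs : List X) → card P (map f xs) ≡ card (P ∘ f) xs
card-map P f xs = cong sum (sym (map-∘ xs))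

card≤length : (P : X → Bool) (xs : List X) → card P xs ≤ length xs
card≤length P xs = ≤-trans (sum-map-≤const (one ∘ P) 1 xs (λ {x} _ → one≤1 (P x)))
  (≤-reflexive (*-identityʳ (length xs)))

card-true : (xs : List X) → card (const true) xs ≡ length xs
card-true xs = trans (sum-map-const 1 xs) (*-identityʳ (length xs))

-- A relation in place of a function: the image may be chosen by cases, and the relation carries the
-- evidence (roots, descents) from which injectivity is read off. Each chosen image is deleted from
-- `ys`, so `ys` may contain repetitions.
card-injection : (P : X → Bool) (Q : Y → Bool) (_↝_ : X → Y → Set) (xs : List X) (ys : List Y) →
                 Unique xs →
                 (∀ {x} → x ∈ xs → T (P x) → ∃ λ y → y ∈ ys × T (Q y) × x ↝ y) →
                 (∀ {x x′ y} → x ↝ y → x′ ↝ y → x ≡ x′) →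
                 card P xs ≤ card Q ys
card-injection P Q _↝_ [] ys u total inj = z≤n
card-injection P Q _↝_ (x ∷ xs) ys (x∉xs ∷ u) total inj with P x in eq
... | false = card-injection P Q _↝_ xs ys u (total ∘ there) inj
... | true with total (here refl) (subst T (sym eq) _)
... | y , y∈ys , Qy , x↝y with ∈-∃++ y∈ys
... | ys₁ , ys₂ , refl = begin
  suc (card P xs)                  ≤⟨ s≤s (card-injection P Q _↝_ xs (ys₁ ++ ys₂) u total′ inj) ⟩
  suc (card Q (ys₁ ++ ys₂))        ≡⟨ cong suc (card-++ Q ys₁ ys₂) ⟩
  suc (card Q ys₁ + card Q ys₂)    ≡⟨ sym (+-suc _ _) ⟩
  card Q ys₁ + suc (card Q ys₂)    ≡⟨ cong (λ c → card Q ys₁ + (c + card Q ys₂)) (sym (one-T Qy)) ⟩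
  card Q ys₁ + card Q (y ∷ ys₂)    ≡⟨ sym (card-++ Q ys₁ (y ∷ ys₂)) ⟩
  card Q (ys₁ ++ y ∷ ys₂)          ∎
  where
  open ≤-Reasoning
  total′ : ∀ {x′} → x′ ∈ xs → T (P x′) → ∃ λ y′ → y′ ∈ ys₁ ++ ys₂ × T (Q y′) × x′ ↝ y′
  total′ x′∈xs Px′ with total (there x′∈xs) Px′
  ... | y′ , y′∈ , Qy′ , x′↝y′ with ∈-++⁻ ys₁ y′∈
  ... | inj₁ y′∈ys₁ = y′ , ∈-++⁺ˡ y′∈ys₁ , Qy′ , x′↝y′
  ... | inj₂ (there y′∈ys₂) = y′ , ∈-++⁺ʳ ys₁ y′∈ys₂ , Qy′ , x′↝y′
  ... | inj₂ (here refl) = ⊥-elim (All.lookup x∉xs x′∈xs (inj x↝y x′↝y′))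

infixr 4 _⊗_

_⊗_ : List X → (X → List Y) → List (X × Y)
[] ⊗ g = []
(x ∷ xs) ⊗ g = map (x ,_) (g x) ++ (xs ⊗ g)

∈-⊗⁺ : ∀ {xs : List X} {g : X → List Y} {x y} → x ∈ xs → y ∈ g x → (x , y) ∈ (xs ⊗ g)
∈-⊗⁺ (here refl) y∈ = ∈-++⁺ˡ (∈-map⁺ _ y∈)
∈-⊗⁺ {xs = x ∷ _} {g} (there x∈) y∈ = ∈-++⁺ʳ (map (x ,_) (g x)) (∈-⊗⁺ x∈ y∈)

∈-⊗⁻ : ∀ (xs : List X) {g : X → List Y} {p} → p ∈ (xs ⊗ g) → proj₁ p ∈ xs × proj₂ p ∈ g (proj₁ p)
∈-⊗⁻ (x ∷ xs) {g} p∈ with ∈-++⁻ (map (x ,_) (g x)) p∈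
... | inj₁ p∈ˡ with ∈-map⁻ (x ,_) p∈ˡ
... | _ , y∈ , refl = here refl , y∈
∈-⊗⁻ (x ∷ xs) {g} p∈ | inj₂ p∈ʳ with ∈-⊗⁻ xs p∈ʳ
... | x∈ , y∈ = there x∈ , y∈

Unique-⊗ : ∀ {xs : List X} {g : X → List Y} → Unique xs → (∀ x → Unique (g x)) → Unique (xs ⊗ g)
Unique-⊗ [] _ = []
Unique-⊗ {xs = x ∷ xs} {g} (x∉xs ∷ u) v =
  Unique.++⁺ (Unique.map⁺ (λ { refl → refl }) (v x)) (Unique-⊗ u v) disjoint
  where
  disjoint : ∀ {p} → p ∈ map (x ,_) (g x) × p ∈ (xs ⊗ g) → ⊥
  disjoint (p∈ˡ , p∈ʳ) with ∈-map⁻ (x ,_) p∈ˡ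
  ... | _ , _ , refl = All.lookup x∉xs (proj₁ (∈-⊗⁻ xs p∈ʳ)) refl

card-⊗ : (P : X × Y → Bool) (xs : List X) (g : X → List Y) →
         card P (xs ⊗ g) ≡ sum (map (λ x → card (λ y → P (x , y)) (g x)) xs)
card-⊗ P [] g = refl
card-⊗ P (x ∷ xs) g = trans (card-++ P (map (x ,_) (g x)) (xs ⊗ g))
  (cong₂ _+_ (card-map P (x ,_) (g x)) (card-⊗ P xs g))

card-⊗-const : (P : Y → Bool) (xs : List X) (ys : List Y) →
               card (P ∘ proj₂) (xs ⊗ λ _ → ys) ≡ length xs * card P ys
card-⊗-const P xs ys = trans (card-⊗ (P ∘ proj₂) xs (λ _ → ys)) (sum-map-const (card P ys) xs)

∈-range⁺ : ∀ {i N} → 1 ≤ i → i ≤ N → i ∈ range N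
∈-range⁺ {suc i} _ i≤N = ∈-map⁺ suc (∈-upTo⁺ i≤N)

∈-range⁻ : ∀ {i N} → i ∈ range N → 1 ≤ i × i ≤ N
∈-range⁻ i∈ with ∈-map⁻ suc i∈
... | j , j∈ , refl = s≤s z≤n , ∈-upTo⁻ j∈

Unique-range : ∀ N → Unique (range N)
Unique-range N = Unique.map⁺ suc-injective (Unique.upTo⁺ N)

length-range : ∀ N → length (range N) ≡ N
length-range N = trans (length-map suc (upTo N)) (length-upTo N)

square : ℕ → List (ℕ × ℕ)
square N = range N ⊗ λ _ → range N

cube : ℕ → List (ℕ × ℕ × ℕ)
cube N = range N ⊗ λ _ → square N

∈-square⁺ : ∀ {a b N} → 1 ≤ a → a ≤ N → 1 ≤ b → b ≤ N → (a , b) ∈ square N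
∈-square⁺ 1≤a a≤N 1≤b b≤N = ∈-⊗⁺ (∈-range⁺ 1≤a a≤N) (∈-range⁺ 1≤b b≤N)

∈-square⁻ : ∀ {a b N} → (a , b) ∈ square N → (1 ≤ a × a ≤ N) × (1 ≤ b × b ≤ N)
∈-square⁻ {N = N} p∈ with ∈-⊗⁻ (range N) p∈
... | a∈ , b∈ = ∈-range⁻ a∈ , ∈-range⁻ b∈

∈-cube⁺ : ∀ {a b c N} → 1 ≤ a → a ≤ N → 1 ≤ b → b ≤ N → 1 ≤ c → c ≤ N → (a , b , c) ∈ cube N
∈-cube⁺ 1≤a a≤N 1≤b b≤N 1≤c c≤N = ∈-⊗⁺ (∈-range⁺ 1≤a a≤N) (∈-square⁺ 1≤b b≤N 1≤c c≤N)

∈-cube⁻ : ∀ {a b c N} → (a , b , c) ∈ cube N →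
          (1 ≤ a × a ≤ N) × (1 ≤ b × b ≤ N) × (1 ≤ c × c ≤ N)
∈-cube⁻ {N = N} p∈ with ∈-⊗⁻ (range N) p∈
... | a∈ , bc∈ = ∈-range⁻ a∈ , ∈-square⁻ bc∈

Unique-square : ∀ N → Unique (square N)
Unique-square N = Unique-⊗ (Unique-range N) (λ _ → Unique-range N)

Unique-cube : ∀ N → Unique (cube N)
Unique-cube N = Unique-⊗ (Unique-range N) (λ _ → Unique-square N)

length-⊗ : ∀ (xs : List X) (g : X → List Y) → length (xs ⊗ g) ≡ sum (map (length ∘ g) xs)
length-⊗ xs g = begin
  length (xs ⊗ g)                           ≡⟨ sym (card-true (xs ⊗ g)) ⟩
  card (const true) (xs ⊗ g)                ≡⟨ card-⊗ (const true) xs g ⟩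
  sum (map (card (const true) ∘ g) xs)      ≡⟨ cong sum (map-cong (λ x → card-true (g x)) xs) ⟩
  sum (map (length ∘ g) xs)                 ∎
  where open ≡-Reasoning

length-⊗-const : ∀ (xs : List X) (ys : List Y) → length (xs ⊗ λ _ → ys) ≡ length xs * length ys
length-⊗-const xs ys = trans (length-⊗ xs (λ _ → ys)) (sum-map-const (length ys) xs)

card-square : (P : ℕ → ℕ → Bool) (N : ℕ) →
  sum (map (λ a → sum (map (λ b → one (P a b)) (range N))) (range N))
    ≡ card (λ (a , b) → P a b) (square N)
card-square P N = sym (card-⊗ _ (range N) (λ _ → range N))

card-cube : (P : ℕ → ℕ → ℕ → Bool) (N : ℕ) →
  sum (map (λ a → sum (map (λ b → sum (map (λ c → one (P a b c)) (range N))) (range N))) (range N))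
    ≡ card (λ (a , b , c) → P a b c) (cube N)
card-cube P N = trans (cong sum (map-cong (λ a → card-square (P a) N) (range N)))
  (sym (card-⊗ _ (range N) (λ _ → square N)))

-- Decoding the boolean predicates

isSquare⁻ : ∀ {z} → T (isSquareᵇ z) → ∃ λ r → z ≡ + (r * r)
isSquare⁻ {+ m} p with satisfied (any⁻ _ (upTo (suc m)) p)
... | r , q = r , cong +_ (sym (≡ᵇ⇒≡ (r * r) m q))

m≤m*m : ∀ m → m ≤ m * m
m≤m*m zero    = z≤n
m≤m*m (suc m) = m≤m*n (suc m) (suc m)

isSquare⁺ : ∀ {z} r → z ≡ + (r * r) → T (isSquareᵇ z)
isSquare⁺ r refl = any⁺ _ (lose (∈-upTo⁺ (s≤s (m≤m*m r))) (≡⇒≡ᵇ (r * r) (r * r) refl))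

-- A record rather than a bare equation, so that `a`, `b` and `r` can be inferred although the
-- products hide them.
record Root (n : ℤ) (a b r : ℕ) : Set where
  constructor root
  field equation : + (a * b) +ᶻ n ≡ + (r * r)

open Root public

IsPair : ℤ → ℕ → ℕ → Set
IsPair n a b = ∃ (Root n a b)

sqCond⁻ : ∀ {n a b} → T (sqCond n a b) → IsPair n a b
sqCond⁻ p with isSquare⁻ p
... | r , eq = r , root eq

sqCond⁺ : ∀ {n a b} → IsPair n a b → T (sqCond n a b)
sqCond⁺ (r , root eq) = isSquare⁺ r eq

pair⁻ : ∀ {n a b} → T (isPairᵇ n a b) → a < b × IsPair n a b
pair⁻ {n} {a} {b} p with to T-∧ p
... | a<b , sq = <ᵇ⇒< a b a<b , sqCond⁻ sq

pair⁺ : ∀ {n a b} → a < b → IsPair n a b → T (isPairᵇ n a b)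
pair⁺ a<b ab = from T-∧ (<⇒<ᵇ a<b , sqCond⁺ ab)

IsTriple : ℤ → ℕ → ℕ → ℕ → Set
IsTriple n a b c = a < b × b < c × IsPair n a b × IsPair n a c × IsPair n b c

triple⁻ : ∀ {n a b c} → T (isTripleᵇ n a b c) → IsTriple n a b c
triple⁻ {n} {a} {b} {c} p with to T-∧ p
... | a<b , p₁ with to T-∧ p₁
... | b<c , p₂ with to T-∧ p₂
... | ab , p₃ with to T-∧ p₃
... | ac , bc = <ᵇ⇒< a b a<b , <ᵇ⇒< b c b<c , sqCond⁻ ab , sqCond⁻ ac , sqCond⁻ bc

triple⁺ : ∀ {n a b c} → IsTriple n a b c → T (isTripleᵇ n a b c)
triple⁺ (a<b , b<c , ab , ac , bc) =
  from T-∧ (<⇒<ᵇ a<b , from T-∧ (<⇒<ᵇ b<c ,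
    from T-∧ (sqCond⁺ ab , from T-∧ (sqCond⁺ ac , sqCond⁺ bc))))

IsRegular : ℤ → ℕ → ℕ → ℕ → Set
IsRegular n a b c = ∃ λ r → Root n a b r × c ≡ a + b + 2 * r

regular⁻ : ∀ {n a b c} → T (isRegularᵇ n a b c) → IsRegular n a b c
regular⁻ {n} {a} {b} {c} p with + (a * b) +ᶻ n in eq
... | -[1+ m ] with satisfied (any⁻ (λ r → false ∧ (c ≡ᵇ a + b + 2 * r)) (upTo (suc c)) p)
... | _ , ()
regular⁻ {n} {a} {b} {c} p | + m with satisfied (any⁻ (λ r → (r * r ≡ᵇ m) ∧ (c ≡ᵇ a + b + 2 * r)) (upTo (suc c)) p)
... | r , q with to T-∧ q
... | u , v = r , root (trans eq (cong +_ (sym (≡ᵇ⇒≡ (r * r) m u)))) , ≡ᵇ⇒≡ c (a + b + 2 * r) v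

regular⁺ : ∀ {n a b c} → IsRegular n a b c → T (isRegularᵇ n a b c)
regular⁺ {n} {a} {b} {c} (r , root eq , refl) with + (a * b) +ᶻ n
regular⁺ {n} {a} {b} {c} (r , root refl , refl) | .(+ (r * r)) =
  any⁺ _ (lose (∈-upTo⁺ (s≤s (≤-trans (m≤n*m r 2) (m≤n+m (2 * r) (a + b)))))
    (from T-∧ (≡⇒≡ᵇ (r * r) (r * r) refl , ≡⇒≡ᵇ (a + b + 2 * r) (a + b + 2 * r) refl)))

-- Regular triples and pairs

square-injective : ∀ {m n} → m * m ≡ n * n → m ≡ n
square-injective {m} {n} eq with <-cmp m n
... | tri< m<n _ _ = contradiction eq (<⇒≢ (*-mono-< m<n m<n))
... | tri≈ _ m≡n _ = m≡n
... | tri> _ _ n<m = contradiction (sym eq) (<⇒≢ (*-mono-< n<m n<m))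

root-unique : ∀ {n a b r s} → Root n a b r → Root n a b s → r ≡ s
root-unique (root p) (root q) = square-injective (ℤ.+-injective (trans (sym p) q))

shift : ∀ n k {x y} → + x +ᶻ n ≡ + y → + (k + x) +ᶻ n ≡ + (k + y)
shift n k {x} eq = trans (ℤ.+-assoc (+ k) (+ x) n) (cong (+ k +ᶻ_) eq)

unshift : ∀ n k {x y} → + (k + x) +ᶻ n ≡ + (k + y) → + x +ᶻ n ≡ + y
unshift n k {x} eq =
  ℤ+.∙-cancelˡ (+ k) _ _ (trans (sym (ℤ.+-assoc (+ k) (+ x) n)) eq)

shift-bounds : ∀ n x {y} → + x +ᶻ n ≡ + y → y ≤ x + ∣ n ∣ × x ≤ y + ∣ n ∣
shift-bounds n x {y} eq =
  subst (λ z → ∣ z ∣ ≤ x + ∣ n ∣) eq (ℤ.∣i+j∣≤∣i∣+∣j∣ (+ x) n) ,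
  subst (λ z → ∣ z ∣ ≤ y + ∣ n ∣) (trans (cong (_-ᶻ n) (sym eq)) (ℤ+.//-rightDividesʳ n (+ x)))
    (ℤ.∣i-j∣≤∣i∣+∣j∣ (+ y) n)

root-bounds : ∀ {n a b r} → Root n a b r → r * r ≤ a * b + ∣ n ∣ × a * b ≤ r * r + ∣ n ∣
root-bounds {n} {a} {b} (root eq) = shift-bounds n (a * b) eq

root-sym : ∀ {n a b r} → Root n a b r → Root n b a r
root-sym {n} {a} {b} {r} (root eq) = root (subst (λ x → + x +ᶻ n ≡ + (r * r)) (*-comm a b) eq)

regular-root : ∀ {n a b r} → Root n a b r → Root n a (a + b + 2 * r) (a + r)
regular-root {n} {a} {b} {r} (root eq) = root (subst₂ (λ x y → + x +ᶻ n ≡ + y)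
  (product a b r) (square′ a r) (shift n (a * a + 2 * a * r) eq))
  where
  product : ∀ a b r → a * a + 2 * a * r + a * b ≡ a * (a + b + 2 * r)
  product = solve-∀
  square′ : ∀ a r → a * a + 2 * a * r + r * r ≡ (a + r) * (a + r)
  square′ = solve-∀

regular-rootʳ : ∀ {n a b c r} → Root n a b r → c ≡ a + b + 2 * r → Root n b c (b + r)
regular-rootʳ {n} {a} {b} {_} {r} ab refl =
  subst (λ s → Root n b (s + 2 * r) (b + r)) (+-comm b a) (regular-root (root-sym ab))

regular-rootˡ : ∀ {n a b c r} → Root n a b r → c ≡ a + b + 2 * r → Root n a c (a + r)
regular-rootˡ ab refl = regular-root ab

pairᵇ : ℤ → ℕ × ℕ → Bool
pairᵇ n (a , b) = isPairᵇ n a b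

regularᵇ : ℤ → ℕ × ℕ × ℕ → Bool
regularᵇ n (a , b , c) = isTripleᵇ n a b c ∧ isRegularᵇ n a b c

D2≡card : ∀ n N → D2 n N ≡ card (pairᵇ n) (square N)
D2≡card n N = card-square (isPairᵇ n) N

D3reg≡card : ∀ n N → D3reg n N ≡ card (regularᵇ n) (cube N)
D3reg≡card n N = card-cube (λ a b c → isTripleᵇ n a b c ∧ isRegularᵇ n a b c) N

bools : List Bool
bools = true ∷ false ∷ []

∈-bools : ∀ b → b ∈ bools
∈-bools true  = here refl
∈-bools false = there (here refl)

Unique-bools : Unique bools
Unique-bools = ((λ ()) ∷ []) ∷ [] ∷ []

choose : Bool → ℕ × ℕ × ℕ → ℕ × ℕ
choose true  (a , b , c) = a , c
choose false (a , b , c) = b , c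

-- The pairs {a, c} and {b, c} have roots a + r and b + r. A pair therefore determines r, and c = a
-- + b + 2 r returns the missing element.
2*D3reg≤D2 : ∀ n N → 2 * D3reg n N ≤ D2 n N
2*D3reg≤D2 n N = begin
  2 * D3reg n N                                          ≡⟨ cong (2 *_) (D3reg≡card n N) ⟩
  2 * card (regularᵇ n) (cube N)                         ≡⟨ sym (card-⊗-const (regularᵇ n) bools (cube N)) ⟩
  card (regularᵇ n ∘ proj₂) (bools ⊗ λ _ → cube N)       ≤⟨ card-injection _ (pairᵇ n) _↝_ (bools ⊗ λ _ → cube N) (square N)
                                                              (Unique-⊗ {g = λ _ → cube N} Unique-bools (λ _ → Unique-cube N)) total injective ⟩
  card (pairᵇ n) (square N)                              ≡⟨ sym (D2≡card n N) ⟩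
  D2 n N                                                 ∎
  where
  open ≤-Reasoning
  _↝_ : Bool × ℕ × ℕ × ℕ → ℕ × ℕ → Set
  (i , t@(a , b , c)) ↝ p = a < b × IsRegular n a b c × choose i t ≡ p

  total : ∀ {x} → x ∈ (bools ⊗ λ _ → cube N) → T (regularᵇ n (proj₂ x)) →
          ∃ λ y → y ∈ square N × T (pairᵇ n y) × x ↝ y
  total {i , a , b , c} x∈ reg with to (T-∧ {isTripleᵇ n a b c}) reg | ∈-cube⁻ {N = N} (proj₂ (∈-⊗⁻ bools x∈))
  ... | t , r | (1≤a , a≤N) , (1≤b , b≤N) , 1≤c , c≤N with triple⁻ {n} {a} {b} {c} t
  ... | a<b , b<c , ab , ac , bc with i
  ... | true  = _ , ∈-square⁺ 1≤a a≤N 1≤c c≤N , pair⁺ (<-trans a<b b<c) ac ,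
    a<b , regular⁻ {n} {a} {b} {c} r , refl
  ... | false = _ , ∈-square⁺ 1≤b b≤N 1≤c c≤N , pair⁺ b<c bc , a<b , regular⁻ {n} {a} {b} {c} r , refl

  -- A pair arising in both ways gives a = b′ and then b = a′, against a < b and a′ < b′.
  mixed : ∀ t t′ y → (true , t) ↝ y → (false , t′) ↝ y → ⊥
  mixed (a , b , c) (a′ , _ , _) _ (a<b , (r , p , e) , refl) (a′<a , (r′ , p′ , e′) , refl)
    with +-cancelˡ-≡ a r r′ (root-unique (regular-rootˡ p e) (regular-rootʳ p′ e′))
  ... | refl with +-cancelˡ-≡ a b a′ (+-cancelʳ-≡ (2 * r) (a + b) (a + a′)
                    (trans (sym e) (trans e′ (cong (_+ 2 * r) (+-comm a′ a)))))
  ... | refl = <-asym a<b a′<a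

  injective : ∀ {x x′ y} → x ↝ y → x′ ↝ y → x ≡ x′
  injective {true , a , b , _} {true , _ , b′ , _} (_ , (r , p , e) , refl) (_ , (r′ , p′ , e′) , refl)
    with +-cancelˡ-≡ a r r′ (root-unique (regular-rootˡ p e) (regular-rootˡ p′ e′))
  ... | refl with +-cancelˡ-≡ a b b′ (+-cancelʳ-≡ (2 * r) (a + b) (a + b′) (trans (sym e) e′))
  ... | refl = refl
  injective {false , a , b , _} {false , a′ , _ , _} (_ , (r , p , e) , refl) (_ , (r′ , p′ , e′) , refl)
    with +-cancelˡ-≡ b r r′ (root-unique (regular-rootʳ p e) (regular-rootʳ p′ e′))
  ... | refl with +-cancelʳ-≡ b a a′ (+-cancelʳ-≡ (2 * r) (a + b) (a′ + b) (trans (sym e) e′))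
  ... | refl = refl
  injective {true , t} {false , t′} {y} p q = ⊥-elim (mixed t t′ y p q)
  injective {false , t} {true , t′} {y} p q = ⊥-elim (mixed t′ t y q p)

squares-apart : ∀ {m n} → m < n → m * m + (n + m) ≤ n * n
squares-apart {m} m<n with m≤n⇒∃[o]m+o≡n m<n
... | k , refl = ≤-trans (m≤m+n _ (2 * m * k + k * k + k)) (≤-reflexive (expand m k))
  where
  expand : ∀ m k → m * m + (suc m + k + m) + (2 * m * k + k * k + k) ≡ (suc m + k) * (suc m + k)
  expand = solve-∀

-- The second pair through c coming from s and c − s: the parametrisation is s = a + u, c = s + d.
partner : ∀ {n a c} → n ≢ 0ℤ → 1 ≤ a → a < c → 2 * ∣ n ∣ < c → IsPair n a c →
          (∃ λ a′ → 1 ≤ a′ × a′ ≢ a × ∃ λ u → Root n a a′ u × c ≡ a + a′ + 2 * u) ⊎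
          (∃ λ d → n ≡ + (d * d) × c ≡ a + 2 * d)
partner {n} {a} {c} n≢0 1≤a a<c 2κ<c (s , eq) = go (m≤n⇒∃[o]m+o≡n a≤s) (m≤n⇒∃[o]m+o≡n (<⇒≤ s<c))
  where
  open ≤-Reasoning
  κ = ∣ n ∣
  κ<c : κ < c
  κ<c = ≤-<-trans (m≤m+n κ (κ + 0)) 2κ<c

  s<c : s < c
  s<c = ≰⇒> λ c≤s → <-irrefl refl (begin-strict
    c * c      ≤⟨ *-mono-≤ c≤s c≤s ⟩
    s * s      ≤⟨ proj₁ (root-bounds eq) ⟩
    a * c + κ  <⟨ +-monoʳ-< (a * c) κ<c ⟩
    a * c + c  ≡⟨ +-comm (a * c) c ⟩
    suc a * c  ≤⟨ *-monoˡ-≤ c a<c ⟩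
    c * c      ∎)

  a≤s : a ≤ s
  a≤s = ≮⇒≥ λ s<a → <-irrefl refl (begin-strict
    s * s + κ        <⟨ +-monoʳ-< (s * s) κ<c ⟩
    s * s + c        ≤⟨ s*s+c≤a*c (m≤n⇒∃[o]m+o≡n s<a) (m≤n⇒∃[o]m+o≡n a<c) ⟩
    a * c            ≤⟨ proj₂ (root-bounds eq) ⟩
    s * s + κ        ∎)
    where
    s*s+c≤a*c : (∃ λ i → suc s + i ≡ a) → (∃ λ j → suc a + j ≡ c) → s * s + c ≤ a * c
    s*s+c≤a*c (i , refl) (j , refl) = ≤-trans (m≤m+n _ ((s + i) * (2 + i + j) + s * i))
      (≤-reflexive (expand s i j))
      where
      expand : ∀ s i j → s * s + (suc (suc s + i) + j) + ((s + i) * (2 + i + j) + s * i) ≡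
                         (suc s + i) * (suc (suc s + i) + j)
      expand = solve-∀

  -- The partner can coincide with a only if n = u² - a². Since n ≠ 0 these squares differ, hence a
  -- + u ≤ κ and c = 2 (a + u) is small.
  equal⇒small : ∀ {a u} → Root n a a u → a + u ≤ κ
  equal⇒small {a} {u} e with <-cmp u a
  ... | tri≈ _ refl _ = contradiction (ℤ+.∙-cancelˡ (+ (a * a)) n 0ℤ (trans (equation e) (sym (ℤ.+-identityʳ _)))) n≢0
  ... | tri< u<a _ _ = +-cancelˡ-≤ (u * u) (a + u) κ
    (≤-trans (squares-apart u<a) (proj₂ (root-bounds e)))
  ... | tri> _ _ a<u = +-cancelˡ-≤ (a * a) (a + u) κ
    (≤-trans (≤-reflexive (cong (λ x → a * a + x) (+-comm a u))) (≤-trans (squares-apart a<u) (proj₁ (root-bounds e))))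

  -- That is, a (d - u) + n = u², so the partner is d - u with root u. The cases of `go` are the
  -- signs of d - u: zero means n = u², and a negative value bounds c by 2 κ.
  reduce : ∀ {a u d} → Root n a (a + u + d) (a + u) → + (a * d) +ᶻ n ≡ + (a * u + u * u)
  reduce {a} {u} {d} (root e) = unshift n (a * a + a * u)
    (subst₂ (λ x y → + x +ᶻ n ≡ + y) (product a u d) (square′ a u) e)
    where
    product : ∀ a u d → a * (a + u + d) ≡ a * a + a * u + a * d
    product = solve-∀
    square′ : ∀ a u → (a + u) * (a + u) ≡ a * a + a * u + (a * u + u * u)
    square′ = solve-∀

  go : (∃ λ u → a + u ≡ s) → (∃ λ d → s + d ≡ c) → _
  go (u , refl) (d , refl) with <-cmp u d
  ... | tri≈ _ refl _ = inj₂ (u , trans (sym (ℤ.+-identityˡ n)) n≡u² , double a u)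
    where
    double : ∀ a u → a + u + u ≡ a + 2 * u
    double = solve-∀
    n≡u² : + 0 +ᶻ n ≡ + (u * u)
    n≡u² = unshift n (a * u) (subst (λ x → + x +ᶻ n ≡ + (a * u + u * u)) (sym (+-identityʳ (a * u))) (reduce eq))
  ... | tri> _ _ d<u = contradiction c≤2κ (<⇒≱ 2κ<c)
    where
    a+u²≤κ : a + u * u ≤ κ
    a+u²≤κ = +-cancelˡ-≤ (a * d) (a + u * u) κ (begin
      a * d + (a + u * u)    ≡⟨ regroup a d (u * u) ⟩
      a * suc d + u * u      ≤⟨ +-monoˡ-≤ (u * u) (*-monoʳ-≤ a d<u) ⟩
      a * u + u * u          ≤⟨ proj₁ (shift-bounds n (a * d) (reduce eq)) ⟩
      a * d + κ              ∎)
      where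
      regroup : ∀ a d x → a * d + (a + x) ≡ a * suc d + x
      regroup = solve-∀
    c≤2κ : a + u + d ≤ 2 * κ
    c≤2κ = begin
      a + u + d              ≤⟨ +-mono-≤ (+-monoʳ-≤ a (m≤m*m u)) (≤-trans (<⇒≤ d<u) (≤-trans (m≤m*m u) (m≤n+m _ a))) ⟩
      a + u * u + (a + u * u) ≤⟨ +-mono-≤ a+u²≤κ a+u²≤κ ⟩
      κ + κ                  ≡⟨ cong (λ x → κ + x) (sym (+-identityʳ κ)) ⟩
      2 * κ                  ∎
  ... | tri< u<d _ _ with m≤n⇒∃[o]m+o≡n u<d
  ... | v , refl = inj₁ (suc v , s≤s z≤n , (λ { refl → <⇒≱ 2κ<c (≤-trans (≤-reflexive (total u v))
                                                    (*-monoʳ-≤ 2 (equal⇒small aa′+n≡u²))) }) ,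
                         u , aa′+n≡u² , sum-form a u v)
    where
    aa′+n≡u² : Root n a (suc v) u
    aa′+n≡u² = root (unshift n (a * u)
      (subst (λ x → + x +ᶻ n ≡ + (a * u + u * u)) (split a u v) (reduce eq)))
      where
      split : ∀ a u v → a * (suc u + v) ≡ a * u + a * suc v
      split = solve-∀
    sum-form : ∀ a u v → a + u + (suc u + v) ≡ a + suc v + 2 * u
    sum-form = solve-∀
    total : ∀ u v → suc v + u + (suc u + v) ≡ 2 * (suc v + u)
    total = solve-∀

-- If n = d² then the root s = c − d of the pair {c − 2 d, c} has the degenerate partner c − 2 s + a = 0.
squareOnly : ℤ → ℕ → List ℕ
squareOnly n N = if isSquareᵇ n then range N else []

-- A pair with c > 2 |n| and a positive partner goes to the regular triple that they form, flagged
-- by whether a is its least or its middle element. A degenerate partner means a = c - 2 d with d² =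
-- n, so c alone identifies the pair.
D2≤2*D3reg+exceptions : ∀ {n} → n ≢ 0ℤ → ∀ N →
  D2 n N ≤ 2 * D3reg n N + (2 * ∣ n ∣ * (2 * ∣ n ∣) + length (squareOnly n N))
D2≤2*D3reg+exceptions {n} n≢0 N = begin
  D2 n N                            ≡⟨ D2≡card n N ⟩
  card (pairᵇ n) (square N)         ≤⟨ card-injection (pairᵇ n) Q _↝_ _ targets (Unique-square N) total injective ⟩
  card Q targets                    ≡⟨ card-++ Q (map inj₁ candidates) (map inj₂ rest) ⟩
  card Q (map inj₁ candidates) + card Q (map inj₂ rest)
    ≡⟨ cong₂ _+_ (trans (card-map Q inj₁ candidates) (card-⊗-const (regularᵇ n) bools (cube N)))
                 (trans (card-map Q inj₂ rest) (card-true rest)) ⟩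
  2 * card (regularᵇ n) (cube N) + length rest
    ≡⟨ cong₂ (λ x y → 2 * x + y) (sym (D3reg≡card n N)) length-rest ⟩
  2 * D3reg n N + (B * B + length (squareOnly n N)) ∎
  where
  open ≤-Reasoning
  B = 2 * ∣ n ∣
  candidates : List (Bool × ℕ × ℕ × ℕ)
  candidates = bools ⊗ λ _ → cube N
  rest : List (ℕ × ℕ ⊎ ℕ)
  rest = map inj₁ (square B) ++ map inj₂ (squareOnly n N)
  targets : List ((Bool × ℕ × ℕ × ℕ) ⊎ (ℕ × ℕ ⊎ ℕ))
  targets = map inj₁ candidates ++ map inj₂ rest
  Q : (Bool × ℕ × ℕ × ℕ) ⊎ (ℕ × ℕ ⊎ ℕ) → Bool
  Q (inj₁ (_ , t)) = regularᵇ n t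
  Q (inj₂ _)       = true
  _↝_ : ℕ × ℕ → (Bool × ℕ × ℕ × ℕ) ⊎ (ℕ × ℕ ⊎ ℕ) → Set
  p ↝ inj₁ (i , t) = choose i t ≡ p
  p ↝ inj₂ (inj₁ q) = q ≡ p
  (a , c) ↝ inj₂ (inj₂ m) = m ≡ c × ∃ λ d → n ≡ + (d * d) × c ≡ a + 2 * d

  length-rest : length rest ≡ B * B + length (squareOnly n N)
  length-rest = begin-equality
    length rest                                     ≡⟨ length-++ (map inj₁ (square B)) ⟩
    length (map inj₁ (square B)) + length (map (inj₂ {A = ℕ × ℕ}) (squareOnly n N))
      ≡⟨ cong₂ _+_ (length-map inj₁ (square B)) (length-map inj₂ (squareOnly n N)) ⟩
    length (square B) + length (squareOnly n N)
      ≡⟨ cong (λ x → x + length (squareOnly n N)) (trans (length-⊗-const (range B) (range B))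
           (cong₂ _*_ (length-range B) (length-range B))) ⟩
    B * B + length (squareOnly n N)                 ∎

  injective : ∀ {x x′ y} → x ↝ y → x′ ↝ y → x ≡ x′
  injective {y = inj₁ _} refl refl = refl
  injective {y = inj₂ (inj₁ _)} refl refl = refl
  injective {a , _} {a′ , _} {inj₂ (inj₂ _)} (refl , d , p , e) (refl , d′ , p′ , e′)
    with square-injective {d} {d′} (ℤ.+-injective (trans (sym p) p′))
  ... | refl with +-cancelʳ-≡ (2 * d) a a′ (trans (sym e) e′)
  ... | refl = refl

  total : ∀ {x} → x ∈ square N → T (pairᵇ n x) → ∃ λ y → y ∈ targets × T (Q y) × x ↝ y
  total {a , c} x∈ p with ∈-square⁻ {N = N} x∈ | pair⁻ {n} {a} {c} p
  ... | (1≤a , a≤N) , 1≤c , c≤N | a<c , ac with c ≤? B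
  ... | yes c≤B = inj₂ (inj₁ (a , c)) ,
    ∈-++⁺ʳ (map inj₁ candidates) (∈-map⁺ inj₂ (∈-++⁺ˡ
      (∈-map⁺ inj₁ (∈-square⁺ 1≤a (≤-trans (<⇒≤ a<c) c≤B) 1≤c c≤B)))) , _ , refl
  ... | no c≰B with partner n≢0 1≤a a<c (≰⇒> c≰B) ac
  ... | inj₂ (d , n≡d² , c≡) = inj₂ (inj₂ c) ,
    ∈-++⁺ʳ (map inj₁ candidates) (∈-map⁺ inj₂ (∈-++⁺ʳ (map inj₁ (square B))
      (∈-map⁺ inj₂ (∈-squareOnly (isSquare⁺ d n≡d²) (∈-range⁺ 1≤c c≤N))))) , _ , refl , d , n≡d² , c≡
    where
    ∈-squareOnly : T (isSquareᵇ n) → c ∈ range N → c ∈ squareOnly n N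
    ∈-squareOnly t c∈ with isSquareᵇ n
    ... | true = c∈
  ... | inj₁ (a′ , 1≤a′ , a′≢a , u , aa′ , c≡) with <-cmp a a′
  ... | tri≈ _ a≡a′ _ = contradiction (sym a≡a′) a′≢a
  ... | tri< a<a′ _ _ = inj₁ (true , a , a′ , c) ,
    ∈-++⁺ˡ (∈-map⁺ inj₁ (∈-⊗⁺ {g = λ _ → cube N} (∈-bools true)
      (∈-cube⁺ 1≤a a≤N 1≤a′ (≤-trans (<⇒≤ a′<c) c≤N) 1≤c c≤N))) ,
    from (T-∧ {isTripleᵇ n a a′ c}) (triple⁺ (a<a′ , a′<c , (u , aa′) , (a + u , regular-rootˡ aa′ c≡) ,
      (a′ + u , regular-rootʳ aa′ c≡)) , regular⁺ {n} {a} (u , aa′ , c≡)) , refl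
    where
    a′<c : a′ < c
    a′<c = ≤-trans (+-monoˡ-≤ a′ 1≤a) (≤-trans (m≤m+n _ (2 * u)) (≤-reflexive (sym c≡)))
  ... | tri> _ _ a′<a = inj₁ (false , a′ , a , c) ,
    ∈-++⁺ˡ (∈-map⁺ inj₁ (∈-⊗⁺ {g = λ _ → cube N} (∈-bools false)
      (∈-cube⁺ 1≤a′ (≤-trans (<⇒≤ a′<a) a≤N) 1≤a a≤N 1≤c c≤N))) ,
    from (T-∧ {isTripleᵇ n a′ a c}) (triple⁺ (a′<a , a<c , (u , root-sym aa′) , (a′ + u , regular-rootʳ aa′ c≡) ,
      (a + u , regular-rootˡ aa′ c≡)) ,
      regular⁺ {n} {a′} (u , root-sym aa′ , trans c≡ (cong (_+ 2 * u) (+-comm a a′)))) , refl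

-- Roots of a congruence in an interval

card-upTo-suc : ∀ f X → card f (upTo (suc X)) ≡ card f (upTo X) + one (f X)
card-upTo-suc f = sum-map-upTo-suc (one ∘ f)

-- The induction carries the last point y found so far and the sharper bound y + d, which grows by
-- at least d with every new point.
card-spaced : ∀ (f : ℕ → Bool) d → (∀ {x y} → x < y → T (f x) → T (f y) → x + d ≤ y) →
              ∀ X → d * card f (upTo X) ≤ X + d
card-spaced f d spaced X with last X
  where
  last : ∀ X → card f (upTo X) ≡ 0 ⊎ ∃ λ y → y < X × T (f y) × d * card f (upTo X) ≤ y + d
  last zero = inj₁ refl
  last (suc X) rewrite card-upTo-suc f X with f X in eq | last X
  ... | false | inj₁ e = inj₁ (trans (+-identityʳ _) e)
  ... | false | inj₂ (y , y<X , fy , le) =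
    inj₂ (y , m<n⇒m<1+n y<X , fy , subst (λ c → d * c ≤ y + d) (sym (+-identityʳ _)) le)
  ... | true | inj₁ e rewrite e = inj₂ (X , ≤-refl , subst T (sym eq) _ ,
    ≤-trans (≤-reflexive (*-identityʳ d)) (m≤n+m d X))
  ... | true | inj₂ (y , y<X , fy , le) = inj₂ (X , ≤-refl , subst T (sym eq) _ , (begin
    d * (card f (upTo X) + 1)    ≡⟨ *-distribˡ-+ d _ 1 ⟩
    d * card f (upTo X) + d * 1  ≤⟨ +-mono-≤ le (≤-reflexive (*-identityʳ d)) ⟩
    y + d + d                    ≤⟨ +-monoˡ-≤ d (spaced y<X fy (subst T (sym eq) _)) ⟩
    X + d                        ∎))
    where open ≤-Reasoning
... | inj₁ e rewrite e | *-zeroʳ d = z≤n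
... | inj₂ (y , y<X , _ , le) = ≤-trans le (+-monoˡ-≤ d (<⇒≤ y<X))

residueᵇ : ℤ → ℕ → ℕ → Bool
residueᵇ m p x = ⌊ p ∣? ∣ + (x * x) -ᶻ m ∣ ⌋

residue⁺ : ∀ {m p q x} → Root m p q x → T (residueᵇ m p x)
residue⁺ {m} {p} {q} {x} (root eq) =
  fromWitness (subst (p ∣_) (cong ∣_∣ (sym (trans (cong (_-ᶻ m) (sym eq)) (ℤ+.//-rightDividesʳ m (+ (p * q)))))) (m∣m*n q))

residue-difference : ∀ m p x h → T (residueᵇ m p x) → T (residueᵇ m p (x + h)) → p ∣ h * (2 * x + h)
residue-difference m p x h rx ry = ℤ.∣⇒∣ᵤ (subst (+ p ℤ.∣_) difference
  (ℤ.∣m∣n⇒∣m-n (ℤ.∣ᵤ⇒∣ {+ p} {+ ((x + h) * (x + h)) -ᶻ m} (toWitness ry))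
               (ℤ.∣ᵤ⇒∣ {+ p} {+ (x * x) -ᶻ m} (toWitness rx))))
  where
  cancel : ∀ i j k → (i +ᶻ j) -ᶻ k -ᶻ (i -ᶻ k) ≡ j
  cancel = ℤSolver.solve-∀
  expand : ∀ x h → (x + h) * (x + h) ≡ x * x + h * (2 * x + h)
  expand = solve-∀
  difference : + ((x + h) * (x + h)) -ᶻ m -ᶻ (+ (x * x) -ᶻ m) ≡ + (h * (2 * x + h))
  difference = trans (cong (λ y → + y -ᶻ m -ᶻ (+ (x * x) -ᶻ m)) (expand x h))
                     (cancel (+ (x * x)) (+ (h * (2 * x + h))) m)

module ResidueCount (m : ℤ) (p H′ : ℕ) where
  private
    H = suc H′

    collisionᵇ : ℕ → ℕ → Bool
    collisionᵇ h x = ⌊ p ∣? h * (2 * x + h) ⌋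

    -- A positive answer means that x is not isolated: a root follows at a distance of at most `H′`,
    -- that is, less than `H`.
    isolated? : ∀ x → _
    isolated? x = any? (λ h → p ∣? ∣ + ((x + h) * (x + h)) -ᶻ m ∣) (range H′)

    isolatedᵇ : ℕ → Bool
    isolatedᵇ x = residueᵇ m p x ∧ not ⌊ isolated? x ⌋

  card-isolated : ∀ X → H * card isolatedᵇ (upTo X) ≤ X + H
  card-isolated = card-spaced isolatedᵇ H spaced
    where
    spaced : ∀ {x y} → x < y → T (isolatedᵇ x) → T (isolatedᵇ y) → x + H ≤ y
    spaced {x} {y} x<y ix iy with m≤n⇒∃[o]m+o≡n (<⇒≤ x<y)
    ... | h , refl = ≮⇒≥ λ x+h<x+H → toWitnessFalse {a? = isolated? x} (proj₂ (to (T-∧ {residueᵇ m p x}) ix))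
      (lose (∈-range⁺ (+-cancelˡ-< x 0 h (subst (_< x + h) (sym (+-identityʳ x)) x<y))
                      (≤-pred (+-cancelˡ-< x h H x+h<x+H)))
            (toWitness (proj₁ (to (T-∧ {residueᵇ m p (x + h)}) iy))))

  -- Two solutions at distance k > 0 leave p ∣ 2 h k, so k ≥ p / (2 H) ≥ H². The spacing H² rather
  -- than H pays for the sum over the H - 1 values of h.
  card-collision : 2 * H * (H * H) ≤ p → ∀ {h} → 1 ≤ h → h ≤ H′ → ∀ X →
                   H * H * card (collisionᵇ h) (upTo X) ≤ X + H * H
  card-collision large {h} 1≤h h≤H′ = card-spaced (collisionᵇ h) (H * H) spaced
    where
    spaced : ∀ {x y} → x < y → T (collisionᵇ h x) → T (collisionᵇ h y) → x + H * H ≤ y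
    spaced {x} {y} x<y cx cy with m≤n⇒∃[o]m+o≡n (<⇒≤ x<y)
    ... | k , refl = +-monoʳ-≤ x (*-cancelˡ-≤ (2 * H) (begin
      2 * H * (H * H)   ≤⟨ large ⟩
      p                 ≤⟨ ∣⇒≤ {{>-nonZero positive}} p∣2hk ⟩
      2 * h * k         ≤⟨ *-monoˡ-≤ k (*-monoʳ-≤ 2 (m≤n⇒m≤1+n h≤H′)) ⟩
      2 * H * k         ∎))
      where
      open ≤-Reasoning
      expand : ∀ h x k → h * (2 * (x + k) + h) ≡ h * (2 * x + h) + 2 * h * k
      expand = solve-∀
      p∣2hk : p ∣ 2 * h * k
      p∣2hk = ∣m+n∣m⇒∣n (subst (p ∣_) (expand h x k) (toWitness cy)) (toWitness cx)
      positive : 0 < 2 * h * k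
      positive = *-mono-< {0} {2 * h} {0} {k} (≤-trans 1≤h (m≤m+n h (h + 0)))
        (+-cancelˡ-< x 0 k (subst (_< x + k) (sym (+-identityʳ x)) x<y))

  -- Either no root follows x within distance H, or x solves one of the linear congruences
  -- p ∣ h (2 x + h) with h < H.
  card-residue : 2 * H * (H * H) ≤ p → ∀ X → H * card (residueᵇ m p) (upTo X) ≤ 2 * X + (H + H * H)
  card-residue large X = begin
    H * card (residueᵇ m p) (upTo X)
      ≤⟨ *-monoʳ-≤ H (card-injection (residueᵇ m p) Q _↝_ (upTo X) targets (Unique.upTo⁺ X) total injective) ⟩
    H * card Q targets
      ≡⟨ cong (λ x → H * x) (trans (card-++ Q (map inj₁ (upTo X)) (map inj₂ collisions))
           (cong₂ _+_ (card-map Q inj₁ (upTo X)) (trans (card-map Q inj₂ collisions)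
             (card-⊗ (λ (h , x) → collisionᵇ h x) (range H′) (λ _ → upTo X))))) ⟩
    H * (card isolatedᵇ (upTo X) + Σcollisions)
      ≡⟨ *-distribˡ-+ H _ Σcollisions ⟩
    H * card isolatedᵇ (upTo X) + H * Σcollisions
      ≤⟨ +-mono-≤ (card-isolated X) HΣ≤ ⟩
    X + H + (X + H * H)
      ≡⟨ regroup X H (H * H) ⟩
    2 * X + (H + H * H) ∎
    where
    open ≤-Reasoning
    regroup : ∀ x h k → x + h + (x + k) ≡ 2 * x + (h + k)
    regroup = solve-∀
    collisions : List (ℕ × ℕ)
    collisions = range H′ ⊗ λ _ → upTo X
    targets : List (ℕ ⊎ ℕ × ℕ)
    targets = map inj₁ (upTo X) ++ map inj₂ collisions
    Q : ℕ ⊎ ℕ × ℕ → Bool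
    Q (inj₁ x) = isolatedᵇ x
    Q (inj₂ (h , x)) = collisionᵇ h x
    Σcollisions = sum (map (λ h → card (collisionᵇ h) (upTo X)) (range H′))
    HΣ≤ : H * Σcollisions ≤ X + H * H
    HΣ≤ = *-cancelˡ-≤ H (begin
      H * (H * Σcollisions)  ≡⟨ sym (*-assoc H H Σcollisions) ⟩
      H * H * Σcollisions    ≡⟨ sym (sum-map-* (H * H) _ (range H′)) ⟩
      sum (map (λ h → H * H * card (collisionᵇ h) (upTo X)) (range H′))
        ≤⟨ sum-map-≤const _ (X + H * H) (range H′) (λ h∈ →
             card-collision large (proj₁ (∈-range⁻ {N = H′} h∈)) (proj₂ (∈-range⁻ h∈)) X) ⟩
      length (range H′) * (X + H * H)  ≡⟨ cong (_* (X + H * H)) (length-range H′) ⟩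
      H′ * (X + H * H)       ≤⟨ *-monoˡ-≤ (X + H * H) (n≤1+n H′) ⟩
      H * (X + H * H)        ∎)
    _↝_ : ℕ → ℕ ⊎ ℕ × ℕ → Set
    x ↝ inj₁ y = x ≡ y
    x ↝ inj₂ (_ , y) = x ≡ y
    injective : ∀ {x x′ y} → x ↝ y → x′ ↝ y → x ≡ x′
    injective {y = inj₁ _} refl refl = refl
    injective {y = inj₂ _} refl refl = refl
    total : ∀ {x} → x ∈ upTo X → T (residueᵇ m p x) → ∃ λ y → y ∈ targets × T (Q y) × x ↝ y
    total {x} x∈ r with isolated? x in eq
    ... | no _ = inj₁ x , ∈-++⁺ˡ (∈-map⁺ inj₁ x∈) ,
      from (T-∧ {residueᵇ m p x}) (r , subst (λ d → T (not ⌊ d ⌋)) (sym eq) _) , refl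
    ... | yes i with find i
    ... | h , h∈ , d = inj₂ (h , x) , ∈-++⁺ʳ (map inj₁ (upTo X)) (∈-map⁺ inj₂ (∈-⊗⁺ h∈ x∈)) ,
      fromWitness (residue-difference m p x h r (fromWitness d)) , refl

open ResidueCount using (card-residue)

-- Size bounds and the box of codes

square-cancel-≤ : ∀ {m n} → m * m ≤ n * n → m ≤ n
square-cancel-≤ m²≤n² = ≮⇒≥ λ n<m → <⇒≱ (*-mono-< n<m n<m) m²≤n²

cube-cancel-≤ : ∀ {m n} → m * m * m ≤ n * n * n → m ≤ n
cube-cancel-≤ m³≤n³ = ≮⇒≥ λ n<m → <⇒≱ (*-mono-< (*-mono-< n<m n<m) n<m) m³≤n³

m+n≤[1+n]*m : ∀ {m} n → 1 ≤ m → m + n ≤ suc n * m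
m+n≤[1+n]*m {m} n 1≤m = +-monoʳ-≤ m (m≤m*n n m {{>-nonZero 1≤m}})

infixl 7 _div_

-- Dividing by 0 gives 0, so that the range of x in `large` can be written for every w.
_div_ : ℕ → ℕ → ℕ
m div zero    = 0
m div n@(suc _) = m / n

≤-div : ∀ {m n x} → 1 ≤ n → n * x ≤ m → x ≤ m div n
≤-div {m} {n@(suc _)} {x} _ nx≤m = begin
  x            ≡⟨ sym (m*n/n≡m x n) ⟩
  x * n / n    ≤⟨ /-monoˡ-≤ n (≤-trans (≤-reflexive (*-comm x n)) nx≤m) ⟩
  m / n        ∎
  where open ≤-Reasoning

n*[m-div-n]≤m : ∀ m n → n * (m div n) ≤ m
n*[m-div-n]≤m m zero = z≤n
n*[m-div-n]≤m m n@(suc _) = ≤-trans (≤-reflexive (*-comm n (m / n))) (m/n*n≤m m n)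

module SortedBounds {m m′ : ℤ} {μ l p q z w x : ℕ} (∣m∣≤μ : ∣ m ∣ ≤ μ) (∣m′∣≤μ : ∣ m′ ∣ ≤ μ)
  (1≤p : 1 ≤ p) (p≤q : p ≤ q) (q≤z : q ≤ z) (pqz≤l⁶ : p * q * z ≤ l * l * (l * l) * (l * l))
  (pq : Root m p q w) (pz : Root m′ p z x) where
  open ≤-Reasoning
  private
    K = l * l
    1≤q = ≤-trans 1≤p p≤q
    1≤z = ≤-trans 1≤q q≤z

    w²≤pq+μ : w * w ≤ p * q + μ
    w²≤pq+μ = ≤-trans (proj₁ (root-bounds pq)) (+-monoʳ-≤ (p * q) ∣m∣≤μ)

    pq≤w²+μ : p * q ≤ w * w + μ
    pq≤w²+μ = ≤-trans (proj₂ (root-bounds pq)) (+-monoʳ-≤ (w * w) ∣m∣≤μ)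

    w²≤[1+μ]pq : w * w ≤ suc μ * (p * q)
    w²≤[1+μ]pq = ≤-trans w²≤pq+μ (m+n≤[1+n]*m μ (*-mono-≤ 1≤p 1≤q))

    x²≤[1+μ]pz : x * x ≤ suc μ * (p * z)
    x²≤[1+μ]pz = ≤-trans (proj₁ (root-bounds pz)) (≤-trans (+-monoʳ-≤ (p * z) ∣m′∣≤μ)
      (m+n≤[1+n]*m μ (*-mono-≤ 1≤p 1≤z)))

    square-* : ∀ a b → a * b * (a * b) ≡ a * a * (b * b)
    square-* = solve-∀

    square-+ : ∀ a b → a * a + b * b ≤ (a + b) * (a + b)
    square-+ a b = ≤-trans (m≤m+n _ (2 * a * b)) (≤-reflexive (expand a b))
      where
      expand : ∀ a b → a * a + b * b + 2 * a * b ≡ (a + b) * (a + b)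
      expand = solve-∀

  -- The product p q z is compared with a sixth power because both its cube root K = l², which
  -- governs p and w, and its square root l K, which governs x, are then integers.
  p≤K : p ≤ K
  p≤K = cube-cancel-≤ (≤-trans (*-mono-≤ (*-monoʳ-≤ p p≤q) (≤-trans p≤q q≤z)) pqz≤l⁶)

  pq≤K² : p * q ≤ K * K
  pq≤K² = cube-cancel-≤ (begin
    p * q * (p * q) * (p * q)      ≤⟨ *-monoʳ-≤ (p * q * (p * q)) (*-mono-≤ (≤-trans p≤q q≤z) q≤z) ⟩
    p * q * (p * q) * (z * z)      ≡⟨ sym (square-* (p * q) z) ⟩
    p * q * z * (p * q * z)        ≤⟨ *-mono-≤ pqz≤l⁶ pqz≤l⁶ ⟩
    K * K * K * (K * K * K)        ≡⟨ regroup K ⟩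
    K * K * (K * K) * (K * K)      ∎)
    where
    regroup : ∀ k → k * k * k * (k * k * k) ≡ k * k * (k * k) * (k * k)
    regroup = solve-∀

  w≤K+μ : w ≤ K + μ
  w≤K+μ = square-cancel-≤ (begin
    w * w              ≤⟨ w²≤pq+μ ⟩
    p * q + μ          ≤⟨ +-mono-≤ pq≤K² (m≤m*m μ) ⟩
    K * K + μ * μ      ≤⟨ square-+ K μ ⟩
    (K + μ) * (K + μ)  ∎)

  p≤w+μ : p ≤ w + μ
  p≤w+μ = square-cancel-≤ (begin
    p * p              ≤⟨ *-monoʳ-≤ p p≤q ⟩
    p * q              ≤⟨ pq≤w²+μ ⟩
    w * w + μ          ≤⟨ +-monoʳ-≤ (w * w) (m≤m*m μ) ⟩
    w * w + μ * μ      ≤⟨ square-+ w μ ⟩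
    (w + μ) * (w + μ)  ∎)

  -- Sharper than the product of the separate bounds on w and x: up to constants (w x)² is p² q z =
  -- p · p q z, at most K · K³.
  wx≤ : w * x ≤ suc μ * (K * K)
  wx≤ = square-cancel-≤ (begin
    w * x * (w * x)                          ≡⟨ square-* w x ⟩
    w * w * (x * x)                          ≤⟨ *-mono-≤ w²≤[1+μ]pq x²≤[1+μ]pz ⟩
    suc μ * (p * q) * (suc μ * (p * z))      ≡⟨ regroup (suc μ) p q z ⟩
    suc μ * suc μ * (p * (p * q * z))        ≤⟨ *-monoʳ-≤ (suc μ * suc μ) (*-mono-≤ p≤K pqz≤l⁶) ⟩
    suc μ * suc μ * (K * (K * K * K))        ≡⟨ collect (suc μ) K ⟩
    suc μ * (K * K) * (suc μ * (K * K))      ∎)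
    where
    regroup : ∀ u p q z → u * (p * q) * (u * (p * z)) ≡ u * u * (p * (p * q * z))
    regroup = solve-∀
    collect : ∀ u k → u * u * (k * (k * k * k)) ≡ u * (k * k) * (u * (k * k))
    collect = solve-∀

  x≤ : x ≤ suc μ * (l * K)
  x≤ = square-cancel-≤ (begin
    x * x                                    ≤⟨ x²≤[1+μ]pz ⟩
    suc μ * (p * z)                          ≤⟨ *-monoʳ-≤ (suc μ) (≤-trans (*-monoˡ-≤ z (m≤m*n p q {{>-nonZero 1≤q}})) pqz≤l⁶) ⟩
    suc μ * (K * K * K)                      ≤⟨ *-monoˡ-≤ (K * K * K) (m≤m*m (suc μ)) ⟩
    suc μ * suc μ * (K * K * K)              ≡⟨ collect (suc μ) l ⟩
    suc μ * (l * K) * (suc μ * (l * K))      ∎)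
    where
    collect : ∀ u l → u * u * (l * l * (l * l) * (l * l)) ≡ u * (l * (l * l)) * (u * (l * (l * l)))
    collect = solve-∀

  -- For w = 0 the bound on w x says nothing about x; such codes have p ≤ μ ≤ P and fall into
  -- `small`.
  w≡0⇒p≤μ : w ≡ 0 → p ≤ μ
  w≡0⇒p≤μ refl = ≤-trans (m≤m*n p q {{>-nonZero 1≤q}}) pq≤w²+μ

module Box (μ l P : ℕ) where
  private
    K = l * l
    M = suc μ * (K * K)

  -- The moduli p ≤ P. There are about P K · l K = P l⁵ such codes, which is o(l⁶) for fixed P.
  small : List (ℕ × ℕ × ℕ)
  small = upTo (suc (K + μ)) ⊗ λ _ → range P ⊗ λ _ → upTo (suc (suc μ * (l * K)))

  -- The moduli p > P, written as P plus an element of `range (w + μ)`. Here x runs only up to M /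
  -- w, so the row of w has O(M) entries and the whole list O(K M) = O(l⁶).
  large : List (ℕ × ℕ × ℕ)
  large = range (K + μ) ⊗ λ w → map (λ p → P + p) (range (w + μ)) ⊗ λ _ → upTo (suc (M div w))

  box : List (ℕ × ℕ × ℕ)
  box = small ++ large

  ∈-box : ∀ {w p x} → μ ≤ P → 1 ≤ p → w ≤ K + μ → p ≤ w + μ → w * x ≤ M → x ≤ suc μ * (l * K) →
          (w ≡ 0 → p ≤ μ) → (w , p , x) ∈ box
  ∈-box {w} {p} {x} μ≤P 1≤p w≤ p≤ wx≤ x≤ w≡0 with p ≤? P
  ... | yes p≤P = ∈-++⁺ˡ (∈-⊗⁺ (∈-upTo⁺ (s≤s w≤)) (∈-⊗⁺ (∈-range⁺ 1≤p p≤P) (∈-upTo⁺ (s≤s x≤))))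
  ... | no p≰P with m≤n⇒∃[o]m+o≡n (≰⇒> p≰P)
  ... | k , refl = ∈-++⁺ʳ small (∈-⊗⁺ (∈-range⁺ 1≤w w≤)
    (∈-⊗⁺ (subst (_∈ map (λ p → P + p) (range (w + μ))) (+-suc P k)
             (∈-map⁺ (λ p → P + p) (∈-range⁺ (s≤s z≤n) (≤-trans (s≤s (m≤n+m k P)) p≤))))
           (∈-upTo⁺ (s≤s (≤-div 1≤w wx≤)))))
    where
    1≤w : 1 ≤ w
    1≤w = n≢0⇒n>0 λ w≡ → p≰P (≤-trans (w≡0 w≡) μ≤P)

  length-small : length small ≡ suc (K + μ) * (P * suc (suc μ * (l * K)))
  length-small = trans (length-⊗-const (upTo (suc (K + μ))) (range P ⊗ λ _ → upTo (suc (suc μ * (l * K)))))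
    (cong₂ _*_ (length-upTo (suc (K + μ))) (trans (length-⊗-const (range P) (upTo (suc (suc μ * (l * K)))))
      (cong₂ _*_ (length-range P) (length-upTo (suc (suc μ * (l * K)))))))

  -- For fixed w there are at most (1 + μ) w moduli, and each keeps about 2 M / (w H) of the x. The
  -- factors w cancel, so every row contributes O(M / H).
  card-large : ∀ m H′ → let H = suc H′ in 2 * H * (H * H) ≤ P →
    H * card (λ (w , p , x) → residueᵇ m p x) large
      ≤ (K + μ) * (suc μ * (2 * M + (K + μ) * (2 + (H + H * H))))
  card-large m H′ H-small = begin
    H * card Q large
      ≡⟨ cong (λ x → H * x) (card-⊗ Q (range (K + μ)) _) ⟩
    H * sum (map row (range (K + μ)))
      ≡⟨ sym (sum-map-* H row (range (K + μ))) ⟩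
    sum (map (λ w → H * row w) (range (K + μ)))
      ≤⟨ sum-map-≤const (λ w → H * row w) bound (range (K + μ))
           (λ w∈ → row≤ (proj₁ (∈-range⁻ {N = K + μ} w∈)) (proj₂ (∈-range⁻ {N = K + μ} w∈))) ⟩
    length (range (K + μ)) * bound
      ≡⟨ cong (_* bound) (length-range (K + μ)) ⟩
    (K + μ) * bound ∎
    where
    open ≤-Reasoning
    H = suc H′
    G = 2 + (H + H * H)
    bound = suc μ * (2 * M + (K + μ) * G)
    Q : ℕ × ℕ × ℕ → Bool
    Q (w , p , x) = residueᵇ m p x
    ps : ℕ → List ℕ
    ps w = map (λ p → P + p) (range (w + μ))
    row : ℕ → ℕ
    row w = card (λ (p , x) → residueᵇ m p x) (ps w ⊗ λ _ → upTo (suc (M div w)))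

    row≤ : ∀ {w} → 1 ≤ w → w ≤ K + μ → H * row w ≤ bound
    row≤ {w} 1≤w w≤ = begin
      H * row w
        ≡⟨ cong (λ x → H * x) (card-⊗ _ (ps w) _) ⟩
      H * sum (map (λ p → card (residueᵇ m p) (upTo (suc (M div w)))) (ps w))
        ≡⟨ sym (sum-map-* H _ (ps w)) ⟩
      sum (map (λ p → H * card (residueᵇ m p) (upTo (suc (M div w)))) (ps w))
        ≤⟨ sum-map-≤const _ (2 * suc (M div w) + (H + H * H)) (ps w) entry≤ ⟩
      length (ps w) * (2 * suc (M div w) + (H + H * H))
        ≡⟨ cong (_* (2 * suc (M div w) + (H + H * H))) (trans (length-map _ (range (w + μ))) (length-range (w + μ))) ⟩
      (w + μ) * (2 * suc (M div w) + (H + H * H))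
        ≤⟨ *-monoˡ-≤ _ (m+n≤[1+n]*m μ 1≤w) ⟩
      suc μ * w * (2 * suc (M div w) + (H + H * H))
        ≡⟨ regroup (suc μ) w (M div w) (H + H * H) ⟩
      suc μ * (2 * (w * (M div w)) + w * G)
        ≤⟨ *-monoʳ-≤ (suc μ) (+-mono-≤ (*-monoʳ-≤ 2 (n*[m-div-n]≤m M w)) (*-monoˡ-≤ G w≤)) ⟩
      bound ∎
      where
      regroup : ∀ u w d g → u * w * (2 * suc d + g) ≡ u * (2 * (w * d) + w * (2 + g))
      regroup = solve-∀
      entry≤ : ∀ {p} → p ∈ ps w →
               H * card (residueᵇ m p) (upTo (suc (M div w))) ≤ 2 * suc (M div w) + (H + H * H)
      entry≤ p∈ with ∈-map⁻ (λ p → P + p) p∈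
      ... | k , _ , refl = card-residue m (P + k) H′ (≤-trans H-small (m≤m+n P k)) (suc (M div w))

-- Descent for irregular triples

square-∣∣ : ∀ i → i *ᶻ i ≡ + (∣ i ∣ * ∣ i ∣)
square-∣∣ (+ m)    = sym (ℤ.pos-* m m)
square-∣∣ -[1+ m ] = refl

root-ℤ : ∀ {n a b r} → Root n a b r → + a *ᶻ + b +ᶻ n ≡ + r *ᶻ + r
root-ℤ {n} {a} {b} {r} (root eq) =
  trans (cong (_+ᶻ n) (sym (ℤ.pos-* a b))) (trans eq (ℤ.pos-* r r))

root-ℕ : ∀ {n a b r} → + a *ᶻ + b +ᶻ n ≡ r *ᶻ r → Root n a b ∣ r ∣
root-ℕ {n} {a} {b} {r} eq =
  root (trans (cong (_+ᶻ n) (ℤ.pos-* a b)) (trans eq (square-∣∣ r)))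

-- The number e of the descent; it vanishes exactly when c = a + b ± 2 r.
defect : (n A B C r s t : ℤ) → ℤ
defect n A B C r s t = n *ᶻ (A +ᶻ B +ᶻ C) +ᶻ + 2 *ᶻ (A *ᶻ B *ᶻ C) -ᶻ + 2 *ᶻ (r *ᶻ s *ᶻ t)

module Defect (n A B C r s t : ℤ) (AB : A *ᶻ B +ᶻ n ≡ r *ᶻ r) (AC : A *ᶻ C +ᶻ n ≡ s *ᶻ s) (BC : B *ᶻ C +ᶻ n ≡ t *ᶻ t) where
  open ≡-Reasoning

  defect-square : A *ᶻ defect n A B C r s t +ᶻ n *ᶻ n ≡ (A *ᶻ t -ᶻ r *ᶻ s) *ᶻ (A *ᶻ t -ᶻ r *ᶻ s)
  defect-square = begin
    A *ᶻ defect n A B C r s t +ᶻ n *ᶻ n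
      ≡⟨ identity n A B C (r *ᶻ s *ᶻ t) ⟩
    A *ᶻ A *ᶻ (B *ᶻ C +ᶻ n) +ᶻ (A *ᶻ B +ᶻ n) *ᶻ (A *ᶻ C +ᶻ n) -ᶻ + 2 *ᶻ A *ᶻ (r *ᶻ s *ᶻ t)
      ≡⟨ cong₂ (λ x y → x +ᶻ y -ᶻ + 2 *ᶻ A *ᶻ (r *ᶻ s *ᶻ t)) (cong (A *ᶻ A *ᶻ_) BC) (cong₂ _*ᶻ_ AB AC) ⟩
    A *ᶻ A *ᶻ (t *ᶻ t) +ᶻ r *ᶻ r *ᶻ (s *ᶻ s) -ᶻ + 2 *ᶻ A *ᶻ (r *ᶻ s *ᶻ t)
      ≡⟨ complete A r s t ⟩
    (A *ᶻ t -ᶻ r *ᶻ s) *ᶻ (A *ᶻ t -ᶻ r *ᶻ s) ∎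
    where
    identity : ∀ n A B C ρ →
      A *ᶻ (n *ᶻ (A +ᶻ B +ᶻ C) +ᶻ + 2 *ᶻ (A *ᶻ B *ᶻ C) -ᶻ + 2 *ᶻ ρ) +ᶻ n *ᶻ n ≡
      A *ᶻ A *ᶻ (B *ᶻ C +ᶻ n) +ᶻ (A *ᶻ B +ᶻ n) *ᶻ (A *ᶻ C +ᶻ n) -ᶻ + 2 *ᶻ A *ᶻ ρ
    identity = ℤSolver.solve-∀
    complete : ∀ A r s t →
      A *ᶻ A *ᶻ (t *ᶻ t) +ᶻ r *ᶻ r *ᶻ (s *ᶻ s) -ᶻ + 2 *ᶻ A *ᶻ (r *ᶻ s *ᶻ t) ≡
      (A *ᶻ t -ᶻ r *ᶻ s) *ᶻ (A *ᶻ t -ᶻ r *ᶻ s)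
    complete = ℤSolver.solve-∀

  -- The second factor is the conjugate of e, in which r s t has the opposite sign; their product is
  -- rational in r² s² t², which the root equations eliminate. This identity decides when e = 0 and
  -- bounds e by about n² c² / (4 r s t).
  defect-product : let e = defect n A B C r s t; D = C -ᶻ A -ᶻ B in
    e *ᶻ (e +ᶻ + 4 *ᶻ (r *ᶻ s *ᶻ t)) +ᶻ n *ᶻ n *ᶻ (+ 4 *ᶻ (r *ᶻ r)) ≡ n *ᶻ n *ᶻ (D *ᶻ D)
  defect-product = begin
    e *ᶻ (e +ᶻ + 4 *ᶻ (r *ᶻ s *ᶻ t)) +ᶻ n *ᶻ n *ᶻ (+ 4 *ᶻ (r *ᶻ r))
      ≡⟨ difference (n *ᶻ (A +ᶻ B +ᶻ C) +ᶻ + 2 *ᶻ (A *ᶻ B *ᶻ C)) n r s t ⟩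
    P *ᶻ P -ᶻ + 4 *ᶻ (r *ᶻ r *ᶻ (s *ᶻ s) *ᶻ (t *ᶻ t)) +ᶻ n *ᶻ n *ᶻ (+ 4 *ᶻ (r *ᶻ r))
      ≡⟨ cong₂ (λ x y → P *ᶻ P -ᶻ + 4 *ᶻ x +ᶻ n *ᶻ n *ᶻ (+ 4 *ᶻ y))
           (cong₂ _*ᶻ_ (cong₂ _*ᶻ_ (sym AB) (sym AC)) (sym BC)) (sym AB) ⟩
    P *ᶻ P -ᶻ + 4 *ᶻ ((A *ᶻ B +ᶻ n) *ᶻ (A *ᶻ C +ᶻ n) *ᶻ (B *ᶻ C +ᶻ n)) +ᶻ n *ᶻ n *ᶻ (+ 4 *ᶻ (A *ᶻ B +ᶻ n))
      ≡⟨ identity n A B C ⟩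
    n *ᶻ n *ᶻ (D *ᶻ D) ∎
    where
    e = defect n A B C r s t
    D = C -ᶻ A -ᶻ B
    P = n *ᶻ (A +ᶻ B +ᶻ C) +ᶻ + 2 *ᶻ (A *ᶻ B *ᶻ C)
    difference : ∀ P n r s t →
      (P -ᶻ + 2 *ᶻ (r *ᶻ s *ᶻ t)) *ᶻ (P -ᶻ + 2 *ᶻ (r *ᶻ s *ᶻ t) +ᶻ + 4 *ᶻ (r *ᶻ s *ᶻ t)) +ᶻ n *ᶻ n *ᶻ (+ 4 *ᶻ (r *ᶻ r)) ≡
      P *ᶻ P -ᶻ + 4 *ᶻ (r *ᶻ r *ᶻ (s *ᶻ s) *ᶻ (t *ᶻ t)) +ᶻ n *ᶻ n *ᶻ (+ 4 *ᶻ (r *ᶻ r))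
    difference = ℤSolver.solve-∀
    identity : ∀ n A B C →
      (n *ᶻ (A +ᶻ B +ᶻ C) +ᶻ + 2 *ᶻ (A *ᶻ B *ᶻ C)) *ᶻ (n *ᶻ (A +ᶻ B +ᶻ C) +ᶻ + 2 *ᶻ (A *ᶻ B *ᶻ C))
        -ᶻ + 4 *ᶻ ((A *ᶻ B +ᶻ n) *ᶻ (A *ᶻ C +ᶻ n) *ᶻ (B *ᶻ C +ᶻ n)) +ᶻ n *ᶻ n *ᶻ (+ 4 *ᶻ (A *ᶻ B +ᶻ n)) ≡
      n *ᶻ n *ᶻ ((C -ᶻ A -ᶻ B) *ᶻ (C -ᶻ A -ᶻ B))
    identity = ℤSolver.solve-∀

  -- Inverts the descent: r, a and the signed roots of a e + n² and b e + n² give back s, and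
  -- thereby c.
  defect-linear : r *ᶻ (A *ᶻ t -ᶻ r *ᶻ s) +ᶻ A *ᶻ (B *ᶻ s -ᶻ r *ᶻ t) ≡ -ᶻ (n *ᶻ s)
  defect-linear = begin
    r *ᶻ (A *ᶻ t -ᶻ r *ᶻ s) +ᶻ A *ᶻ (B *ᶻ s -ᶻ r *ᶻ t)  ≡⟨ gather A B r s t ⟩
    (A *ᶻ B -ᶻ r *ᶻ r) *ᶻ s                            ≡⟨ cong (λ x → (A *ᶻ B -ᶻ x) *ᶻ s) (sym AB) ⟩
    (A *ᶻ B -ᶻ (A *ᶻ B +ᶻ n)) *ᶻ s                     ≡⟨ cancel (A *ᶻ B) n s ⟩
    -ᶻ (n *ᶻ s)                                        ∎
    where
    gather : ∀ A B r s t → r *ᶻ (A *ᶻ t -ᶻ r *ᶻ s) +ᶻ A *ᶻ (B *ᶻ s -ᶻ r *ᶻ t) ≡ (A *ᶻ B -ᶻ r *ᶻ r) *ᶻ s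
    gather = ℤSolver.solve-∀
    cancel : ∀ x n s → (x -ᶻ (x +ᶻ n)) *ᶻ s ≡ -ᶻ (n *ᶻ s)
    cancel = ℤSolver.solve-∀

-- By symmetry `defect-square` also holds with c, and by `defect-swap₂` with b, in the place of a.
defect-swap : ∀ n A B C r s t → defect n C A B s t r ≡ defect n A B C r s t
defect-swap = expanded
  where
  expanded : ∀ n A B C r s t →
    n *ᶻ (C +ᶻ A +ᶻ B) +ᶻ + 2 *ᶻ (C *ᶻ A *ᶻ B) -ᶻ + 2 *ᶻ (s *ᶻ t *ᶻ r) ≡
    n *ᶻ (A +ᶻ B +ᶻ C) +ᶻ + 2 *ᶻ (A *ᶻ B *ᶻ C) -ᶻ + 2 *ᶻ (r *ᶻ s *ᶻ t)
  expanded = ℤSolver.solve-∀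

defect-swap₂ : ∀ n A B C r s t → defect n B A C r t s ≡ defect n A B C r s t
defect-swap₂ = expanded
  where
  expanded : ∀ n A B C r s t →
    n *ᶻ (B +ᶻ A +ᶻ C) +ᶻ + 2 *ᶻ (B *ᶻ A *ᶻ C) -ᶻ + 2 *ᶻ (r *ᶻ t *ᶻ s) ≡
    n *ᶻ (A +ᶻ B +ᶻ C) +ᶻ + 2 *ᶻ (A *ᶻ B *ᶻ C) -ᶻ + 2 *ᶻ (r *ᶻ s *ᶻ t)
  expanded = ℤSolver.solve-∀

signed : Bool → ℕ → ℤ
signed true  w = + w
signed false w = -ᶻ + w

signed-∣∣ : ∀ i → ∃ λ σ → i ≡ signed σ ∣ i ∣
signed-∣∣ (+ m)    = true , refl
signed-∣∣ -[1+ m ] = false , refl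

-- x and y are the absolute values of a t - r s and b s - r t, and σ and τ their signs. The square
-- equations forget the signs, but `linear` depends on them.
record Descent (n : ℤ) (a b c : ℕ) (σ τ : Bool) : Set where
  field
    {e r s x y} : ℕ
    1≤a    : 1 ≤ a
    1≤e    : 1 ≤ e
    ab     : Root n a b r
    ac     : Root n a c s
    ae     : Root (n *ᶻ n) a e x
    be     : Root (n *ᶻ n) b e y
    linear : + r *ᶻ signed σ x +ᶻ + a *ᶻ signed τ y ≡ -ᶻ (n *ᶻ + s)
    size   : a * b * e ≤ suc ∣ n ∣ * suc ∣ n ∣ * (∣ n ∣ * ∣ n ∣) * c

-- If c = a + b - 2 r, then c > b forces 2 r < a < b. So a b ≥ (r + 1) b exceeds r² by at least b,
-- and since it exceeds r² by at most |n|, it follows that b ≤ |n|.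
regular-or-small : ∀ {n a b c r} → Root n a b r → a < b → b < c →
                   ∣ + c -ᶻ + a -ᶻ + b ∣ ≡ 2 * r → (c ≡ a + b + 2 * r) ⊎ c ≤ 2 * ∣ n ∣
regular-or-small {n} {a} {b} {c} {r} ab a<b b<c eq with a + b ≤? c
... | yes a+b≤c with m≤n⇒∃[o]m+o≡n a+b≤c
... | k , refl = inj₁ (cong (λ x → a + b + x) (trans (sym (cong ∣_∣ (cancel (+ a) (+ b) (+ k)))) eq))
  where
  cancel : ∀ A B K → (A +ᶻ B +ᶻ K) -ᶻ A -ᶻ B ≡ K
  cancel = ℤSolver.solve-∀
regular-or-small {n} {a} {b} {c} {r} ab a<b b<c eq | no a+b≰c with m≤n⇒∃[o]m+o≡n (<⇒≤ (≰⇒> a+b≰c))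
... | k , c+k≡a+b = inj₂ (begin
  c                  ≤⟨ m≤m+n c k ⟩
  c + k              ≡⟨ c+k≡a+b ⟩
  a + b              ≤⟨ +-monoˡ-≤ b (<⇒≤ a<b) ⟩
  b + b              ≤⟨ +-mono-≤ b≤κ b≤κ ⟩
  κ + κ              ≡⟨ cong (λ x → κ + x) (sym (+-identityʳ κ)) ⟩
  2 * κ              ∎)
  where
  open ≤-Reasoning
  κ = ∣ n ∣
  cancel : ∀ A B C → C -ᶻ A -ᶻ B ≡ C -ᶻ (A +ᶻ B)
  cancel = ℤSolver.solve-∀
  cancel′ : ∀ C K → C -ᶻ (C +ᶻ K) ≡ -ᶻ K
  cancel′ = ℤSolver.solve-∀
  k≡2r : k ≡ 2 * r
  k≡2r = trans (sym (trans (cong ∣_∣ (trans (cancel (+ a) (+ b) (+ c))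
    (trans (cong (λ x → + c -ᶻ + x) (sym c+k≡a+b)) (cancel′ (+ c) (+ k))))) (ℤ.∣-i∣≡∣i∣ (+ k)))) eq
  2r<a : 2 * r < a
  2r<a = +-cancelˡ-< b (2 * r) a (begin-strict
    b + 2 * r        <⟨ +-monoˡ-< (2 * r) b<c ⟩
    c + 2 * r        ≡⟨ cong (λ x → c + x) (sym k≡2r) ⟩
    c + k            ≡⟨ c+k≡a+b ⟩
    a + b            ≡⟨ +-comm a b ⟩
    b + a            ∎)
  r<a : r < a
  r<a = ≤-<-trans (m≤m+n r (r + 0)) 2r<a
  b≤κ : b ≤ κ
  b≤κ = +-cancelˡ-≤ (r * r) b κ (begin
    r * r + b        ≤⟨ +-monoˡ-≤ b (*-monoʳ-≤ r (<⇒≤ (<-trans r<a a<b))) ⟩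
    r * b + b        ≡⟨ +-comm (r * b) b ⟩
    suc r * b        ≤⟨ *-monoˡ-≤ b r<a ⟩
    a * b            ≤⟨ proj₂ (root-bounds ab) ⟩
    r * r + κ        ∎)

-- The last premise gives e · r s t ≤ κ² c², and a b c is at most a constant times r s t; cancelling
-- one c leaves the claim. For r = 0 this is void, but then a b ≤ κ and e ≤ κ c.
size-bound : ∀ {κ a b c r s t e} → 1 ≤ a → 1 ≤ b → κ < c →
             a * b ≤ r * r + κ → a * c ≤ s * s + κ → b * c ≤ t * t + κ →
             e * (e + 4 * (r * s * t)) ≤ κ * κ * (c * c) →
             a * b * e ≤ suc κ * suc κ * (κ * κ) * c
size-bound {κ} {a} {b} {c} {zero} {s} {t} {e} 1≤a 1≤b κ<c ab ac bc ee = begin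
  a * b * e                          ≤⟨ *-mono-≤ ab e≤κc ⟩
  κ * (κ * c)                        ≡⟨ sym (*-assoc κ κ c) ⟩
  κ * κ * c                          ≤⟨ *-monoˡ-≤ c (m≤n*m (κ * κ) (suc κ * suc κ)) ⟩
  suc κ * suc κ * (κ * κ) * c        ∎
  where
  open ≤-Reasoning
  regroup : ∀ k c → k * k * (c * c) ≡ k * c * (k * c)
  regroup = solve-∀
  e≤κc : e ≤ κ * c
  e≤κc = square-cancel-≤ (begin
    e * e                            ≡⟨ cong (λ x → e * x) (sym (+-identityʳ e)) ⟩
    e * (e + 4 * 0)                  ≤⟨ ee ⟩
    κ * κ * (c * c)                  ≡⟨ regroup κ c ⟩
    κ * c * (κ * c)                  ∎)
size-bound {κ} {a} {b} {c} {r@(suc _)} {s} {t} {e} 1≤a 1≤b κ<c ab ac bc ee =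
  *-cancelʳ-≤ (a * b * e) (U * U * (κ * κ) * c) c {{>-nonZero (≤-trans (s≤s z≤n) κ<c)}} (begin
    a * b * e * c                    ≡⟨ commute (a * b) e c ⟩
    a * b * c * e                    ≤⟨ *-monoˡ-≤ e abc≤ ⟩
    U * U * ρ * e                    ≡⟨ *-assoc (U * U) ρ e ⟩
    U * U * (ρ * e)                  ≤⟨ *-monoʳ-≤ (U * U) (begin
      ρ * e                            ≡⟨ *-comm ρ e ⟩
      e * ρ                            ≤⟨ *-monoʳ-≤ e (≤-trans (m≤m+n ρ (3 * ρ)) (m≤n+m (4 * ρ) e)) ⟩
      e * (e + 4 * ρ)                  ≤⟨ ee ⟩
      κ * κ * (c * c)                  ∎) ⟩
    U * U * (κ * κ * (c * c))        ≡⟨ regroup (U * U) (κ * κ) c ⟩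
    U * U * (κ * κ) * c * c          ∎)
  where
  open ≤-Reasoning
  U = suc κ
  ρ = r * s * t
  commute : ∀ x e c → x * e * c ≡ x * c * e
  commute = solve-∀
  regroup : ∀ u k c → u * (k * (c * c)) ≡ u * k * c * c
  regroup = solve-∀
  positive : ∀ {x} y → 1 ≤ x → x * c ≤ y * y + κ → 1 ≤ y
  positive {x} zero 1≤x xc≤κ = contradiction (≤-trans (m≤n*m c x {{>-nonZero 1≤x}}) xc≤κ) (<⇒≱ κ<c)
  positive (suc y) _ _ = s≤s z≤n
  enlarge : ∀ {x} y → 1 ≤ y → x ≤ y * y + κ → x ≤ U * (y * y)
  enlarge y 1≤y x≤ = ≤-trans x≤ (m+n≤[1+n]*m κ (*-mono-≤ 1≤y 1≤y))
  factor : ∀ a b c → a * b * c * (a * b * c) ≡ a * b * (a * c) * (b * c)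
  factor = solve-∀
  collect : ∀ u r s t → u * (r * r) * (u * (s * s)) * (u * (t * t)) ≡ u * u * u * (r * s * t * (r * s * t))
  collect = solve-∀
  square′ : ∀ u x → u * (u * u * u * (x * x)) ≡ u * u * x * (u * u * x)
  square′ = solve-∀
  abc≤ : a * b * c ≤ U * U * ρ
  abc≤ = square-cancel-≤ (begin
    a * b * c * (a * b * c)          ≡⟨ factor a b c ⟩
    a * b * (a * c) * (b * c)        ≤⟨ *-mono-≤ (*-mono-≤ (enlarge r (s≤s z≤n) ab)
                                          (enlarge s (positive s 1≤a ac) ac)) (enlarge t (positive t 1≤b bc) bc) ⟩
    U * (r * r) * (U * (s * s)) * (U * (t * t)) ≡⟨ collect U r s t ⟩
    -- A further factor U turns U³ into a square.
    U * U * U * (ρ * ρ)              ≤⟨ m≤n*m (U * U * U * (ρ * ρ)) U ⟩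
    U * (U * U * U * (ρ * ρ))        ≡⟨ square′ U ρ ⟩
    U * U * ρ * (U * U * ρ)          ∎)

∣c-a-b∣≤c : ∀ {a b c} → a < b → b < c → ∣ + c -ᶻ + a -ᶻ + b ∣ ≤ c
∣c-a-b∣≤c {a} {b} {c} a<b b<c = subst (λ x → ∣ x ∣ ≤ c) (sym (swap (+ c) (+ a) (+ b)))
  (subst (_≤ c) (cong ∣_∣ (sym (ℤ.m-n≡m⊖n c (a + b)))) bound)
  where
  swap : ∀ C A B → C -ᶻ A -ᶻ B ≡ C -ᶻ (A +ᶻ B)
  swap = ℤSolver.solve-∀
  bound : ∣ c ℤ.⊖ (a + b) ∣ ≤ c
  bound with a + b ≤? c
  ... | yes a+b≤c = subst (_≤ c) (sym (cong ∣_∣ (ℤ.⊖-≥ a+b≤c))) (m∸n≤m c (a + b))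
  ... | no a+b≰c = subst (_≤ c) (sym (ℤ.∣⊖∣-≤ (<⇒≤ (≰⇒> a+b≰c))))
    (m≤n+o⇒m∸n≤o (a + b) c (+-mono-≤ (<⇒≤ (<-trans a<b b<c)) (<⇒≤ b<c)))

module IrregularTriple {n : ℤ} (n≢0 : n ≢ 0ℤ) {a b c r s t : ℕ} (1≤a : 1 ≤ a) (a<b : a < b) (b<c : b < c)
  (large : 2 * (∣ n ∣ * ∣ n ∣) < c) (irregular : ¬ IsRegular n a b c)
  (ab : Root n a b r) (ac : Root n a c s) (bc : Root n b c t) where
  private
    κ = ∣ n ∣
    AB = root-ℤ ab
    AC = root-ℤ ac
    BC = root-ℤ bc
    BA = root-ℤ (root-sym ab)
    CA = root-ℤ (root-sym ac)
    CB = root-ℤ (root-sym bc)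
    open Defect n (+ a) (+ b) (+ c) (+ r) (+ s) (+ t) AB AC BC
    e = defect n (+ a) (+ b) (+ c) (+ r) (+ s) (+ t)
    D = + c -ᶻ + a -ᶻ + b

    κ²<c : κ * κ < c
    κ²<c = ≤-<-trans (m≤m+n (κ * κ) (κ * κ + 0)) large

    κ<c : κ < c
    κ<c = ≤-<-trans (m≤m*m κ) κ²<c

    2κ<c : 2 * κ < c
    2κ<c = ≤-<-trans (*-monoʳ-≤ 2 (m≤m*m κ)) large

    Z = + c *ᶻ + r -ᶻ + s *ᶻ + t

    ce+n² : + c *ᶻ e +ᶻ n *ᶻ n ≡ Z *ᶻ Z
    ce+n² = subst (λ x → + c *ᶻ x +ᶻ n *ᶻ n ≡ Z *ᶻ Z)
      (defect-swap n (+ a) (+ b) (+ c) (+ r) (+ s) (+ t)) (Defect.defect-square n (+ c) (+ a) (+ b) (+ s) (+ t) (+ r) CA CB AB)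

    be+n² : + b *ᶻ e +ᶻ n *ᶻ n ≡ (+ b *ᶻ + s -ᶻ + r *ᶻ + t) *ᶻ (+ b *ᶻ + s -ᶻ + r *ᶻ + t)
    be+n² = subst (λ x → + b *ᶻ x +ᶻ n *ᶻ n ≡ (+ b *ᶻ + s -ᶻ + r *ᶻ + t) *ᶻ (+ b *ᶻ + s -ᶻ + r *ᶻ + t))
      (defect-swap₂ n (+ a) (+ b) (+ c) (+ r) (+ s) (+ t)) (Defect.defect-square n (+ b) (+ a) (+ c) (+ r) (+ t) (+ s) BA BC AC)

    -- c e + n² is a square, hence not negative, so e < 0 would give c ≤ n².
    defect-nonneg : ∀ {k} → e ≢ -[1+ k ]
    defect-nonneg {k} e≡ = <⇒≱ κ²<c (begin
      c                             ≤⟨ m≤m*n c (suc k) ⟩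
      c * suc k                     ≤⟨ m≤n+m (c * suc k) (∣ Z ∣ * ∣ Z ∣) ⟩
      ∣ Z ∣ * ∣ Z ∣ + c * suc k     ≡⟨ ℤ.+-injective (sym n²≡) ⟩
      κ * κ                         ∎)
      where
      open ≤-Reasoning
      move : ∀ c k m → m ≡ (c *ᶻ (-ᶻ k) +ᶻ m) +ᶻ c *ᶻ k
      move = ℤSolver.solve-∀
      n²≡ : + (κ * κ) ≡ + (∣ Z ∣ * ∣ Z ∣ + c * suc k)
      n²≡ = trans (sym (square-∣∣ n)) (trans (move (+ c) (+ suc k) (n *ᶻ n))
        (cong₂ _+ᶻ_ (trans (cong (λ x → + c *ᶻ x +ᶻ n *ᶻ n) (sym e≡)) (trans ce+n² (square-∣∣ Z)))
                    (sym (ℤ.pos-* c (suc k)))))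

    product-ℕ : ∀ {E} → e ≡ + E → E * (E + 4 * (r * s * t)) + κ * κ * (4 * (r * r)) ≡ κ * κ * (∣ D ∣ * ∣ D ∣)
    product-ℕ {E} e≡ = ℤ.+-injective (begin
      + (E * (E + 4 * (r * s * t))) +ᶻ + (κ * κ * (4 * (r * r)))
        ≡⟨ cong₂ _+ᶻ_ (trans (ℤ.pos-* E _) (cong (λ x → + E *ᶻ (+ E +ᶻ x)) (trans (ℤ.pos-* 4 (r * s * t))
             (cong (+ 4 *ᶻ_) (trans (ℤ.pos-* (r * s) t) (cong (_*ᶻ + t) (ℤ.pos-* r s)))))))
             (trans (ℤ.pos-* (κ * κ) _) (cong₂ _*ᶻ_ (sym (square-∣∣ n))
               (trans (ℤ.pos-* 4 (r * r)) (cong (+ 4 *ᶻ_) (ℤ.pos-* r r))))) ⟩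
      + E *ᶻ (+ E +ᶻ + 4 *ᶻ (+ r *ᶻ + s *ᶻ + t)) +ᶻ n *ᶻ n *ᶻ (+ 4 *ᶻ (+ r *ᶻ + r))
        ≡⟨ cong (λ x → x *ᶻ (x +ᶻ + 4 *ᶻ (+ r *ᶻ + s *ᶻ + t)) +ᶻ n *ᶻ n *ᶻ (+ 4 *ᶻ (+ r *ᶻ + r))) (sym e≡) ⟩
      e *ᶻ (e +ᶻ + 4 *ᶻ (+ r *ᶻ + s *ᶻ + t)) +ᶻ n *ᶻ n *ᶻ (+ 4 *ᶻ (+ r *ᶻ + r))
        ≡⟨ defect-product ⟩
      n *ᶻ n *ᶻ (D *ᶻ D)
        ≡⟨ cong₂ _*ᶻ_ (square-∣∣ n) (square-∣∣ D) ⟩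
      + (κ * κ) *ᶻ + (∣ D ∣ * ∣ D ∣)
        ≡⟨ sym (ℤ.pos-* (κ * κ) _) ⟩
      + (κ * κ * (∣ D ∣ * ∣ D ∣)) ∎)
      where open ≡-Reasoning

    κ-nonZero : NonZero κ
    κ-nonZero = ≢-nonZero λ κ≡0 → n≢0 (ℤ.∣i∣≡0⇒i≡0 κ≡0)

    defect-nonzero : e ≢ + 0
    defect-nonzero e≡0 = irregular-or (regular-or-small ab a<b b<c ∣D∣≡2r)
      where
      irregular-or : (c ≡ a + b + 2 * r) ⊎ c ≤ 2 * κ → ⊥
      irregular-or (inj₁ c≡) = irregular (r , ab , c≡)
      irregular-or (inj₂ c≤) = <⇒≱ 2κ<c c≤
      double : ∀ r → 4 * (r * r) ≡ 2 * r * (2 * r)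
      double = solve-∀
      ∣D∣≡2r : ∣ D ∣ ≡ 2 * r
      ∣D∣≡2r = square-injective (trans (sym (*-cancelˡ-≡ _ _ (κ * κ) {{m*n≢0 κ κ {{κ-nonZero}} {{κ-nonZero}}}} (product-ℕ e≡0))) (double r))

    positive-defect : ∀ {E} → e ≡ + E → 1 ≤ E → ∃ λ σ → ∃ λ τ → Descent n a b c σ τ
    positive-defect {E} e≡ 1≤E with signed-∣∣ (+ a *ᶻ + t -ᶻ + r *ᶻ + s) | signed-∣∣ (+ b *ᶻ + s -ᶻ + r *ᶻ + t)
    ... | σ , X≡ | τ , Y≡ = σ , τ , record
      { 1≤a = 1≤a
      ; 1≤e = 1≤E
      ; ab = ab
      ; ac = ac
      ; ae = root-ℕ {r = + a *ᶻ + t -ᶻ + r *ᶻ + s}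
               (subst (λ e → + a *ᶻ e +ᶻ n *ᶻ n ≡ (+ a *ᶻ + t -ᶻ + r *ᶻ + s) *ᶻ (+ a *ᶻ + t -ᶻ + r *ᶻ + s)) e≡ defect-square)
      ; be = root-ℕ {r = + b *ᶻ + s -ᶻ + r *ᶻ + t}
               (subst (λ e → + b *ᶻ e +ᶻ n *ᶻ n ≡ (+ b *ᶻ + s -ᶻ + r *ᶻ + t) *ᶻ (+ b *ᶻ + s -ᶻ + r *ᶻ + t)) e≡ be+n²)
      ; linear = subst₂ (λ x y → + r *ᶻ x +ᶻ + a *ᶻ y ≡ -ᶻ (n *ᶻ + s)) X≡ Y≡ defect-linear
      ; size = size-bound {κ} {a} {b} {c} {r} {s} {t} {E} 1≤a (≤-trans 1≤a (<⇒≤ a<b)) κ<c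
          (proj₂ (root-bounds ab)) (proj₂ (root-bounds ac)) (proj₂ (root-bounds bc))
          (≤-trans (m≤m+n _ (κ * κ * (4 * (r * r)))) (≤-trans (≤-reflexive (product-ℕ e≡))
            (*-monoʳ-≤ (κ * κ) (*-mono-≤ (∣c-a-b∣≤c a<b b<c) (∣c-a-b∣≤c a<b b<c)))))
      }

    by-sign : ∀ i → e ≡ i → ∃ λ σ → ∃ λ τ → Descent n a b c σ τ
    by-sign (+ zero)  e≡ = contradiction e≡ defect-nonzero
    by-sign (+ suc E) e≡ = positive-defect e≡ (s≤s z≤n)
    by-sign -[1+ k ]  e≡ = contradiction e≡ defect-nonneg

  descent : ∃ λ σ → ∃ λ τ → Descent n a b c σ τ
  descent = by-sign e refl

open IrregularTriple using (descent)

-- Encoding irregular triples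

irregularᵇ : ℤ → ℕ × ℕ × ℕ → Bool
irregularᵇ n (a , b , c) = isTripleᵇ n a b c ∧ not (isRegularᵇ n a b c)

D3irr : ℤ → ℕ → ℕ
D3irr n N = card (irregularᵇ n) (cube N)

D3≡D3reg+D3irr : ∀ n N → D3 n N ≡ D3reg n N + D3irr n N
D3≡D3reg+D3irr n N = begin
  D3 n N                                                    ≡⟨ card-cube (isTripleᵇ n) N ⟩
  card (λ (a , b , c) → isTripleᵇ n a b c) (cube N)         ≡⟨ cong sum (map-cong split (cube N)) ⟩
  sum (map (λ t → one (regularᵇ n t) + one (irregularᵇ n t)) (cube N))
    ≡⟨ sum-map-+ (one ∘ regularᵇ n) (one ∘ irregularᵇ n) (cube N) ⟩
  card (regularᵇ n) (cube N) + D3irr n N                    ≡⟨ cong (_+ D3irr n N) (sym (D3reg≡card n N)) ⟩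
  D3reg n N + D3irr n N                                     ∎
  where
  open ≡-Reasoning
  split : ∀ t → one (isTripleᵇ n (proj₁ t) (proj₁ (proj₂ t)) (proj₂ (proj₂ t))) ≡
                one (regularᵇ n t) + one (irregularᵇ n t)
  split (a , b , c) with isTripleᵇ n a b c | isRegularᵇ n a b c
  ... | false | _     = refl
  ... | true  | true  = refl
  ... | true  | false = refl

cofactor-unique : ∀ {n a b b′ r} → 1 ≤ a → Root n a b r → Root n a b′ r → b ≡ b′
cofactor-unique {n} {a} {b} {b′} 1≤a (root p) (root q) = *-cancelˡ-≡ b b′ a {{>-nonZero 1≤a}}
  (ℤ.+-injective (ℤ+.∙-cancelʳ n (+ (a * b)) (+ (a * b′)) (trans p (sym q))))

module _ {n : ℤ} (n≢0 : n ≢ 0ℤ) where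
  open Descent

  -- The products a b, a e and b e fix r, x and y. With the signs, `linear` then fixes n s, so s
  -- because n ≠ 0, and a c + n = s² fixes c.
  descent-injective : ∀ {a b c c′ σ τ} (d : Descent n a b c σ τ) (d′ : Descent n a b c′ σ τ) →
                      e d ≡ e d′ → c ≡ c′
  descent-injective {a} {σ = σ} {τ} d d′ refl with root-unique (ab d) (ab d′) | root-unique (ae d) (ae d′) | root-unique (be d) (be d′)
  ... | r≡ | x≡ | y≡ = cofactor-unique (1≤a d) (ac d) (subst (Root n _ _) (sym s≡) (ac d′))
    where
    ns≡ : n *ᶻ + s d ≡ n *ᶻ + s d′
    ns≡ = ℤ.neg-injective (trans (sym (linear d)) (trans
      (cong₂ _+ᶻ_ (cong₂ (λ r x → + r *ᶻ signed σ x) r≡ x≡) (cong (λ y → + a *ᶻ signed τ y) y≡)) (linear d′)))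
    s≡ : s d ≡ s d′
    s≡ = ℤ.+-injective (ℤ.*-cancelˡ-≡ n _ _ {{ℤ.≢-nonZero n≢0}} ns≡)

-- The increasing order of a, b and e.
data Order : Set where
  eab aeb abe : Order

orders : List Order
orders = eab ∷ aeb ∷ abe ∷ []

∈-orders : ∀ o → o ∈ orders
∈-orders eab = here refl
∈-orders aeb = there (here refl)
∈-orders abe = there (there (here refl))

Tag : Set
Tag = Order × Bool × Bool

tags : List Tag
tags = orders ⊗ λ _ → bools ⊗ λ _ → bools

∈-tags : ∀ t → t ∈ tags
∈-tags (o , σ , τ) = ∈-⊗⁺ (∈-orders o) (∈-⊗⁺ (∈-bools σ) (∈-bools τ))

-- The m′ in p z + m′ = x². The least and the greatest number are a and b only in the order `aeb`;
-- otherwise e is one of them and n² occurs.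
modulus : ℤ → Tag → ℤ
modulus n (eab , _) = n *ᶻ n
modulus n (aeb , _) = n
modulus n (abe , _) = n *ᶻ n

-- The triple (w, p, x): the root for the least and the middle number, the least number, and the
-- root for the least and the greatest. Division by p recovers the other two numbers.
Code : ∀ {n a b c} (t : Tag) → Descent n a b c (proj₁ (proj₂ t)) (proj₂ (proj₂ t)) → ℕ × ℕ × ℕ → Set
Code (eab , _) d p = p ≡ (Descent.x d , Descent.e d , Descent.y d)
Code {a = a} (aeb , _) d p = p ≡ (Descent.x d , a , Descent.r d)
Code {a = a} (abe , _) d p = p ≡ (Descent.r d , a , Descent.x d)

module Encoding {n : ℤ} (n≢0 : n ≢ 0ℤ) where
  open Descent
  private
    κ = ∣ n ∣
    μ = κ * κ
    B = 2 * μ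

  ∣n²∣≤μ : ∣ n *ᶻ n ∣ ≤ μ
  ∣n²∣≤μ = ≤-reflexive (ℤ.abs-* n n)

  _⟿_ : ℕ × ℕ × ℕ → Tag × ℕ × ℕ × ℕ → Set
  (a , b , c) ⟿ (t , p) = ∃ λ (d : Descent n a b c (proj₁ (proj₂ t)) (proj₂ (proj₂ t))) → Code t d p

  ⟿-injective : ∀ {T T′} y → T ⟿ y → T′ ⟿ y → T ≡ T′
  ⟿-injective {a , b , c} {a′ , b′ , c′} ((eab , σ , τ) , _) (d , refl) (d′ , p)
    with ,-injective p
  ... | x≡ , ey≡ with ,-injective ey≡
  ... | e≡ , y≡
    with cofactor-unique (1≤e d) (root-sym (ae d)) (subst₂ (λ e x → Root (n *ᶻ n) e a′ x) (sym e≡) (sym x≡) (root-sym (ae d′)))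
       | cofactor-unique (1≤e d) (root-sym (be d)) (subst₂ (λ e y → Root (n *ᶻ n) e b′ y) (sym e≡) (sym y≡) (root-sym (be d′)))
  ... | refl | refl = cong (λ c → a , b , c) (descent-injective n≢0 d d′ e≡)
  ⟿-injective {a , b , c} {a′ , b′ , c′} ((aeb , σ , τ) , _) (d , refl) (d′ , p)
    with ,-injective p
  ... | x≡ , ar≡ with ,-injective ar≡
  ... | refl , r≡
    with cofactor-unique (1≤a d) (ae d) (subst (λ x → Root (n *ᶻ n) a (e d′) x) (sym x≡) (ae d′))
       | cofactor-unique (1≤a d) (ab d) (subst (λ r → Root n a b′ r) (sym r≡) (ab d′))
  ... | e≡ | refl = cong (λ c → a , b , c) (descent-injective n≢0 d d′ e≡)
  ⟿-injective {a , b , c} {a′ , b′ , c′} ((abe , σ , τ) , _) (d , refl) (d′ , p)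
    with ,-injective p
  ... | r≡ , ax≡ with ,-injective ax≡
  ... | refl , x≡
    with cofactor-unique (1≤a d) (ae d) (subst (λ x → Root (n *ᶻ n) a (e d′) x) (sym x≡) (ae d′))
       | cofactor-unique (1≤a d) (ab d) (subst (λ r → Root n a b′ r) (sym r≡) (ab d′))
  ... | e≡ | refl = cong (λ c → a , b , c) (descent-injective n≢0 d d′ e≡)

  module _ (N l P : ℕ) (N≤ : suc κ * suc κ * μ * N ≤ l * l * (l * l) * (l * l)) (μ≤P : μ ≤ P) where
    open Box μ l P

    codes : List (Tag × ℕ × ℕ × ℕ)
    codes = tags ⊗ λ _ → box

    codeᵇ : Tag × ℕ × ℕ × ℕ → Bool
    codeᵇ (t , w , p , x) = residueᵇ (modulus n t) p x

    descent⇒code : ∀ {a b c σ τ} → a < b → c ≤ N → (d : Descent n a b c σ τ) →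
                   ∃ λ y → y ∈ codes × T (codeᵇ y) × (a , b , c) ⟿ y
    descent⇒code {a} {b} {c} {σ} {τ} a<b c≤N d with e d ≤? a | e d ≤? b
    ... | yes e≤a | _ = ((eab , σ , τ) , x d , e d , y d) ,
      ∈-⊗⁺ {g = λ _ → box} (∈-tags _) (∈-box μ≤P (1≤e d) w≤K+μ p≤w+μ wx≤ x≤ w≡0⇒p≤μ) ,
      residue⁺ (root-sym (be d)) , d , refl
      where
      rotate : ∀ a b e → e * a * b ≡ a * b * e
      rotate = solve-∀
      open SortedBounds {l = l} ∣n²∣≤μ ∣n²∣≤μ (1≤e d) e≤a (<⇒≤ a<b)
        (≤-trans (≤-reflexive (rotate a b (e d))) (≤-trans (size d) (≤-trans (*-monoʳ-≤ (suc κ * suc κ * μ) c≤N) N≤)))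
        (root-sym (ae d)) (root-sym (be d))
    ... | no e≰a | yes e≤b = ((aeb , σ , τ) , x d , a , r d) ,
      ∈-⊗⁺ {g = λ _ → box} (∈-tags _) (∈-box μ≤P (1≤a d) w≤K+μ p≤w+μ wx≤ x≤ w≡0⇒p≤μ) ,
      residue⁺ (ab d) , d , refl
      where
      rotate : ∀ a b e → a * e * b ≡ a * b * e
      rotate = solve-∀
      open SortedBounds {l = l} ∣n²∣≤μ (m≤m*m κ) (1≤a d) (<⇒≤ (≰⇒> e≰a)) e≤b
        (≤-trans (≤-reflexive (rotate a b (e d))) (≤-trans (size d) (≤-trans (*-monoʳ-≤ (suc κ * suc κ * μ) c≤N) N≤)))
        (ae d) (ab d)
    ... | no _ | no e≰b = ((abe , σ , τ) , r d , a , x d) ,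
      ∈-⊗⁺ {g = λ _ → box} (∈-tags _) (∈-box μ≤P (1≤a d) w≤K+μ p≤w+μ wx≤ x≤ w≡0⇒p≤μ) ,
      residue⁺ (ae d) , d , refl
      where
      open SortedBounds {l = l} (m≤m*m κ) ∣n²∣≤μ (1≤a d) (<⇒≤ a<b) (<⇒≤ (≰⇒> e≰b))
        (≤-trans (size d) (≤-trans (*-monoʳ-≤ (suc κ * suc κ * μ) c≤N) N≤))
        (ab d) (ae d)

    D3irr≤codes : D3irr n N ≤ B * (B * B) + card codeᵇ codes
    D3irr≤codes = begin
      D3irr n N          ≤⟨ card-injection (irregularᵇ n) Q _↦_ (cube N) targets (Unique-cube N) total (λ {x} {x′} {y} → injective x x′ y) ⟩
      card Q targets     ≡⟨ card-++ Q (map inj₁ (cube B)) (map inj₂ codes) ⟩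
      card Q (map inj₁ (cube B)) + card Q (map inj₂ codes)
        ≡⟨ cong₂ _+_ (trans (card-map Q inj₁ (cube B)) (trans (card-true (cube B)) length-cube)) (card-map Q inj₂ codes) ⟩
      B * (B * B) + card codeᵇ codes ∎
      where
      open ≤-Reasoning
      length-cube : length (cube B) ≡ B * (B * B)
      length-cube = trans (length-⊗-const (range B) (square B)) (cong₂ _*_ (length-range B)
        (trans (length-⊗-const (range B) (range B)) (cong₂ _*_ (length-range B) (length-range B))))
      targets : List (ℕ × ℕ × ℕ ⊎ Tag × ℕ × ℕ × ℕ)
      targets = map inj₁ (cube B) ++ map inj₂ codes
      Q : ℕ × ℕ × ℕ ⊎ Tag × ℕ × ℕ × ℕ → Bool
      Q (inj₁ _) = true
      Q (inj₂ y) = codeᵇ y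
      _↦_ : ℕ × ℕ × ℕ → ℕ × ℕ × ℕ ⊎ Tag × ℕ × ℕ × ℕ → Set
      t ↦ inj₁ t′ = t ≡ t′
      t ↦ inj₂ y  = t ⟿ y
      injective : ∀ x x′ y → x ↦ y → x′ ↦ y → x ≡ x′
      injective x x′ (inj₁ _) refl refl = refl
      injective x x′ (inj₂ y) p q = ⟿-injective y p q
      total : ∀ {x} → x ∈ cube N → T (irregularᵇ n x) → ∃ λ y → y ∈ targets × T (Q y) × x ↦ y
      total {a , b , c} t∈ irr with ∈-cube⁻ {N = N} t∈ | to (T-∧ {isTripleᵇ n a b c}) irr
      ... | (1≤a , a≤N) , (1≤b , b≤N) , 1≤c , c≤N | tr , ¬reg with triple⁻ {n} {a} {b} {c} tr
      ... | a<b , b<c , (_ , ab) , (_ , ac) , (_ , bc) with c ≤? B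
      ... | yes c≤B = inj₁ (a , b , c) , ∈-++⁺ˡ (∈-map⁺ inj₁
              (∈-cube⁺ 1≤a (≤-trans (<⇒≤ (<-trans a<b b<c)) c≤B) 1≤b (≤-trans (<⇒≤ b<c) c≤B) 1≤c c≤B)) , _ , refl
      ... | no c≰B with descent n≢0 1≤a a<b b<c (≰⇒> c≰B) irregular ab ac bc
        where
        irregular : ¬ IsRegular n a b c
        irregular reg = T-not ¬reg (regular⁺ {n} {a} {b} {c} reg)
          where
          T-not : ∀ {b} → T (not b) → T b → ⊥
          T-not {true} ()
          T-not {false} _ ()
      ... | σ , τ , d with descent⇒code a<b c≤N d
      ... | y , y∈ , Qy , t⟿y = inj₂ y , ∈-++⁺ʳ (map inj₁ (cube B)) (∈-map⁺ inj₂ y∈) , Qy , t⟿y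

    card-codes : ∀ H′ → let H = suc H′; K = l * l in 2 * H * (H * H) ≤ P →
      H * card codeᵇ codes ≤
        12 * (H * (suc (K + μ) * (P * suc (suc μ * (l * K)))) +
              (K + μ) * (suc μ * (2 * (suc μ * (K * K)) + (K + μ) * (2 + (H + H * H)))))
    card-codes H′ H-small = begin
      H * card codeᵇ codes
        ≡⟨ cong (λ x → H * x) (card-⊗ codeᵇ tags (λ _ → box)) ⟩
      H * sum (map slice tags)
        ≡⟨ sym (sum-map-* H slice tags) ⟩
      sum (map (λ t → H * slice t) tags)
        ≤⟨ sum-map-≤const (λ t → H * slice t) bound tags (λ {t} _ → slice≤ t) ⟩
      -- Twelve tags: three orders and four choices of signs.
      12 * bound ∎
      where
      open ≤-Reasoning
      H = suc H′
      K = l * l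
      slice : Tag → ℕ
      slice t = card (λ y → codeᵇ (t , y)) box
      bound = H * (suc (K + μ) * (P * suc (suc μ * (l * K)))) +
              (K + μ) * (suc μ * (2 * (suc μ * (K * K)) + (K + μ) * (2 + (H + H * H))))
      slice≤ : ∀ t → H * slice t ≤ bound
      slice≤ t = begin
        H * slice t
          ≡⟨ cong (λ x → H * x) (card-++ (λ y → codeᵇ (t , y)) small large) ⟩
        H * (card (λ y → codeᵇ (t , y)) small + card (λ y → codeᵇ (t , y)) large)
          ≡⟨ *-distribˡ-+ H (card (λ y → codeᵇ (t , y)) small) _ ⟩
        H * card (λ y → codeᵇ (t , y)) small + H * card (λ y → codeᵇ (t , y)) large
          ≤⟨ +-mono-≤ (*-monoʳ-≤ H (≤-trans (card≤length _ small) (≤-reflexive length-small)))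
                      (card-large (modulus n t) H′ H-small) ⟩
        bound ∎

open Encoding using (codes; codeᵇ; D3irr≤codes; card-codes)

-- Irregular triples are negligible against N

infix 4 _≪_

-- The relation f = o(g), without division.
_≪_ : (ℕ → ℕ) → (ℕ → ℕ) → Set
f ≪ g = ∀ k → ∃ λ N₀ → ∀ N → N₀ ≤ N → k * f N ≤ g N

integer-root : (f : ℕ → ℕ) → f 0 ≡ 0 → (∀ l → f l < f (suc l)) →
               ∀ M → ∃ λ l → f l ≤ M × M < f (suc l)
integer-root f f0≡0 mono zero = 0 , ≤-reflexive f0≡0 , subst (_< f 1) f0≡0 (mono 0)
integer-root f f0≡0 mono (suc M) with integer-root f f0≡0 mono M
... | l , fl≤M , M<f with f (suc l) ≤? suc M
... | yes f≤ = suc l , f≤ , ≤-<-trans M<f (mono (suc l))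
... | no f≰ = l , m≤n⇒m≤1+n fl≤M , ≰⇒> f≰

sixth : ℕ → ℕ
sixth l = l * l * (l * l) * (l * l)

sixth-mono-≤ : ∀ {l l′} → l ≤ l′ → sixth l ≤ sixth l′
sixth-mono-≤ p = *-mono-≤ (*-mono-≤ (*-mono-≤ p p) (*-mono-≤ p p)) (*-mono-≤ p p)

sixth-mono-< : ∀ {l l′} → l < l′ → sixth l < sixth l′
sixth-mono-< p = *-mono-< (*-mono-< (*-mono-< p p) (*-mono-< p p)) (*-mono-< p p)

sixth-suc : ∀ {l} → 1 ≤ l → sixth (suc l) ≤ 64 * sixth l
sixth-suc {l} 1≤l = ≤-trans (sixth-mono-≤ {suc l} {l + l} (+-monoˡ-≤ l 1≤l)) (≤-reflexive (expand l))
  where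
  expand : ∀ l → (l + l) * (l + l) * ((l + l) * (l + l)) * ((l + l) * (l + l)) ≡ 64 * (l * l * (l * l) * (l * l))
  expand = solve-∀

-- C N lies between consecutive sixth powers. The upper one satisfies the premise of `bound` and is
-- at most q C N, so j = p q C k absorbs all constants.
sixth-bound⇒≪id : ∀ {f : ℕ → ℕ} {C p q} → 1 ≤ C → 1 ≤ p → 1 ≤ q →
  (∀ {l} → 1 ≤ l → sixth (suc l) ≤ q * sixth l) →
  (∀ j → 1 ≤ j → ∃ λ Λ → 1 ≤ Λ × ∀ l N → Λ ≤ l → C * N ≤ sixth l → j * f N ≤ p * sixth l) →
  f ≪ λ N → N
sixth-bound⇒≪id _ _ _ _ _ zero = 0 , λ _ _ → z≤n
sixth-bound⇒≪id {f} {C} {p} {q} 1≤C 1≤p 1≤q suc≤ bound k@(suc _)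
  with bound (p * q * C * k) (*-mono-≤ {1} {p * q * C} {1} {k} (*-mono-≤ {1} {p * q} {1} {C} (*-mono-≤ {1} {p} {1} {q} 1≤p 1≤q) 1≤C) (s≤s z≤n))
... | Λ , 1≤Λ , bound-Λ = sixth Λ , λ N large → conclude N large (integer-root sixth refl (λ l → sixth-mono-< {l} ≤-refl) (C * N))
  where
  open ≤-Reasoning
  conclude : ∀ N → sixth Λ ≤ N → (∃ λ l → sixth l ≤ C * N × C * N < sixth (suc l)) → k * f N ≤ N
  conclude N large (l , lower , upper) =
    *-cancelˡ-≤ (p * q * C) {{>-nonZero (*-mono-≤ {1} {p * q} {1} {C} (*-mono-≤ {1} {p} {1} {q} 1≤p 1≤q) 1≤C)}} (begin
      p * q * C * (k * f N)          ≡⟨ sym (*-assoc (p * q * C) k (f N)) ⟩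
      p * q * C * k * f N            ≤⟨ bound-Λ (suc l) N (≤-trans Λ≤l (n≤1+n l)) (<⇒≤ upper) ⟩
      p * sixth (suc l)              ≤⟨ *-monoʳ-≤ p (≤-trans (suc≤ {l} (≤-trans 1≤Λ Λ≤l)) (*-monoʳ-≤ q lower)) ⟩
      p * (q * (C * N))              ≡⟨ collect p q C N ⟩
      p * q * C * N                  ∎)
    where
    collect : ∀ p q c n → p * (q * (c * n)) ≡ p * q * c * n
    collect = solve-∀
    Λ≤l : Λ ≤ l
    Λ≤l = ≮⇒≥ λ l<Λ → <⇒≱ upper (≤-trans (sixth-mono-≤ {suc l} {Λ} l<Λ) (≤-trans large (m≤n*m N C {{>-nonZero 1≤C}})))

module IrregularBound {n : ℤ} (n≢0 : n ≢ 0ℤ) where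
  private
    κ = ∣ n ∣
    μ = κ * κ
    U = suc μ
    B³ = 2 * μ * (2 * μ * (2 * μ))
    C = suc κ * suc κ * μ

    1≤κ : 1 ≤ κ
    1≤κ = n≢0⇒n>0 (n≢0 ∘ ℤ.∣i∣≡0⇒i≡0)

    1≤C : 1 ≤ C
    1≤C = *-mono-≤ {1} {suc κ * suc κ} (s≤s z≤n) (*-mono-≤ 1≤κ 1≤κ)

  module _ (j : ℕ) (1≤j : 1 ≤ j) where
    private
      -- H = 8 U² j cancels the factor with which the large codes enter `jL≤`. P is at least 2 H³
      -- for the root count and at least μ for the codes with w = 0.
      H′ = pred (j * (8 * (U * U)))
      H = suc H′
      P = μ + 2 * H * (H * H)
      G = 2 + (H + H * H)
    threshold : ℕ
    -- One summand for each of the quantities that l has to dominate.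
    threshold = 1 + μ + G + j * (6 * (P * U)) + j * B³

    private
      H≡ : H ≡ j * (8 * (U * U))
      H≡ = suc-pred (j * (8 * (U * U))) {{m*n≢0 j (8 * (U * U)) {{>-nonZero 1≤j}}}}

    -- 25 = 1 + 12 + 12: the triples with small c, then the small and the large codes of the twelve
    -- tags, each costing at most l⁶ after multiplication by j.
    D3irr-bound : ∀ {l N} → threshold ≤ l → C * N ≤ sixth l → j * D3irr n N ≤ 25 * sixth l
    D3irr-bound {l} {N} Λ≤l CN≤ = *-cancelˡ-≤ H (begin
      H * (j * D3irr n N)
        ≤⟨ *-monoʳ-≤ H (*-monoʳ-≤ j (D3irr≤codes n≢0 N l P CN≤ μ≤P)) ⟩
      H * (j * (B³ + card (codeᵇ n≢0 N l P CN≤ μ≤P) (codes n≢0 N l P CN≤ μ≤P)))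
        ≡⟨ distribute H j B³ _ ⟩
      H * (j * B³) + j * (H * card (codeᵇ n≢0 N l P CN≤ μ≤P) (codes n≢0 N l P CN≤ μ≤P))
        ≤⟨ +-mono-≤ (*-monoʳ-≤ H jB³≤) (*-monoʳ-≤ j (card-codes n≢0 N l P CN≤ μ≤P H′ (m≤n+m _ μ))) ⟩
      H * sixth l + j * (12 * (H * S + L))
        ≡⟨ distribute′ H j (sixth l) S L ⟩
      H * sixth l + 12 * (H * (j * S)) + 12 * (j * L)
        ≤⟨ +-mono-≤ (+-monoʳ-≤ (H * sixth l) (*-monoʳ-≤ 12 (*-monoʳ-≤ H jS≤))) (*-monoʳ-≤ 12 jL≤) ⟩
      H * sixth l + 12 * (H * sixth l) + 12 * (H * sixth l)
        ≡⟨ total H (sixth l) ⟩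
      H * (25 * sixth l) ∎)
      where
      open ≤-Reasoning
      K = l * l
      S = suc (K + μ) * (P * suc (suc μ * (l * K)))
      L = (K + μ) * (suc μ * (2 * (suc μ * (K * K)) + (K + μ) * (2 + (H + H * H))))
      μ≤P : μ ≤ P
      μ≤P = m≤m+n μ _
      distribute : ∀ h j b c → h * (j * (b + c)) ≡ h * (j * b) + j * (h * c)
      distribute = solve-∀
      distribute′ : ∀ h j k s l → h * k + j * (12 * (h * s + l)) ≡ h * k + 12 * (h * (j * s)) + 12 * (j * l)
      distribute′ = solve-∀
      total : ∀ h k → h * k + 12 * (h * k) + 12 * (h * k) ≡ h * (25 * k)
      total = solve-∀
      below : ∀ {x} y → threshold ≡ x + y → x ≤ l
      below y eq = ≤-trans (m≤m+n _ y) (≤-trans (≤-reflexive (sym eq)) Λ≤l)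
      1≤l : 1 ≤ l
      1≤l = ≤-trans (s≤s z≤n) Λ≤l
      1+μ≤l : 1 + μ ≤ l
      1+μ≤l = below (G + j * (6 * (P * U)) + j * B³) (regroup (1 + μ) G _ _)
        where
        regroup : ∀ a b c d → a + b + c + d ≡ a + (b + c + d)
        regroup = solve-∀
      G≤l : G ≤ l
      G≤l = below (1 + μ + j * (6 * (P * U)) + j * B³) (regroup (1 + μ) G _ _)
        where
        regroup : ∀ a b c d → a + b + c + d ≡ b + (a + c + d)
        regroup = solve-∀
      jPU≤l : j * (6 * (P * U)) ≤ l
      jPU≤l = below (1 + μ + G + j * B³) (regroup (1 + μ) G _ _)
        where
        regroup : ∀ a b c d → a + b + c + d ≡ c + (a + b + d)
        regroup = solve-∀
      jB³≤l : j * B³ ≤ l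
      jB³≤l = below (1 + μ + G + j * (6 * (P * U))) (+-comm (1 + μ + G + j * (6 * (P * U))) _)
      l≤K : l ≤ K
      l≤K = m≤m*m l
      1≤K : 1 ≤ K
      1≤K = *-mono-≤ 1≤l 1≤l
      K≤sixth : K ≤ sixth l
      K≤sixth = m≤n*m K (K * K) {{>-nonZero (*-mono-≤ 1≤K 1≤K)}}
      jB³≤ : j * B³ ≤ sixth l
      jB³≤ = ≤-trans jB³≤l (≤-trans l≤K K≤sixth)
      K+μ≤2K : K + μ ≤ 2 * K
      K+μ≤2K = +-monoʳ-≤ K (≤-trans (≤-trans (n≤1+n μ) (≤-trans 1+μ≤l l≤K)) (m≤m+n K 0))
      1+K+μ≤3K : suc (K + μ) ≤ 3 * K
      1+K+μ≤3K = +-mono-≤ 1≤K K+μ≤2K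
      jS≤ : j * S ≤ sixth l
      jS≤ = begin
        j * (suc (K + μ) * (P * suc (U * (l * K))))
          ≤⟨ *-monoʳ-≤ j (*-mono-≤ 1+K+μ≤3K (*-monoʳ-≤ P (+-monoˡ-≤ (U * (l * K)) (*-mono-≤ {1} {U} (s≤s z≤n) (*-mono-≤ 1≤l 1≤K))))) ⟩
        j * (3 * K * (P * (U * (l * K) + U * (l * K))))
          ≡⟨ collect j K P U l ⟩
        j * (6 * (P * U)) * l * (K * K)
          ≤⟨ *-monoˡ-≤ (K * K) (*-monoˡ-≤ l jPU≤l) ⟩
        l * l * (K * K)
          ≡⟨ *-comm K (K * K) ⟩
        sixth l ∎
        where
        collect : ∀ j k p u l → j * (3 * k * (p * (u * (l * k) + u * (l * k)))) ≡ j * (6 * (p * u)) * l * (k * k)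
        collect = solve-∀
      jL≤ : j * L ≤ H * sixth l
      jL≤ = begin
        j * ((K + μ) * (U * (2 * (U * (K * K)) + (K + μ) * G)))
          ≤⟨ *-monoʳ-≤ j (*-mono-≤ K+μ≤2K (*-monoʳ-≤ U (+-monoʳ-≤ (2 * (U * (K * K))) (*-mono-≤ K+μ≤2K (≤-trans G≤l l≤K))))) ⟩
        j * (2 * K * (U * (2 * (U * (K * K)) + 2 * K * K)))
          ≤⟨ *-monoʳ-≤ j (*-monoʳ-≤ (2 * K) (*-monoʳ-≤ U (+-monoʳ-≤ (2 * (U * (K * K))) (begin
              2 * K * K            ≡⟨ *-assoc 2 K K ⟩
              2 * (K * K)          ≤⟨ *-monoʳ-≤ 2 (m≤n*m (K * K) U) ⟩
              2 * (U * (K * K))    ∎)))) ⟩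
        j * (2 * K * (U * (2 * (U * (K * K)) + 2 * (U * (K * K)))))
          ≡⟨ collect j K U ⟩
        j * (8 * (U * U)) * (K * K * K)
          ≡⟨ cong (_* sixth l) (sym H≡) ⟩
        H * sixth l ∎
        where
        collect : ∀ j k u → j * (2 * k * (u * (2 * (u * (k * k)) + 2 * (u * (k * k))))) ≡ j * (8 * (u * u)) * (k * k * k)
        collect = solve-∀

  D3irr≪id : D3irr n ≪ λ N → N
  D3irr≪id = sixth-bound⇒≪id {C = C} {25} {64} 1≤C (s≤s z≤n) (s≤s z≤n) sixth-suc
    (λ j 1≤j → threshold j 1≤j , s≤s z≤n , λ l N → D3irr-bound j 1≤j)

open IrregularBound using (D3irr≪id)

-- Coprime pairs in a region

-- Σ 1/g² over g ≥ 2 is at most 1/4 + Σ_{g ≥ 3} (1/(g-1) - 1/g) = 3/4.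
sum-of-inverse-squares : ∀ (c : ℕ → ℕ) T → (∀ g → 2 ≤ g → g * g * c g ≤ T) →
                         ∀ G → 4 * sum (map (λ i → c (2 + i)) (upTo G)) ≤ 3 * T
sum-of-inverse-squares c T g²c≤T zero = z≤n
sum-of-inverse-squares c T g²c≤T (suc G) = *-cancelˡ-≤ (2 + G) (begin
  (2 + G) * (4 * S (suc G))              ≤⟨ m≤m+n _ (4 * T) ⟩
  (2 + G) * (4 * S (suc G)) + 4 * T      ≤⟨ telescope G ⟩
  (2 + G) * (3 * T)                      ∎)
  where
  open ≤-Reasoning
  S : ℕ → ℕ
  S G = sum (map (λ i → c (2 + i)) (upTo G))
  -- S ≤ (3/4 - 1/(G + 2)) T with denominators cleared; the subtracted tail makes the induction
  -- close.
  telescope : ∀ G → (2 + G) * (4 * S (suc G)) + 4 * T ≤ (2 + G) * (3 * T)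
  telescope zero = begin
    2 * (4 * S 1) + 4 * T                ≡⟨ simplify (c 2) T ⟩
    2 * (2 * 2 * c 2) + 4 * T            ≤⟨ +-monoˡ-≤ (4 * T) (*-monoʳ-≤ 2 (g²c≤T 2 ≤-refl)) ⟩
    2 * T + 4 * T                        ≡⟨ collect T ⟩
    2 * (3 * T)                          ∎
    where
    simplify : ∀ c t → 2 * (4 * (c + 0)) + 4 * t ≡ 2 * (2 * 2 * c) + 4 * t
    simplify = solve-∀
    collect : ∀ t → 2 * t + 4 * t ≡ 2 * (3 * t)
    collect = solve-∀
  telescope (suc G) rewrite sum-map-upTo-suc (λ i → c (2 + i)) (suc G) =
    *-cancelˡ-≤ h (+-cancelʳ-≤ (suc h * (4 * T)) _ _ (begin
      h * (suc h * (4 * (S (suc G) + c (suc h))) + 4 * T) + suc h * (4 * T)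
        ≡⟨ separate h (S (suc G)) (c (suc h)) T ⟩
      suc h * (h * (4 * S (suc G)) + 4 * T) + 4 * (h * suc h * c (suc h)) + h * (4 * T)
        ≤⟨ +-monoˡ-≤ (h * (4 * T)) (+-mono-≤ (*-monoʳ-≤ (suc h) (telescope G))
             (*-monoʳ-≤ 4 (≤-trans (*-monoˡ-≤ (c (suc h)) (*-monoˡ-≤ (suc h) (n≤1+n h)))
               (g²c≤T (suc h) (s≤s (s≤s z≤n)))))) ⟩
      suc h * (h * (3 * T)) + 4 * T + h * (4 * T)
        ≡⟨ recombine h T ⟩
      h * (suc h * (3 * T)) + suc h * (4 * T) ∎))
    where
    h = 2 + G
    separate : ∀ h s c t → h * (suc h * (4 * (s + c)) + 4 * t) + suc h * (4 * t) ≡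
                           suc h * (h * (4 * s) + 4 * t) + 4 * (h * suc h * c) + h * (4 * t)
    separate = solve-∀
    recombine : ∀ h t → suc h * (h * (3 * t)) + 4 * t + h * (4 * t) ≡ h * (suc h * (3 * t)) + suc h * (4 * t)
    recombine = solve-∀

offset-apart : ∀ {g u i j} → i < j → j < g → g ∣ u + i → ¬ (g ∣ u + j)
offset-apart {g} {u} {i} i<j j<g gi gj with m≤n⇒∃[o]m+o≡n i<j
... | k , refl = <⇒≱ (≤-<-trans (s≤s (m≤n+m k i)) j<g)
  (∣⇒≤ (∣m+n∣m⇒∣n (subst (g ∣_) (trans (cong (λ x → u + x) (sym (+-suc i k))) (sym (+-assoc u i (suc k)))) gj) gi))

offset-unique : ∀ {g u i j} → i < g → j < g → g ∣ u + i → g ∣ u + j → i ≡ j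
offset-unique {g} {u} {i} {j} i<g j<g gi gj with <-cmp i j
... | tri≈ _ i≡j _ = i≡j
... | tri< i<j _ _ = contradiction gj (offset-apart {u = u} i<j j<g gi)
... | tri> _ _ j<i = contradiction gi (offset-apart {u = u} j<i i<g gj)

grid : ℕ → ℕ → List (ℕ × ℕ)
grid A B = range A ⊗ λ _ → range B

module Sieve (A B : ℕ) (D : ℕ × ℕ → Bool)
  (down : ∀ {u v u′ v′} → u′ ≤ u → v′ ≤ v → T (D (u , v)) → T (D (u′ , v′))) where

  coprimeᵇ : ℕ × ℕ → Bool
  coprimeᵇ (u , v) = D (u , v) ∧ ⌊ coprime? u v ⌋

  multipleᵇ : ℕ → ℕ × ℕ → Bool
  multipleᵇ g (u , v) = D (u , v) ∧ (⌊ g ∣? u ⌋ ∧ ⌊ g ∣? v ⌋)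

  multiple⁻ : ∀ {g u v} → T (multipleᵇ g (u , v)) → T (D (u , v)) × (g ∣ u) × (g ∣ v)
  multiple⁻ {g} {u} {v} m with to (T-∧ {D (u , v)}) m
  ... | d , gg with to (T-∧ {⌊ g ∣? u ⌋}) gg
  ... | gu , gv = d , toWitness gu , toWitness gv

  -- A point with both coordinates divisible by g owns the block of the g² points (u - i, v - j)
  -- with i, j < g. The blocks are disjoint, and they stay in the region because it is closed
  -- downwards, so no boundary terms appear.
  card-multiple : ∀ g → 2 ≤ g → g * g * card (multipleᵇ g) (grid A B) ≤ card D (grid A B)
  card-multiple g 2≤g = begin
    g * g * card (multipleᵇ g) (grid A B)
      ≡⟨ *-assoc g g _ ⟩
    g * (g * card (multipleᵇ g) (grid A B))
      ≡⟨ sym (cong₂ _*_ (length-upTo g) (cong (_* card (multipleᵇ g) (grid A B)) (length-upTo g))) ⟩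
    length (upTo g) * (length (upTo g) * card (multipleᵇ g) (grid A B))
      ≡⟨ cong (λ x → length (upTo g) * x) (sym (card-⊗-const (multipleᵇ g) (upTo g) (grid A B))) ⟩
    length (upTo g) * card (multipleᵇ g ∘ proj₂) (upTo g ⊗ λ _ → grid A B)
      ≡⟨ sym (card-⊗-const (multipleᵇ g ∘ proj₂) (upTo g) (upTo g ⊗ λ _ → grid A B)) ⟩
    card (multipleᵇ g ∘ proj₂ ∘ proj₂) sources
      ≤⟨ card-injection (multipleᵇ g ∘ proj₂ ∘ proj₂) D _↝_ sources (grid A B) unique total injective ⟩
    card D (grid A B) ∎
    where
    open ≤-Reasoning
    sources : List (ℕ × ℕ × ℕ × ℕ)
    sources = upTo g ⊗ λ _ → upTo g ⊗ λ _ → grid A B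
    unique : Unique sources
    unique = Unique-⊗ {g = λ _ → upTo g ⊗ λ _ → grid A B} (Unique.upTo⁺ g)
      (λ _ → Unique-⊗ {g = λ _ → grid A B} (Unique.upTo⁺ g)
        (λ _ → Unique-⊗ {g = λ _ → range B} (Unique-range A) (λ _ → Unique-range B)))
    _↝_ : ℕ × ℕ × ℕ × ℕ → ℕ × ℕ → Set
    (i , j , u , v) ↝ (u′ , v′) = (i < g × j < g × (g ∣ u) × (g ∣ v)) × u′ + i ≡ u × v′ + j ≡ v
    injective : ∀ {x x′ y} → x ↝ y → x′ ↝ y → x ≡ x′
    injective {y = u , v} ((i<g , j<g , gu , gv) , refl , refl) ((i′<g , j′<g , gu′ , gv′) , refl , refl)
      with offset-unique {u = u} i<g i′<g gu gu′ | offset-unique {u = v} j<g j′<g gv gv′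
    ... | refl | refl = refl
    shrink : ∀ {i u C} → i < g → g ∣ u → 1 ≤ u × u ≤ C → ∃ λ u′ → u′ + i ≡ u × u′ ∈ range C × u′ ≤ u
    shrink {i} {u} {C} i<g g∣u (1≤u , u≤C) =
      u ∸ i , m∸n+n≡m (<⇒≤ i<u) , ∈-range⁺ (m<n⇒0<n∸m i<u) (≤-trans (m∸n≤m u i) u≤C) , m∸n≤m u i
      where
      i<u : i < u
      i<u = <-≤-trans i<g (∣⇒≤ {{>-nonZero 1≤u}} g∣u)
    total : ∀ {x} → x ∈ sources → T (multipleᵇ g (proj₂ (proj₂ x))) → ∃ λ y → y ∈ grid A B × T (D y) × x ↝ y
    total {i , j , u , v} x∈ m with ∈-⊗⁻ (upTo g) x∈
    ... | i∈ , jp∈ with ∈-⊗⁻ (upTo g) jp∈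
    ... | j∈ , p∈ with ∈-⊗⁻ (range A) p∈ | multiple⁻ {g} {u} {v} m
    ... | u∈ , v∈ | d , gu , gv
      with shrink (∈-upTo⁻ i∈) gu (∈-range⁻ u∈) | shrink (∈-upTo⁻ j∈) gv (∈-range⁻ v∈)
    ... | u′ , eu , u′∈ , u′≤ | v′ , ev , v′∈ , v′≤ =
      (u′ , v′) , ∈-⊗⁺ u′∈ v′∈ , down u′≤ v′≤ d , (∈-upTo⁻ i∈ , ∈-upTo⁻ j∈ , gu , gv) , eu , ev

  -- A point that is not coprime is counted under its gcd g, with 2 ≤ g ≤ A, stored as g - 2. All
  -- such points together make up at most 3/4 of the region.
  card≤4*coprime : card D (grid A B) ≤ 4 * card coprimeᵇ (grid A B)
  card≤4*coprime = +-cancelʳ-≤ (3 * card D (grid A B)) _ _ (begin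
    card D (grid A B) + 3 * card D (grid A B)
      ≤⟨ *-monoʳ-≤ 4 split ⟩
    4 * (card coprimeᵇ (grid A B) + S)
      ≡⟨ *-distribˡ-+ 4 (card coprimeᵇ (grid A B)) S ⟩
    4 * card coprimeᵇ (grid A B) + 4 * S
      ≤⟨ +-monoʳ-≤ (4 * card coprimeᵇ (grid A B))
           (sum-of-inverse-squares (λ g → card (multipleᵇ g) (grid A B)) (card D (grid A B)) card-multiple A) ⟩
    4 * card coprimeᵇ (grid A B) + 3 * card D (grid A B) ∎)
    where
    open ≤-Reasoning
    S = sum (map (λ i → card (multipleᵇ (2 + i)) (grid A B)) (upTo A))
    targets : List (ℕ × ℕ ⊎ ℕ × ℕ × ℕ)
    targets = map inj₁ (grid A B) ++ map inj₂ (upTo A ⊗ λ _ → grid A B)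
    Q : ℕ × ℕ ⊎ ℕ × ℕ × ℕ → Bool
    Q (inj₁ p) = coprimeᵇ p
    Q (inj₂ (i , p)) = multipleᵇ (2 + i) p
    _↝_ : ℕ × ℕ → ℕ × ℕ ⊎ ℕ × ℕ × ℕ → Set
    p ↝ inj₁ q = p ≡ q
    p ↝ inj₂ (_ , q) = p ≡ q
    injective : ∀ {x x′ y} → x ↝ y → x′ ↝ y → x ≡ x′
    injective {y = inj₁ _} refl refl = refl
    injective {y = inj₂ _} refl refl = refl
    total : ∀ {x} → x ∈ grid A B → T (D x) → ∃ λ y → y ∈ targets × T (Q y) × x ↝ y
    total {u , v} p∈ d with ∈-range⁻ {N = A} (proj₁ (∈-⊗⁻ (range A) p∈)) | coprime? u v in eq
    ... | _ | yes c = inj₁ (u , v) , ∈-++⁺ˡ (∈-map⁺ inj₁ p∈) ,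
      from (T-∧ {D (u , v)}) (d , subst (λ c → T ⌊ c ⌋) (sym eq) _) , refl
    ... | 1≤u , u≤A | no ¬c = inj₂ (gcd u v ∸ 2 , u , v) ,
      ∈-++⁺ʳ (map inj₁ (grid A B)) (∈-map⁺ inj₂ (∈-⊗⁺ {g = λ _ → grid A B} (∈-upTo⁺ g-2<A) p∈)) ,
      from (T-∧ {D (u , v)}) (d , subst (λ g → T (⌊ g ∣? u ⌋ ∧ ⌊ g ∣? v ⌋)) (sym (m+[n∸m]≡n 2≤g))
        (from (T-∧ {⌊ gcd u v ∣? u ⌋}) (fromWitness (gcd[m,n]∣m u v) , fromWitness (gcd[m,n]∣n u v)))) , refl
      where
      2≤g : 2 ≤ gcd u v
      2≤g = ≤∧≢⇒< (n≢0⇒n>0 (gcd[m,n]≢0 u v (inj₁ (λ u≡0 → <⇒≢ 1≤u (sym u≡0)))))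
        (λ 1≡g → ¬c (Coprime.gcd≡1⇒coprime (sym 1≡g)))
      g-2<A : gcd u v ∸ 2 < A
      g-2<A = ≤-trans (≤-trans (≤-reflexive (trans (+-comm 1 _) refl))
        (≤-trans (m≤m+n (gcd u v ∸ 2 + 1) 1) (≤-reflexive (trans (+-assoc _ 1 1) (m∸n+n≡m 2≤g)))))
        (≤-trans (∣⇒≤ {{>-nonZero 1≤u}} (gcd[m,n]∣m u v)) u≤A)
    split : card D (grid A B) ≤ card coprimeᵇ (grid A B) + S
    split = begin
      card D (grid A B)
        ≤⟨ card-injection D Q _↝_ (grid A B) targets
             (Unique-⊗ {g = λ _ → range B} (Unique-range A) (λ _ → Unique-range B)) total injective ⟩
      card Q targets
        ≡⟨ card-++ Q (map inj₁ (grid A B)) _ ⟩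
      card Q (map inj₁ (grid A B)) + card Q (map inj₂ (upTo A ⊗ λ _ → grid A B))
        ≡⟨ cong₂ _+_ (card-map Q inj₁ (grid A B)) (trans (card-map Q inj₂ (upTo A ⊗ λ _ → grid A B))
             (card-⊗ (λ (i , p) → multipleᵇ (2 + i) p) (upTo A) (λ _ → grid A B))) ⟩
      card coprimeᵇ (grid A B) + S ∎

-- Pairs from quadratic forms

modular-inverse : ∀ {b y} → Coprime b y → ∃ λ u → + b ℤ.∣ u *ᶻ + y -ᶻ + 1
modular-inverse {b} {y} c with coprime-Bézout c
... | Bézout.+- p q eq = -ᶻ + q , ℤ.divides (-ᶻ + p) (begin
  -ᶻ + q *ᶻ + y -ᶻ + 1        ≡⟨ gather (+ q) (+ y) ⟩
  -ᶻ (+ 1 +ᶻ + q *ᶻ + y)      ≡⟨ cong (λ x → -ᶻ (+ 1 +ᶻ x)) (sym (ℤ.pos-* q y)) ⟩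
  -ᶻ (+ (1 + q * y))          ≡⟨ cong (λ x → -ᶻ (+ x)) eq ⟩
  -ᶻ (+ (p * b))              ≡⟨ cong -ᶻ_ (ℤ.pos-* p b) ⟩
  -ᶻ (+ p *ᶻ + b)             ≡⟨ ℤ.neg-distribˡ-* (+ p) (+ b) ⟩
  -ᶻ + p *ᶻ + b               ∎)
  where
  open ≡-Reasoning
  gather : ∀ q y → -ᶻ q *ᶻ y -ᶻ + 1 ≡ -ᶻ (+ 1 +ᶻ q *ᶻ y)
  gather = ℤSolver.solve-∀
... | Bézout.-+ p q eq = + q , ℤ.divides (+ p) (begin
  + q *ᶻ + y -ᶻ + 1           ≡⟨ cong (_-ᶻ + 1) (sym (ℤ.pos-* q y)) ⟩
  + (q * y) -ᶻ + 1            ≡⟨ cong (λ x → + x -ᶻ + 1) (sym eq) ⟩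
  + 1 +ᶻ + (p * b) -ᶻ + 1     ≡⟨ cancel (+ (p * b)) ⟩
  + (p * b)                   ≡⟨ ℤ.pos-* p b ⟩
  + p *ᶻ + b                  ∎)
  where
  open ≡-Reasoning
  cancel : ∀ x → + 1 +ᶻ x -ᶻ + 1 ≡ x
  cancel = ℤSolver.solve-∀

reduce-mod : ∀ i b .{{_ : NonZero b}} → ∃ λ s → s < b × + b ℤ.∣ + s -ᶻ i
reduce-mod i b = i %ℕ b , n%ℕd<d i b ,
  ℤ.divides (-ᶻ (i /ℕ b)) (trans (cong (λ z → + (i %ℕ b) -ᶻ z) (a≡a%ℕn+[a/ℕn]*n i b)) (cancel (+ (i %ℕ b)) (i /ℕ b) (+ b)))
  where
  cancel : ∀ s q b → s -ᶻ (s +ᶻ q *ᶻ b) ≡ -ᶻ q *ᶻ b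
  cancel = ℤSolver.solve-∀

Represents : ℤ → ℕ → ℕ → ℕ → Set
Represents n x y b = + b +ᶻ n *ᶻ + (y * y) ≡ + (x * x)

represented⇒coprime : ∀ {n x y b} → Coprime x y → Represents n x y b → Coprime b y
represented⇒coprime {n} {x} {y} {b} x⊥y form {d} (d∣b , d∣y) = x⊥y (d∣x , d∣y)
  where
  d∣x² : d ∣ x * x
  d∣x² = ℤ.∣⇒∣ᵤ {+ d} {+ (x * x)} (subst (+ d ℤ.∣_) form (ℤ.∣m∣n⇒∣m+n (ℤ.∣ᵤ⇒∣ {+ d} {+ b} d∣b)
    (ℤ.∣n⇒∣m*n n (ℤ.∣ᵤ⇒∣ {+ d} {+ (y * y)} (∣m⇒∣m*n y d∣y)))))
  d∣x : d ∣ x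
  d∣x = coprime-divisor (λ (p , q) → x⊥y (q , ∣-trans p d∣y)) d∣x²

module _ {n : ℤ} {x y b s : ℕ} (u : ℤ) (form : Represents n x y b)
  (b∣uy-1 : + b ℤ.∣ u *ᶻ + y -ᶻ + 1) (b∣s-ux : + b ℤ.∣ + s -ᶻ u *ᶻ + x) where

  quotient-root-linear : + b ℤ.∣ + s *ᶻ + y -ᶻ + x
  quotient-root-linear = subst (+ b ℤ.∣_) (sym (split (+ s) u (+ x) (+ y)))
    (ℤ.∣m∣n⇒∣m+n (ℤ.∣m⇒∣m*n (+ y) b∣s-ux) (ℤ.∣n⇒∣m*n (+ x) b∣uy-1))
    where
    split : ∀ s u x y → s *ᶻ y -ᶻ x ≡ (s -ᶻ u *ᶻ x) *ᶻ y +ᶻ x *ᶻ (u *ᶻ y -ᶻ + 1)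
    split = ℤSolver.solve-∀

  -- Modulo b, s² ≡ u² x² = u² (b + n y²) ≡ n (u y)² ≡ n.
  quotient-root-square : + b ℤ.∣ + s *ᶻ + s -ᶻ n
  quotient-root-square = subst (+ b ℤ.∣_) (sym (trans (split (+ s) u (+ x) n)
      (trans (cong (λ z → (+ s -ᶻ u *ᶻ + x) *ᶻ (+ s +ᶻ u *ᶻ + x) +ᶻ (u *ᶻ u *ᶻ z -ᶻ n)) form-ℤ)
             (cong (λ z → (+ s -ᶻ u *ᶻ + x) *ᶻ (+ s +ᶻ u *ᶻ + x) +ᶻ z) (expand u (+ b) n (+ y))))))
    (ℤ.∣m∣n⇒∣m+n (ℤ.∣m⇒∣m*n (+ s +ᶻ u *ᶻ + x) b∣s-ux)
      (ℤ.∣m∣n⇒∣m+n (ℤ.∣n⇒∣m*n (u *ᶻ u) (ℤ.∣-refl {+ b})) (ℤ.∣n⇒∣m*n (n *ᶻ (u *ᶻ + y +ᶻ + 1)) b∣uy-1)))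
    where
    form-ℤ : + x *ᶻ + x ≡ + b +ᶻ n *ᶻ (+ y *ᶻ + y)
    form-ℤ = trans (sym (ℤ.pos-* x x)) (trans (sym form) (cong (λ z → + b +ᶻ n *ᶻ z) (ℤ.pos-* y y)))
    split : ∀ s u x n → s *ᶻ s -ᶻ n ≡ (s -ᶻ u *ᶻ x) *ᶻ (s +ᶻ u *ᶻ x) +ᶻ (u *ᶻ u *ᶻ (x *ᶻ x) -ᶻ n)
    split = ℤSolver.solve-∀
    expand : ∀ u b n y → u *ᶻ u *ᶻ (b +ᶻ n *ᶻ (y *ᶻ y)) -ᶻ n ≡ u *ᶻ u *ᶻ b +ᶻ n *ᶻ (u *ᶻ y +ᶻ + 1) *ᶻ (u *ᶻ y -ᶻ + 1)
    expand = ℤSolver.solve-∀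

-- The quotient q of s² - n by b is the element a, provided that it is positive: `s²≢n` excludes q =
-- 0, and q < 0 would give b ≤ n.
root⇒pair : ∀ {n x y b s} → n ≢ 0ℤ → 1 ≤ y → ∣ n ∣ < b → s < b → Represents n x y b →
            + b ℤ.∣ + s *ᶻ + y -ᶻ + x → + b ℤ.∣ + s *ᶻ + s -ᶻ n →
            ∃ λ a → 1 ≤ a × a < b × Root n a b s
root⇒pair {n} {x} {y} {b} {s} n≢0 1≤y κ<b s<b form b∣sy-x (ℤ.divides q eq) = by-sign q eq
  where
  -- If s² = n then b = (x − s y) (x + s y) divides, hence is at most, x − s y.
  s²≢n : + s *ᶻ + s ≢ n
  s²≢n s²≡n = go (m≤n⇒∃[o]m+o≡n sy<x)
    where
    open ≤-Reasoning
    1≤b : 1 ≤ b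
    1≤b = ≤-trans (s≤s z≤n) κ<b
    1≤s : 1 ≤ s
    1≤s = n≢0⇒n>0 λ s≡0 → n≢0 (trans (sym s²≡n) (cong (λ z → + z *ᶻ + z) s≡0))
    regroup : ∀ s y → s * s * (y * y) ≡ s * y * (s * y)
    regroup = solve-∀
    x² : x * x ≡ b + s * y * (s * y)
    x² = trans (ℤ.+-injective (trans (sym form) (cong (λ z → + b +ᶻ z)
      (trans (cong (_*ᶻ + (y * y)) (trans (sym s²≡n) (sym (ℤ.pos-* s s)))) (sym (ℤ.pos-* (s * s) (y * y)))))))
      (cong (λ z → b + z) (regroup s y))
    sy<x : s * y < x
    sy<x = ≰⇒> λ x≤sy → <⇒≱ (m<n+m (s * y * (s * y)) 1≤b) (subst (_≤ s * y * (s * y)) x² (*-mono-≤ x≤sy x≤sy))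
    go : (∃ λ k → suc (s * y) + k ≡ x) → ⊥
    go (k , x≡) = <⇒≱ 1+k<b (∣⇒≤ b∣1+k)
      where
      x≡′ : x ≡ s * y + suc k
      x≡′ = trans (sym x≡) (sym (+-suc (s * y) k))
      square-sum : ∀ z d → (z + d) * (z + d) ≡ d * (2 * z + d) + z * z
      square-sum = solve-∀
      b≡ : b ≡ suc k * (2 * (s * y) + suc k)
      b≡ = +-cancelʳ-≡ (s * y * (s * y)) _ _ (trans (sym x²)
        (trans (cong (λ z → z * z) x≡′) (square-sum (s * y) (suc k))))
      1+k<b : suc k < b
      1+k<b = begin-strict
        suc k                              ≡⟨ sym (*-identityʳ (suc k)) ⟩
        suc k * 1                          <⟨ *-monoʳ-< (suc k) (≤-trans (*-monoʳ-≤ 2 (*-mono-≤ 1≤s 1≤y)) (m≤m+n (2 * (s * y)) (suc k))) ⟩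
        suc k * (2 * (s * y) + suc k)      ≡⟨ sym b≡ ⟩
        b                                  ∎
      cancel : ∀ z d → z -ᶻ (z +ᶻ d) ≡ -ᶻ d
      cancel = ℤSolver.solve-∀
      b∣1+k : b ∣ suc k
      b∣1+k = ℤ.∣⇒∣ᵤ {+ b} { -ᶻ + suc k} (subst (+ b ℤ.∣_)
        (trans (cong₂ _-ᶻ_ (sym (ℤ.pos-* s y)) (cong +_ x≡′)) (cancel (+ (s * y)) (+ suc k))) b∣sy-x)

  by-sign : ∀ q → + s *ᶻ + s -ᶻ n ≡ q *ᶻ + b → ∃ λ a → 1 ≤ a × a < b × Root n a b s
  by-sign (+ zero) eq = ⊥-elim (s²≢n (ℤ.i-j≡0⇒i≡j _ _ eq))
  by-sign -[1+ k ] eq = ⊥-elim (<⇒≱ κ<b (begin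
    b                        ≤⟨ m≤m+n b (k * b) ⟩
    suc k * b                ≤⟨ m≤n+m (suc k * b) (s * s) ⟩
    s * s + suc k * b        ≡⟨ cong ∣_∣ n≡ ⟩
    ∣ n ∣                    ∎))
    where
    open ≤-Reasoning
    move : ∀ s n q b → s -ᶻ n ≡ -ᶻ q *ᶻ b → s +ᶻ q *ᶻ b ≡ n
    move s n q b e = trans (cong (_+ᶻ q *ᶻ b) (trans (sym (restore s n)) (cong (_+ᶻ n) e))) (cancel q b n)
      where
      restore : ∀ s n → s -ᶻ n +ᶻ n ≡ s
      restore = ℤSolver.solve-∀
      cancel : ∀ q b n → -ᶻ q *ᶻ b +ᶻ n +ᶻ q *ᶻ b ≡ n
      cancel = ℤSolver.solve-∀
    n≡ : + (s * s + suc k * b) ≡ n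
    n≡ = trans (cong₂ _+ᶻ_ (ℤ.pos-* s s) (ℤ.pos-* (suc k) b)) (move (+ s *ᶻ + s) n (+ suc k) (+ b) eq)
  by-sign (+ suc k) eq = suc k , s≤s z≤n , a<b , ab
    where
    open ≤-Reasoning
    restore : ∀ s n → s -ᶻ n +ᶻ n ≡ s
    restore = ℤSolver.solve-∀
    ab : Root n (suc k) b s
    ab = root (trans (cong (_+ᶻ n) (trans (ℤ.pos-* (suc k) b) (sym eq))) (trans (restore (+ s *ᶻ + s) n) (sym (ℤ.pos-* s s))))
    a<b : suc k < b
    a<b = *-cancelʳ-< b (suc k) b (begin-strict
      suc k * b              ≤⟨ proj₂ (root-bounds ab) ⟩
      s * s + ∣ n ∣          <⟨ +-mono-≤-< (*-monoʳ-≤ s (<⇒≤ s<b)) κ<b ⟩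
      s * b + b              ≡⟨ +-comm (s * b) b ⟩
      suc s * b              ≤⟨ *-monoˡ-≤ b s<b ⟩
      b * b                  ∎)

-- A coprime representation b = x² − n y² gives the square root x / y of n modulo b.
represented⇒pair : ∀ {n x y b} → n ≢ 0ℤ → 1 ≤ y → Coprime x y → ∣ n ∣ < b → Represents n x y b →
  ∃ λ a → ∃ λ s → 1 ≤ a × a < b × Root n a b s × + b ℤ.∣ + s *ᶻ + y -ᶻ + x
represented⇒pair {n} {x} {y} {b} n≢0 1≤y x⊥y κ<b form
  with modular-inverse (represented⇒coprime {n} {x} {y} {b} x⊥y form)
... | u , b∣uy-1 with reduce-mod (u *ᶻ + x) b {{>-nonZero (≤-trans (s≤s z≤n) κ<b)}}
... | s , s<b , b∣s-ux = conclude (root⇒pair {x = x} n≢0 1≤y κ<b s<b form linear (quotient-root-square u form b∣uy-1 b∣s-ux))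
  where
  linear : + b ℤ.∣ + s *ᶻ + y -ᶻ + x
  linear = quotient-root-linear {n} u form b∣uy-1 b∣s-ux
  conclude : (∃ λ a → 1 ≤ a × a < b × Root n a b s) →
             ∃ λ a → ∃ λ s → 1 ≤ a × a < b × Root n a b s × + b ℤ.∣ + s *ᶻ + y -ᶻ + x
  conclude (a , 1≤a , a<b , ab) = a , s , 1≤a , a<b , ab , linear

-- Both fractions x / y and x′ / y′ are the root s modulo b.
cross-divides : ∀ {b s x y x′ y′} → + b ℤ.∣ + s *ᶻ + y -ᶻ + x → + b ℤ.∣ + s *ᶻ + y′ -ᶻ + x′ →
                + b ℤ.∣ + x *ᶻ + y′ -ᶻ + x′ *ᶻ + y
cross-divides {b} {s} {x} {y} {x′} {y′} p q = subst (+ b ℤ.∣_) (identity (+ s) (+ x) (+ y) (+ x′) (+ y′))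
  (ℤ.∣m∣n⇒∣m-n (ℤ.∣n⇒∣m*n (+ y) q) (ℤ.∣n⇒∣m*n (+ y′) p))
  where
  identity : ∀ s x y x′ y′ → y *ᶻ (s *ᶻ y′ -ᶻ x′) -ᶻ y′ *ᶻ (s *ᶻ y -ᶻ x) ≡ x *ᶻ y′ -ᶻ x′ *ᶻ y
  identity = ℤSolver.solve-∀

coprime-cross : ∀ {u y u′ y′} → 1 ≤ u → Coprime u y → Coprime u′ y′ → u * y′ ≡ u′ * y → u ≡ u′ × y ≡ y′
coprime-cross {u} {y} {u′} {y′} 1≤u u⊥y u′⊥y′ eq = u≡u′ ,
  sym (*-cancelˡ-≡ y′ y u {{>-nonZero 1≤u}} (trans eq (cong (_* y) (sym u≡u′))))
  where
  u∣u′ : u ∣ u′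
  u∣u′ = coprime-divisor u⊥y (subst (u ∣_) (trans eq (*-comm u′ y)) (m∣m*n y′))
  u′∣u : u′ ∣ u
  u′∣u = coprime-divisor u′⊥y′ (subst (u′ ∣_) (trans (sym eq) (*-comm u y′)) (m∣m*n y))
  u≡u′ : u ≡ u′
  u≡u′ = ∣-antisym u∣u′ u′∣u

-- The form x² − n y² in the coordinates u = x − A y and y, where A² − n = Q.
form : ℕ → ℕ → ℕ → ℕ → ℕ
form A Q u y = u * u + 2 * A * u * y + Q * (y * y)

-- For two points with the same value b, u y′ - u′ y is no positive multiple of b; exchanging the
-- points excludes the negative ones. Divisibility of this number by b then forces it to be 0.
Separated : ℕ → ℕ → Set
Separated A Q = ∀ {u y u′ y′} k → 1 ≤ u → 1 ≤ y → 1 ≤ u′ → 1 ≤ y′ → form A Q u y ≡ form A Q u′ y′ →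
                u * y′ ≢ u′ * y + suc k * form A Q u y

module _ {n : ℤ} (n≢0 : n ≢ 0ℤ) {A Q : ℕ} (A²≡Q+n : + (A * A) ≡ + Q +ᶻ n) (separated : Separated A Q) where

  form-represents : ∀ u y → + form A Q u y +ᶻ n *ᶻ + (y * y) ≡ + ((u + A * y) * (u + A * y))
  form-represents u y = begin
    + form A Q u y +ᶻ n *ᶻ + (y * y)
      ≡⟨ cong (_+ᶻ n *ᶻ + (y * y)) (cong (λ z → + (u * u + 2 * A * u * y) +ᶻ z) (ℤ.pos-* Q (y * y))) ⟩
    + (u * u + 2 * A * u * y) +ᶻ + Q *ᶻ + (y * y) +ᶻ n *ᶻ + (y * y)
      ≡⟨ factor (+ (u * u + 2 * A * u * y)) (+ Q) n (+ (y * y)) ⟩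
    + (u * u + 2 * A * u * y) +ᶻ (+ Q +ᶻ n) *ᶻ + (y * y)
      ≡⟨ cong (λ z → + (u * u + 2 * A * u * y) +ᶻ z *ᶻ + (y * y)) (sym A²≡Q+n) ⟩
    + (u * u + 2 * A * u * y) +ᶻ + (A * A) *ᶻ + (y * y)
      ≡⟨ cong (λ z → + (u * u + 2 * A * u * y) +ᶻ z) (sym (ℤ.pos-* (A * A) (y * y))) ⟩
    + (u * u + 2 * A * u * y + A * A * (y * y))
      ≡⟨ cong +_ (complete A u y) ⟩
    + ((u + A * y) * (u + A * y)) ∎
    where
    open ≡-Reasoning
    factor : ∀ p q n y → p +ᶻ q *ᶻ y +ᶻ n *ᶻ y ≡ p +ᶻ (q +ᶻ n) *ᶻ y
    factor = ℤSolver.solve-∀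
    complete : ∀ A u y → u * u + 2 * A * u * y + A * A * (y * y) ≡ (u + A * y) * (u + A * y)
    complete = solve-∀

  separate : ∀ {u y u′ y′} → 1 ≤ u → 1 ≤ y → 1 ≤ u′ → 1 ≤ y′ → form A Q u y ≡ form A Q u′ y′ →
             + form A Q u y ℤ.∣ + (u + A * y) *ᶻ + y′ -ᶻ + (u′ + A * y′) *ᶻ + y → u * y′ ≡ u′ * y
  separate {u} {y} {u′} {y′} 1≤u 1≤y 1≤u′ 1≤y′ b≡b′ (ℤ.divides q eq) = by-sign q uy′-u′y
    where
    b = form A Q u y
    -- The substitution x = u + A y has determinant 1 and preserves cross products.
    shear : ∀ u A y u′ y′ → (u +ᶻ A *ᶻ y) *ᶻ y′ -ᶻ (u′ +ᶻ A *ᶻ y′) *ᶻ y ≡ u *ᶻ y′ -ᶻ u′ *ᶻ y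
    shear = ℤSolver.solve-∀
    restore : ∀ p q → p -ᶻ q +ᶻ q ≡ p
    restore = ℤSolver.solve-∀
    restore′ : ∀ p q → p -ᶻ (p -ᶻ q) ≡ q
    restore′ = ℤSolver.solve-∀
    uy′-u′y : + (u * y′) -ᶻ + (u′ * y) ≡ q *ᶻ + b
    uy′-u′y = trans (cong₂ _-ᶻ_ (ℤ.pos-* u y′) (ℤ.pos-* u′ y)) (trans (sym (shear (+ u) (+ A) (+ y) (+ u′) (+ y′)))
      (trans (cong₂ (λ v v′ → (+ u +ᶻ v) *ᶻ + y′ -ᶻ (+ u′ +ᶻ v′) *ᶻ + y) (sym (ℤ.pos-* A y)) (sym (ℤ.pos-* A y′))) eq))
    by-sign : ∀ q → + (u * y′) -ᶻ + (u′ * y) ≡ q *ᶻ + b → u * y′ ≡ u′ * y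
    by-sign (+ zero) e = ℤ.+-injective (ℤ.i-j≡0⇒i≡j _ _ e)
    by-sign (+ suc k) e = ⊥-elim (separated k 1≤u 1≤y 1≤u′ 1≤y′ b≡b′
      (trans (ℤ.+-injective (trans (sym (restore (+ (u * y′)) (+ (u′ * y)))) (cong (_+ᶻ + (u′ * y))
        (trans e (sym (ℤ.pos-* (suc k) b)))))) (+-comm (suc k * b) (u′ * y))))
    by-sign -[1+ k ] e = ⊥-elim (separated k 1≤u′ 1≤y′ 1≤u 1≤y (sym b≡b′)
      (trans (ℤ.+-injective (trans (sym (restore′ (+ (u * y′)) (+ (u′ * y)))) (trans (cong (λ z → + (u * y′) -ᶻ z) e)
        (cong (λ z → + (u * y′) +ᶻ z) (trans (ℤ.neg-distribˡ-* -[1+ k ] (+ b)) (sym (ℤ.pos-* (suc k) b)))))))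
        (cong (λ z → u * y′ + suc k * z) b≡b′)))

  -- The shear y = v + j u keeps u and y coprime. The linear bound takes j = 0; for n = t² the
  -- choice j = t makes every value of the form exceed n.
  coprime-forms≤D2 : ∀ j U V (D : ℕ × ℕ → Bool) (down : ∀ {u v u′ v′} → u′ ≤ u → v′ ≤ v → T (D (u , v)) → T (D (u′ , v′))) N →
    (∀ {u v} → 1 ≤ u × u ≤ U → 1 ≤ v × v ≤ V → T (D (u , v)) → ∣ n ∣ < form A Q u (v + j * u) × form A Q u (v + j * u) ≤ N) →
    card (Sieve.coprimeᵇ U V D down) (grid U V) ≤ D2 n N
  coprime-forms≤D2 j U V D down N bounds = begin
    card (Sieve.coprimeᵇ U V D down) (grid U V)
      ≤⟨ card-injection (Sieve.coprimeᵇ U V D down) (pairᵇ n) _↝_ (grid U V) (square N)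
           (Unique-⊗ {g = λ _ → range V} (Unique-range U) (λ _ → Unique-range V)) total injective ⟩
    card (pairᵇ n) (square N)
      ≡⟨ sym (D2≡card n N) ⟩
    D2 n N ∎
    where
    open ≤-Reasoning
    _↝_ : ℕ × ℕ → ℕ × ℕ → Set
    (u , v) ↝ (a , b) = let y = v + j * u in
      1 ≤ u × 1 ≤ y × Coprime u y × b ≡ form A Q u y × ∃ λ s → Root n a b s × + b ℤ.∣ + s *ᶻ + y -ᶻ + (u + A * y)
    injective : ∀ {p p′ q} → p ↝ q → p′ ↝ q → p ≡ p′
    injective {u , v} {u′ , v′} {a , b} (1≤u , 1≤y , u⊥y , b≡ , s , ab , d) (1≤u′ , 1≤y′ , u′⊥y′ , b≡′ , s′ , ab′ , d′)
      = same (coprime-cross 1≤u u⊥y u′⊥y′ (separate 1≤u 1≤y 1≤u′ 1≤y′ (trans (sym b≡) b≡′) b∣xy′-x′y))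
      where
      y = v + j * u
      y′ = v′ + j * u′
      s≡s′ : s′ ≡ s
      s≡s′ = root-unique ab′ ab
      b∣xy′-x′y : + form A Q u y ℤ.∣ + (u + A * y) *ᶻ + y′ -ᶻ + (u′ + A * y′) *ᶻ + y
      b∣xy′-x′y = subst (λ b → + b ℤ.∣ + (u + A * y) *ᶻ + y′ -ᶻ + (u′ + A * y′) *ᶻ + y) b≡
        (cross-divides {b} {s} {u + A * y} {y} d
          (subst (λ s → + b ℤ.∣ + s *ᶻ + y′ -ᶻ + (u′ + A * y′)) s≡s′ d′))
      same : u ≡ u′ × y ≡ y′ → (u , v) ≡ (u′ , v′)
      same (refl , y≡y′) = cong (u ,_) (+-cancelʳ-≡ (j * u) v v′ y≡y′)
    total : ∀ {p} → p ∈ grid U V → T (Sieve.coprimeᵇ U V D down p) → ∃ λ q → q ∈ square N × T (pairᵇ n q) × p ↝ q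
    total {u , v} p∈ t with ∈-⊗⁻ (range U) p∈ | to (T-∧ {D (u , v)}) t
    ... | u∈ , v∈ | d , c =
      target (represented⇒pair n≢0 1≤y x⊥y (proj₁ (bounds (∈-range⁻ u∈) (∈-range⁻ v∈) d)) (form-represents u y))
      where
      y = v + j * u
      1≤u : 1 ≤ u
      1≤u = proj₁ (∈-range⁻ {N = U} u∈)
      1≤v : 1 ≤ v
      1≤v = proj₁ (∈-range⁻ {N = V} v∈)
      1≤y : 1 ≤ y
      1≤y = ≤-trans 1≤v (m≤m+n v (j * u))
      u⊥v : Coprime u v
      u⊥v = toWitness c
      u⊥y : Coprime u y
      u⊥y {i} (i∣u , i∣y) = u⊥v (i∣u , ∣m+n∣m⇒∣n (subst (i ∣_) (+-comm v (j * u)) i∣y) (∣n⇒∣m*n j i∣u))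
      x⊥y : Coprime (u + A * y) y
      x⊥y {i} (i∣x , i∣y) = u⊥y (∣m+n∣m⇒∣n (subst (i ∣_) (+-comm u (A * y)) i∣x) (∣n⇒∣m*n A i∣y) , i∣y)
      target : (∃ λ a → ∃ λ s → 1 ≤ a × a < form A Q u y × Root n a (form A Q u y) s ×
                 + form A Q u y ℤ.∣ + s *ᶻ + y -ᶻ + (u + A * y)) →
               ∃ λ q → q ∈ square N × T (pairᵇ n q) × (u , v) ↝ q
      target (a , s , 1≤a , a<b , ab , d′) = (a , form A Q u y) ,
        ∈-square⁺ 1≤a (≤-trans (<⇒≤ a<b) b≤N) (≤-trans 1≤a (<⇒≤ a<b)) b≤N , pair⁺ a<b (s , ab) ,
        1≤u , 1≤y , u⊥y , refl , s , ab , d′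
        where
        b≤N : form A Q u y ≤ N
        b≤N = proj₂ (bounds (∈-range⁻ u∈) (∈-range⁻ v∈) d)

-- Linear growth of the number of pairs

module LinearBound {n : ℤ} (n≢0 : n ≢ 0ℤ) where
  private
    κ = ∣ n ∣
    A = suc κ

  -- A = |n| + 1 makes Q = A² - n positive, so all coefficients of the form are positive even where
  -- x² - n y² is indefinite.
  positive-complement : ∀ n → ∃ λ Q → 1 ≤ Q × + (suc ∣ n ∣ * suc ∣ n ∣) ≡ + Q +ᶻ n
  positive-complement (+ m) with m≤n⇒∃[o]m+o≡n {m} {m + m * suc m} (m≤m+n m (m * suc m))
  ... | o , m+o≡ = suc o , s≤s z≤n , cong (λ z → + suc z) (trans (sym m+o≡) (+-comm m o))
  positive-complement -[1+ m ] = suc (suc m) * suc (suc m) + suc m , s≤s z≤n ,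
    sym (ℤ+.//-rightDividesʳ (+ suc m) (+ (suc (suc m) * suc (suc m))))

  -- A positive multiple of b as difference would give b ≤ u y′. But b exceeds u² by its first
  -- expression and y′² by its second, whence u < y′ < u.
  separated-definite : ∀ {Q} → 1 ≤ Q → Separated A Q
  separated-definite {Q} 1≤Q {u} {y} {u′} {y′} k 1≤u 1≤y 1≤u′ 1≤y′ b≡b′ eq =
    <-asym (*-cancelˡ-< u u y′ (<-≤-trans u²<b b≤uy′)) (*-cancelʳ-< y′ y′ u (<-≤-trans y′²<b b≤uy′))
    where
    open ≤-Reasoning
    b = form A Q u y
    b≤uy′ : b ≤ u * y′
    b≤uy′ = ≤-trans (m≤m+n b (k * b)) (≤-trans (m≤n+m (suc k * b) (u′ * y)) (≤-reflexive (sym eq)))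
    cross : ∀ {u y} → 1 ≤ u → 1 ≤ y → 1 ≤ 2 * A * u * y
    cross 1≤u 1≤y = *-mono-≤ {1} {2 * A * _} (*-mono-≤ {1} {2 * A} (s≤s z≤n) 1≤u) 1≤y
    u²<b : u * u < b
    u²<b = ≤-trans (m<m+n (u * u) (cross 1≤u 1≤y)) (m≤m+n _ (Q * (y * y)))
    y′²<b : y′ * y′ < b
    y′²<b = begin-strict
      y′ * y′                                        <⟨ m<n+m (y′ * y′) {u′ * u′ + 2 * A * u′ * y′} (≤-trans (*-mono-≤ 1≤u′ 1≤u′) (m≤m+n _ (2 * A * u′ * y′))) ⟩
      u′ * u′ + 2 * A * u′ * y′ + y′ * y′            ≤⟨ +-monoʳ-≤ _ (m≤n*m (y′ * y′) Q {{>-nonZero 1≤Q}}) ⟩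
      form A Q u′ y′                                 ≡⟨ sym b≡b′ ⟩
      b                                              ∎

  D2-linear : ∃ λ c → ∃ λ N₀ → ∀ N → N₀ ≤ N → N ≤ c * D2 n N
  D2-linear with positive-complement n
  -- B is the sum of the coefficients, so the form is at most B L² for u, v ≤ L. One factor 4 comes
  -- from (L + 1)² ≤ 4 L², the other from the sieve.
  ... | Q , 1≤Q , A²≡Q+n = 4 * B * 4 , B , λ N B≤N → bound N B≤N (integer-root (λ l → B * (l * l)) (*-zeroʳ B) mono N)
    where
    open ≤-Reasoning
    B = 1 + 2 * A + Q
    mono : ∀ l → B * (l * l) < B * (suc l * suc l)
    mono l = *-monoʳ-< B (*-mono-< {l} {suc l} ≤-refl ≤-refl)
    module _ (L : ℕ) where
      everything : ℕ × ℕ → Bool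
      everything _ = true
      open Sieve L L everything (λ _ _ _ → _) public
    fits : ∀ {L u v} → u ≤ L → v ≤ L → form A Q u v ≤ B * (L * L)
    fits {L} {u} {v} u≤L v≤L = begin
      u * u + 2 * A * u * v + Q * (v * v)
        ≤⟨ +-mono-≤ (+-mono-≤ (*-mono-≤ u≤L u≤L) (*-mono-≤ (*-monoʳ-≤ (2 * A) u≤L) v≤L)) (*-monoʳ-≤ Q (*-mono-≤ v≤L v≤L)) ⟩
      L * L + 2 * A * L * L + Q * (L * L)
        ≡⟨ collect A Q L ⟩
      B * (L * L) ∎
      where
      collect : ∀ A Q L → L * L + 2 * A * L * L + Q * (L * L) ≡ (1 + 2 * A + Q) * (L * L)
      collect = solve-∀
    exceeds : ∀ {u v} → 1 ≤ u → 1 ≤ v → κ < form A Q u v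
    exceeds {u} {v} 1≤u 1≤v = begin
      A                              ≤⟨ m≤n*m A 2 ⟩
      2 * A                          ≡⟨ sym (trans (*-identityʳ (2 * A * 1)) (*-identityʳ (2 * A))) ⟩
      2 * A * 1 * 1                  ≤⟨ *-mono-≤ (*-monoʳ-≤ (2 * A) 1≤u) 1≤v ⟩
      2 * A * u * v                  ≤⟨ m≤n+m _ (u * u) ⟩
      u * u + 2 * A * u * v          ≤⟨ m≤m+n _ (Q * (v * v)) ⟩
      form A Q u v                   ∎
    bound : ∀ N → B ≤ N → (∃ λ L → B * (L * L) ≤ N × N < B * (suc L * suc L)) → N ≤ 4 * B * 4 * D2 n N
    bound N B≤N (L , lower , upper) = begin
      N                              ≤⟨ <⇒≤ upper ⟩
      B * (suc L * suc L)            ≤⟨ *-monoʳ-≤ B (*-mono-≤ 1+L≤2L 1+L≤2L) ⟩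
      B * ((L + L) * (L + L))        ≡⟨ regroup B L ⟩
      4 * B * (L * L)                ≤⟨ *-monoʳ-≤ (4 * B) L²≤4D2 ⟩
      4 * B * (4 * D2 n N)           ≡⟨ sym (*-assoc (4 * B) 4 (D2 n N)) ⟩
      4 * B * 4 * D2 n N             ∎
      where
      regroup : ∀ b l → b * ((l + l) * (l + l)) ≡ 4 * b * (l * l)
      regroup = solve-∀
      1≤L : 1 ≤ L
      1≤L = n≢0⇒n>0 λ { refl → <⇒≱ upper (≤-trans (≤-reflexive (*-identityʳ B)) B≤N) }
      1+L≤2L : suc L ≤ L + L
      1+L≤2L = +-monoˡ-≤ L 1≤L
      fits′ : ∀ {u v} → 1 ≤ u × u ≤ L → 1 ≤ v × v ≤ L → T (everything L (u , v)) →
              κ < form A Q u (v + 0) × form A Q u (v + 0) ≤ N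
      fits′ {u} {v} (1≤u , u≤L) (1≤v , v≤L) _ =
        subst (λ v → κ < form A Q u v × form A Q u v ≤ N) (sym (+-identityʳ v))
          (exceeds 1≤u 1≤v , ≤-trans (fits u≤L v≤L) lower)
      L²≤4D2 : L * L ≤ 4 * D2 n N
      L²≤4D2 = begin
        L * L                                       ≡⟨ sym (cong₂ _*_ (length-range L) (length-range L)) ⟩
        length (range L) * length (range L)         ≡⟨ sym (length-⊗-const (range L) (range L)) ⟩
        length (grid L L)                           ≡⟨ sym (card-true (grid L L)) ⟩
        card (everything L) (grid L L)              ≤⟨ card≤4*coprime L ⟩
        4 * card (coprimeᵇ L) (grid L L)
          ≤⟨ *-monoʳ-≤ 4 (coprime-forms≤D2 n≢0 {A} {Q} A²≡Q+n (separated-definite 1≤Q) 0 L L (everything L) (λ _ _ _ → _) N fits′) ⟩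
        4 * D2 n N                                  ∎

open LinearBound using (D2-linear)

-- Faster growth when n is a square

-- Infinite descent: u² = v² + j u v forces u > j v, and (v , u − j v) is a smaller solution.
no-solution : ∀ {u v j} → 1 ≤ u → 1 ≤ v → 1 ≤ j → u * u ≢ v * v + j * u * v
no-solution {u} = go (<-wellFounded u)
  where
  go : ∀ {u v j} → Acc _<_ u → 1 ≤ u → 1 ≤ v → 1 ≤ j → u * u ≢ v * v + j * u * v
  go {u} {v} {j} (acc rec) 1≤u 1≤v 1≤j eq = step (m≤n⇒∃[o]m+o≡n jv<u)
    where
    open ≤-Reasoning
    commute : ∀ j u v → j * u * v ≡ u * (j * v)
    commute = solve-∀
    jv<u : j * v < u
    jv<u = *-cancelˡ-< u (j * v) u (begin-strict
      u * (j * v)            ≡⟨ sym (commute j u v) ⟩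
      j * u * v              <⟨ m<n+m (j * u * v) (*-mono-≤ 1≤v 1≤v) ⟩
      v * v + j * u * v      ≡⟨ sym eq ⟩
      u * u                  ∎)
    v<u : v < u
    v<u = ≤-<-trans (m≤n*m v j {{>-nonZero 1≤j}}) jv<u
    step : (∃ λ w → suc (j * v) + w ≡ u) → ⊥
    step (w , u≡) = go {v} {suc w} {j} (rec v<u) 1≤v (s≤s z≤n) 1≤j
      (+-cancelʳ-≡ (j * v * (j * v) + j * v * suc w) _ _ (begin-equality
        v * v + (j * v * (j * v) + j * v * suc w)             ≡⟨ left v j (suc w) ⟩
        v * v + j * (j * v + suc w) * v                       ≡⟨ cong (λ u → v * v + j * u * v) u≡′ ⟩
        v * v + j * u * v                                     ≡⟨ sym eq ⟩
        u * u                                                 ≡⟨ cong (λ u → u * u) (sym u≡′) ⟩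
        (j * v + suc w) * (j * v + suc w)                     ≡⟨ right v j (suc w) ⟩
        suc w * suc w + j * v * suc w + (j * v * (j * v) + j * v * suc w) ∎))
      where
      u≡′ : j * v + suc w ≡ u
      u≡′ = trans (+-suc (j * v) w) u≡
      left : ∀ v j w → v * v + (j * v * (j * v) + j * v * w) ≡ v * v + j * (j * v + w) * v
      left = solve-∀
      right : ∀ v j w → (j * v + w) * (j * v + w) ≡ w * w + j * v * w + (j * v * (j * v) + j * v * w)
      right = solve-∀

-- With Q = 0 the value b need not exceed y′², so size no longer decides. Instead y and y′ can be
-- eliminated, which leaves u² = u′² + j u u′ with j = 2 t (k + 1).
separated-split : ∀ {t} → 1 ≤ t → Separated t 0
separated-split {t} 1≤t {u} {y} {u′} {y′} k 1≤u 1≤y 1≤u′ 1≤y′ b≡b′ eq =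
  no-solution {u} {u′} {2 * t * suc k} 1≤u 1≤u′ (*-mono-≤ {1} {2 * t} (*-mono-≤ {1} {2} (s≤s z≤n) 1≤t) (s≤s z≤n))
    (*-cancelʳ-≡ (u * u) (u′ * u′ + 2 * t * suc k * u * u′) b {{>-nonZero 1≤b}} (begin-equality
      u * u * b                                        ≡⟨ cong (λ z → u * u * z) b≡b′ ⟩
      u * u * form t 0 u′ y′                           ≡⟨ left t u u′ y′ ⟩
      u * u * (u′ * u′) + 2 * t * u * u′ * (u * y′)    ≡⟨ cong (λ z → u * u * (u′ * u′) + 2 * t * u * u′ * z) eq ⟩
      u * u * (u′ * u′) + 2 * t * u * u′ * (u′ * y + suc k * b) ≡⟨ right t (suc k) u y u′ b ⟩
      u′ * u′ * form t 0 u y + 2 * t * suc k * u * u′ * b ≡⟨ sym (*-distribʳ-+ b (u′ * u′) (2 * t * suc k * u * u′)) ⟩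
      (u′ * u′ + 2 * t * suc k * u * u′) * b           ∎))
  where
  open ≤-Reasoning
  b = form t 0 u y
  1≤b : 1 ≤ b
  1≤b = ≤-trans (*-mono-≤ 1≤u 1≤u) (≤-trans (m≤m+n (u * u) (2 * t * u * y)) (m≤m+n _ 0))
  left : ∀ t u u′ y′ → u * u * (u′ * u′ + 2 * t * u′ * y′ + 0) ≡ u * u * (u′ * u′) + 2 * t * u * u′ * (u * y′)
  left = solve-∀
  right : ∀ t k u y u′ b → u * u * (u′ * u′) + 2 * t * u * u′ * (u′ * y + k * b) ≡
                           u′ * u′ * (u * u + 2 * t * u * y + 0) + 2 * t * k * u * u′ * b
  right = solve-∀

sum-map-range-suc : (f : ℕ → ℕ) (n : ℕ) → sum (map f (range (suc n))) ≡ sum (map f (range n)) + f (suc n)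
sum-map-range-suc f n = trans (cong sum (sym (map-∘ (upTo (suc n)))))
  (trans (sum-map-upTo-suc (f ∘ suc) n) (cong (λ z → sum z + f (suc n)) (map-∘ (upTo n))))

sum-map-range-+ : (f : ℕ → ℕ) (c m k : ℕ) → (∀ {i} → i ≤ m + k → c ≤ f i) →
                  sum (map f (range m)) + k * c ≤ sum (map f (range (m + k)))
sum-map-range-+ f c m zero _ = ≤-reflexive (trans (+-identityʳ _) (cong (λ z → sum (map f (range z))) (sym (+-identityʳ m))))
sum-map-range-+ f c m (suc k) c≤f = begin
  sum (map f (range m)) + (c + k * c)       ≡⟨ rotate _ c (k * c) ⟩
  sum (map f (range m)) + k * c + c         ≤⟨ +-mono-≤ (sum-map-range-+ f c m k (λ i≤ → c≤f (≤-trans i≤ (+-monoʳ-≤ m (n≤1+n k)))))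
                                                 (c≤f (≤-reflexive (sym (+-suc m k)))) ⟩
  sum (map f (range (m + k))) + f (suc (m + k)) ≡⟨ sym (sum-map-range-suc f (m + k)) ⟩
  sum (map f (range (suc (m + k))))         ≡⟨ cong (λ z → sum (map f (range z))) (sym (+-suc m k)) ⟩
  sum (map f (range (m + suc k)))           ∎
  where
  open ≤-Reasoning
  rotate : ∀ a b c → a + (b + c) ≡ a + c + b
  rotate = solve-∀

module Hyperbola (J V : ℕ) where
  -- A multiple of 2^J, so that the quotients of W by the ends 2^(i+1) of the dyadic blocks are
  -- exact.
  W = 2 ^ J * V

  below : ℕ × ℕ → Bool
  below (u , v) = ⌊ u * v ≤? W ⌋

  below-down : ∀ {u v u′ v′} → u′ ≤ u → v′ ≤ v → T (below (u , v)) → T (below (u′ , v′))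
  below-down u′≤u v′≤v p = fromWitness (≤-trans (*-mono-≤ u′≤u v′≤v) (toWitness p))

  row : ℕ → ℕ
  row u = card (λ v → below (u , v)) (range W)

  row≥ : ∀ {u c} → c ≤ W → u * c ≤ W → c ≤ row u
  row≥ {u} {c} c≤W uc≤W = begin
    c                                ≡⟨ sym (trans (card-true (range c)) (length-range c)) ⟩
    card (const true) (range c)
      ≤⟨ card-injection (const true) (λ v → below (u , v)) _≡_ (range c) (range W) (Unique-range c) total
           (λ p q → trans p (sym q)) ⟩
    row u                            ∎
    where
    open ≤-Reasoning
    total : ∀ {v} → v ∈ range c → T true → ∃ λ y → y ∈ range W × T (below (u , y)) × v ≡ y
    total {v} v∈ _ with ∈-range⁻ v∈
    ... | 1≤v , v≤c = v , ∈-range⁺ 1≤v (≤-trans v≤c c≤W) , fromWitness (≤-trans (*-monoʳ-≤ u v≤c) uc≤W) , refl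

  -- The dyadic block 2^i < u ≤ 2^(i+1) contributes at least W / 2.
  dyadic : ∀ i r → i + r ≡ J → i * W ≤ 2 * sum (map row (range (2 ^ i)))
  dyadic zero r _ = z≤n
  dyadic (suc i) r i+r≡J = begin
    W + i * W                                          ≡⟨ +-comm W (i * W) ⟩
    i * W + W                                          ≤⟨ +-mono-≤ (dyadic i (suc r) (trans (+-suc i r) i+r≡J)) (≤-reflexive W≡) ⟩
    2 * sum (map row (range (2 ^ i))) + 2 * (2 ^ i * c)  ≡⟨ sym (*-distribˡ-+ 2 (sum (map row (range (2 ^ i)))) (2 ^ i * c)) ⟩
    2 * (sum (map row (range (2 ^ i))) + 2 ^ i * c)    ≤⟨ *-monoʳ-≤ 2 (sum-map-range-+ row c (2 ^ i) (2 ^ i) c≤row) ⟩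
    2 * sum (map row (range (2 ^ i + 2 ^ i)))          ≡⟨ cong (λ z → 2 * sum (map row (range z))) (cong (λ z → 2 ^ i + z) (sym (+-identityʳ (2 ^ i)))) ⟩
    2 * sum (map row (range (2 ^ suc i)))              ∎
    where
    open ≤-Reasoning
    c = 2 ^ r * V
    regroup : ∀ a b v → 2 * a * b * v ≡ 2 * (a * (b * v))
    regroup = solve-∀
    W≡ : W ≡ 2 * (2 ^ i * c)
    W≡ = trans (cong (λ z → 2 ^ z * V) (sym i+r≡J)) (trans (cong (_* V) (^-distribˡ-+-* 2 (suc i) r))
      (regroup (2 ^ i) (2 ^ r) V))
    c≤row : ∀ {u} → u ≤ 2 ^ i + 2 ^ i → c ≤ row u
    c≤row {u} u≤ = row≥ {u} (begin
        c                            ≤⟨ m≤n*m c (2 ^ suc i) {{m^n≢0 2 (suc i)}} ⟩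
        2 ^ suc i * c                ≡⟨ *-assoc 2 (2 ^ i) c ⟩
        2 * (2 ^ i * c)              ≡⟨ sym W≡ ⟩
        W                            ∎)
      (begin
        u * c                        ≤⟨ *-monoˡ-≤ c u≤ ⟩
        (2 ^ i + 2 ^ i) * c          ≡⟨ double (2 ^ i) c ⟩
        2 * (2 ^ i * c)              ≡⟨ sym W≡ ⟩
        W                            ∎)
      where
      double : ∀ a c → (a + a) * c ≡ 2 * (a * c)
      double = solve-∀

  open Sieve (2 ^ J) W below below-down public

  J*W≤8*coprime : J * W ≤ 8 * card coprimeᵇ (grid (2 ^ J) W)
  J*W≤8*coprime = begin
    J * W                                     ≤⟨ dyadic J 0 (+-identityʳ J) ⟩
    2 * sum (map row (range (2 ^ J)))         ≡⟨ cong (λ z → 2 * z) (sym (card-⊗ below (range (2 ^ J)) (λ _ → range W))) ⟩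
    2 * card below (grid (2 ^ J) W)           ≤⟨ *-monoʳ-≤ 2 card≤4*coprime ⟩
    2 * (4 * card coprimeᵇ (grid (2 ^ J) W))  ≡⟨ sym (*-assoc 2 4 (card coprimeᵇ (grid (2 ^ J) W))) ⟩
    8 * card coprimeᵇ (grid (2 ^ J) W)        ∎
    where open ≤-Reasoning

module SquareCase {t : ℕ} (1≤t : 1 ≤ t) where
  private
    n = + (t * t)
    n≢0 : n ≢ 0ℤ
    n≢0 e = <⇒≢ (*-mono-≤ 1≤t 1≤t) (sym (ℤ.+-injective e))

  -- J takes the place of log N: it stays fixed while N grows, which is enough for a ratio that
  -- exceeds every constant.
  D2-dyadic : ∀ J → ∃ λ N₀ → ∀ N → N₀ ≤ N → J * N ≤ 4 * t * 8 * D2 n N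
  D2-dyadic J = 2 * (E + R) , λ N large → bound N large
      (integer-root (R *_) (*-zeroʳ R) (λ l → *-monoʳ-< R {{>-nonZero 1≤R}} ≤-refl) (N ∸ E))
    where
    open ≤-Reasoning
    P = 2 ^ J
    -- On the region the form (1 + 2 t²) u² + 2 t u v is at most E + R V, and V is the largest
    -- number that keeps this within N. For N ≥ 2 (E + R) the part R V is at least N / 2.
    E = (1 + 2 * t * t) * (P * P)
    R = 2 * t * P
    1≤R : 1 ≤ R
    1≤R = *-mono-≤ {1} {2 * t} (*-mono-≤ {1} {2} (s≤s z≤n) 1≤t) (>-nonZero⁻¹ P {{m^n≢0 2 J}})
    bound : ∀ N → 2 * (E + R) ≤ N → (∃ λ V → R * V ≤ N ∸ E × N ∸ E < R * suc V) → J * N ≤ 4 * t * 8 * D2 n N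
    bound N large (V , lower , upper) = begin
      J * N                          ≤⟨ *-monoʳ-≤ J N≤2RV ⟩
      J * (2 * (R * V))              ≡⟨ regroup J t P V ⟩
      4 * t * (J * W)                ≤⟨ *-monoʳ-≤ (4 * t) J*W≤8*coprime ⟩
      4 * t * (8 * card coprimeᵇ (grid P W))
        ≤⟨ *-monoʳ-≤ (4 * t) (*-monoʳ-≤ 8 (coprime-forms≤D2 {n} n≢0 {t} {0} refl (separated-split 1≤t) t P W below below-down N fits)) ⟩
      4 * t * (8 * D2 n N)           ≡⟨ sym (*-assoc (4 * t) 8 (D2 n N)) ⟩
      4 * t * 8 * D2 n N             ∎
      where
      open Hyperbola J V
      E≤N : E ≤ N
      E≤N = ≤-trans (≤-trans (m≤m+n E R) (m≤m+n (E + R) _)) large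
      N≡ : N ≡ E + (N ∸ E)
      N≡ = sym (m+[n∸m]≡n E≤N)
      regroup : ∀ J t P V → J * (2 * (2 * t * P * V)) ≡ 4 * t * (J * (P * V))
      regroup = solve-∀
      N≤2RV : N ≤ 2 * (R * V)
      N≤2RV = +-cancelʳ-≤ N N (2 * (R * V)) (begin
        N + N                              ≤⟨ +-mono-≤ N≤ N≤ ⟩
        E + R * suc V + (E + R * suc V)    ≡⟨ collect E R V ⟩
        2 * (R * V) + 2 * (E + R)          ≤⟨ +-monoʳ-≤ (2 * (R * V)) large ⟩
        2 * (R * V) + N                    ∎)
        where
        N≤ : N ≤ E + R * suc V
        N≤ = ≤-trans (≤-reflexive N≡) (+-monoʳ-≤ E (<⇒≤ upper))
        collect : ∀ E R V → E + R * suc V + (E + R * suc V) ≡ 2 * (R * V) + 2 * (E + R)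
        collect = solve-∀
      fits : ∀ {u v} → 1 ≤ u × u ≤ P → 1 ≤ v × v ≤ W → T (below (u , v)) →
             t * t < form t 0 u (v + t * u) × form t 0 u (v + t * u) ≤ N
      fits {u} {v} (1≤u , u≤P) (1≤v , v≤W) p = t²<form , form≤N
        where
        expand : ∀ t u v → u * u + 2 * t * u * (v + t * u) + 0 ≡ (1 + 2 * t * t) * (u * u) + 2 * t * (u * v)
        expand = solve-∀
        t²<form : t * t < form t 0 u (v + t * u)
        t²<form = begin-strict
          t * t                                        <⟨ m<n+m (t * t) {1 + t * t} (s≤s z≤n) ⟩
          1 + t * t + t * t                            ≡⟨ twice t ⟩
          (1 + 2 * t * t) * 1                          ≤⟨ *-monoʳ-≤ (1 + 2 * t * t) (*-mono-≤ 1≤u 1≤u) ⟩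
          (1 + 2 * t * t) * (u * u)                    ≤⟨ m≤m+n _ (2 * t * (u * v)) ⟩
          (1 + 2 * t * t) * (u * u) + 2 * t * (u * v)  ≡⟨ sym (expand t u v) ⟩
          form t 0 u (v + t * u)                       ∎
          where
          twice : ∀ t → 1 + t * t + t * t ≡ (1 + 2 * t * t) * 1
          twice = solve-∀
        form≤N : form t 0 u (v + t * u) ≤ N
        form≤N = begin
          form t 0 u (v + t * u)                       ≡⟨ expand t u v ⟩
          (1 + 2 * t * t) * (u * u) + 2 * t * (u * v)  ≤⟨ +-mono-≤ (*-monoʳ-≤ (1 + 2 * t * t) (*-mono-≤ u≤P u≤P)) (*-monoʳ-≤ (2 * t) (toWitness p)) ⟩
          E + 2 * t * (P * V)                          ≡⟨ cong (λ z → E + z) (sym (*-assoc (2 * t) P V)) ⟩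
          E + R * V                                    ≤⟨ +-monoʳ-≤ E lower ⟩
          E + (N ∸ E)                                  ≡⟨ sym N≡ ⟩
          N                                            ∎

  id≪D2 : (λ N → N) ≪ D2 n
  id≪D2 k = cancel (4 * t * 8) (*-mono-≤ {1} {4 * t} (*-mono-≤ {1} {4} (s≤s z≤n) 1≤t) (s≤s z≤n)) D2-dyadic
    where
    cancel : ∀ w → 1 ≤ w → (∀ J → ∃ λ N₀ → ∀ N → N₀ ≤ N → J * N ≤ w * D2 n N) →
             ∃ λ N₀ → ∀ N → N₀ ≤ N → k * N ≤ D2 n N
    cancel w 1≤w bound with bound (w * k)
    ... | N₀ , b = N₀ , λ N N₀≤N → *-cancelˡ-≤ w {{>-nonZero 1≤w}}
      (≤-trans (≤-reflexive (sym (*-assoc w k N))) (b N N₀≤N))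

open SquareCase using (id≪D2)

-- Orders of growth and the conclusion

linear⇒const≪ : ∀ {f : ℕ → ℕ} → (∃ λ c → ∃ λ N₀ → ∀ N → N₀ ≤ N → N ≤ c * f N) → ∀ B → const B ≪ f
linear⇒const≪ {f} (c , N₀ , linear) B k = N₀ + suc c * (k * B) , λ N large →
  *-cancelˡ-≤ (suc c) (≤-trans (m≤n+m (suc c * (k * B)) N₀) (≤-trans large
    (≤-trans (linear N (≤-trans (m≤m+n N₀ _) large)) (*-monoˡ-≤ (f N) (n≤1+n c)))))

≪-linear : ∀ {f g : ℕ → ℕ} → f ≪ (λ N → N) → (∃ λ c → ∃ λ N₀ → ∀ N → N₀ ≤ N → N ≤ c * g N) → f ≪ g
≪-linear {f} {g} f≪id (c , N₀ , linear) k with f≪id (suc c * k)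
... | N₁ , small = N₀ + N₁ , λ N large → *-cancelˡ-≤ (suc c) (begin
  suc c * (k * f N)      ≡⟨ sym (*-assoc (suc c) k (f N)) ⟩
  suc c * k * f N        ≤⟨ small N (≤-trans (m≤n+m N₁ N₀) large) ⟩
  N                      ≤⟨ linear N (≤-trans (m≤m+n N₀ N₁) large) ⟩
  c * g N                ≤⟨ *-monoˡ-≤ (g N) (n≤1+n c) ⟩
  suc c * g N            ∎)
  where open ≤-Reasoning

≪-+ : ∀ {f g h : ℕ → ℕ} → f ≪ h → g ≪ h → (λ N → f N + g N) ≪ h
≪-+ {f} {g} {h} f≪h g≪h k with f≪h (2 * k) | g≪h (2 * k)
... | N₀ , f≤ | N₁ , g≤ = N₀ + N₁ , λ N large → *-cancelˡ-≤ 2 (begin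
  2 * (k * (f N + g N))          ≡⟨ distribute k (f N) (g N) ⟩
  2 * k * f N + 2 * k * g N      ≤⟨ +-mono-≤ (f≤ N (≤-trans (m≤m+n N₀ N₁) large)) (g≤ N (≤-trans (m≤n+m N₁ N₀) large)) ⟩
  h N + h N                      ≡⟨ cong (λ z → h N + z) (sym (+-identityʳ (h N))) ⟩
  2 * h N                        ∎)
  where
  open ≤-Reasoning
  distribute : ∀ k a b → 2 * (k * (a + b)) ≡ 2 * k * a + 2 * k * b
  distribute = solve-∀

-- For square n there is one possible exception for each c ≤ N, which a linear lower bound for `D2`
-- could not absorb; `id≪D2` does.
squareOnly≪D2 : ∀ {n} → n ≢ 0ℤ → (λ N → length (squareOnly n N)) ≪ D2 n
squareOnly≪D2 {n} n≢0 with isSquareᵇ n in eq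
... | false = λ k → 0 , λ N _ → subst (_≤ D2 n N) (sym (*-zeroʳ k)) z≤n
... | true = λ k → from-root k (isSquare⁻ {n} (subst T (sym eq) _))
  where
  from-root : ∀ k → (∃ λ t → n ≡ + (t * t)) → ∃ λ N₀ → ∀ N → N₀ ≤ N → k * length (range N) ≤ D2 n N
  from-root k (t , n≡t²) = subst (λ n → ∃ λ N₀ → ∀ N → N₀ ≤ N → k * length (range N) ≤ D2 n N) (sym n≡t²)
    (N₀ , λ N large → subst (λ z → k * z ≤ D2 (+ (t * t)) N) (sym (length-range N)) (proj₂ (id≪D2 1≤t k) N large))
    where
    1≤t : 1 ≤ t
    1≤t = n≢0⇒n>0 λ t≡0 → n≢0 (trans n≡t² (cong (λ t → + (t * t)) t≡0))
    N₀ = proj₁ (id≪D2 1≤t k)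

ratio⇒∼ : ∀ {f g h : ℕ → ℕ} → h ≪ g → (∀ N → ℕ.∣ f N - g N ∣ ≤ h N) → f ∼ g
ratio⇒∼ h≪g close k = proj₁ (h≪g (suc k)) , λ N large →
  ≤-trans (*-monoʳ-≤ (suc k) (close N)) (proj₂ (h≪g (suc k)) N large)

theorem22 : (n : ℤ) → n ≢ 0ℤ →
    ((λ N → D3 n N) ∼ (λ N → D3reg n N)) × ((λ N → 2 * D3reg n N) ∼ (λ N → D2 n N))
theorem22 n n≢0 = triples∼regular , regular∼pairs
  where
  open ≤-Reasoning
  B = 2 * ∣ n ∣ * (2 * ∣ n ∣)

  exceptions : ℕ → ℕ
  exceptions N = B + length (squareOnly n N)

  exceptions≪D2 : exceptions ≪ D2 n
  exceptions≪D2 = ≪-+ (linear⇒const≪ (D2-linear n≢0) B) (squareOnly≪D2 n≢0)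

  -- Carries the lower bound over from pairs to regular triples, against which the irregular ones
  -- are measured.
  D2≤4*D3reg : ∀ N → 2 * exceptions N ≤ D2 n N → D2 n N ≤ 4 * D3reg n N
  D2≤4*D3reg N few = +-cancelʳ-≤ (D2 n N) (D2 n N) (4 * D3reg n N) (begin
    D2 n N + D2 n N
      ≡⟨ cong (λ z → D2 n N + z) (sym (+-identityʳ (D2 n N))) ⟩
    2 * D2 n N
      ≤⟨ *-monoʳ-≤ 2 (D2≤2*D3reg+exceptions n≢0 N) ⟩
    2 * (2 * D3reg n N + exceptions N)
      ≡⟨ distribute (D3reg n N) (exceptions N) ⟩
    4 * D3reg n N + 2 * exceptions N
      ≤⟨ +-monoʳ-≤ (4 * D3reg n N) few ⟩
    4 * D3reg n N + D2 n N ∎)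
    where
    distribute : ∀ d e → 2 * (2 * d + e) ≡ 4 * d + 2 * e
    distribute = solve-∀

  D3irr≪D2 : D3irr n ≪ D2 n
  D3irr≪D2 = ≪-linear (D3irr≪id n≢0) (D2-linear n≢0)

  D3irr≪D3reg : D3irr n ≪ D3reg n
  D3irr≪D3reg k = conclude (exceptions≪D2 2) (D3irr≪D2 (4 * k))
    where
    conclude : (∃ λ N₀ → ∀ N → N₀ ≤ N → 2 * exceptions N ≤ D2 n N) →
               (∃ λ N₀ → ∀ N → N₀ ≤ N → 4 * k * D3irr n N ≤ D2 n N) →
               ∃ λ N₀ → ∀ N → N₀ ≤ N → k * D3irr n N ≤ D3reg n N
    conclude (N₀ , few) (N₁ , rare) = N₀ + N₁ , λ N large → *-cancelˡ-≤ 4 (begin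
      4 * (k * D3irr n N)         ≡⟨ sym (*-assoc 4 k (D3irr n N)) ⟩
      4 * k * D3irr n N           ≤⟨ rare N (≤-trans (m≤n+m N₁ N₀) large) ⟩
      D2 n N                      ≤⟨ D2≤4*D3reg N (few N (≤-trans (m≤m+n N₀ N₁) large)) ⟩
      4 * D3reg n N               ∎)

  triples∼regular : D3 n ∼ D3reg n
  triples∼regular = ratio⇒∼ {D3 n} {D3reg n} {D3irr n} D3irr≪D3reg λ N → ≤-reflexive
    (trans (cong (λ z → ℕ.∣ z - D3reg n N ∣) (D3≡D3reg+D3irr n N))
      (trans (∣-∣-comm (D3reg n N + D3irr n N) (D3reg n N)) (∣m-m+n∣≡n (D3reg n N) (D3irr n N))))

  regular∼pairs : (λ N → 2 * D3reg n N) ∼ D2 n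
  regular∼pairs = ratio⇒∼ {λ N → 2 * D3reg n N} {D2 n} {exceptions} exceptions≪D2 λ N → subst (_≤ exceptions N)
    (sym (m≤n⇒∣m-n∣≡n∸m (2*D3reg≤D2 n N)))
    (m≤n+o⇒m∸n≤o (D2 n N) (2 * D3reg n N) (D2≤2*D3reg+exceptions n≢0 N))
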